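{- The set $\{\mathbf n_\pi:\pi\text{ a set partition of }[n]\text{ all of whose blocks have odd size}\}$ is a basis of $\mathrm{NCSym}_n\cap\mathrm{NC}\Pi_n$ (and hence, over all $n$, of $\mathrm{NCSym}\cap\mathrm{NC}\Pi$).
   Context: Let $\mathbf x_1,\mathbf x_2,\dots$ be noncommuting variables over $\mathbb Q$, $[m]=\{1,\dots,m\}$. A set composition $\phi=\phi_1|\cdots|\phi_\ell$ of $[n]$ is a sequence of disjoint nonempty blocks with union $[n]$, $\ell(\phi)=\ell$; it is odd if all blocks have odd size; $\pi(\phi)$ is the set partition with the same blocks. For $\psi,\phi$ set compositions, $\psi\le\phi$ if each block of $\psi$ is a union of consecutive blocks of $\phi$. $\mathbf M_\phi=\sum\mathbf x_{i_1}\cdots\mathbf x_{i_n}$ over tuples of positive integers with $i_j=i_k$ iff $j,k$ in the same block and $i_j<i_k$ iff the block of $j$ is left of that of $k$. $\mathrm{NCQSym}_n=\mathrm{span}\{\mathbf M_\phi\}$; for a set partition $\pi$, $\mathbf m_\pi=\sum_{\pi(\phi)=\pi}\mathbf M_\phi$ and $\mathrm{NCSym}_n=\mathrm{span}\{\mathbf m_\pi:\pi\text{ set partition of }[n]\}$. Order nonzero integers by $-1\prec1\prec-2\prec2\prec\cdots$. For a poset $P$ on an $n$-set $X$ and bijections $\gamma,\sigma:X\to[n]$, an enriched $(P,\gamma)$-partition is $f:X\to\mathbb Z\setminus\{0\}$ with, for $a\le b$: $f(a)\preceq f(b)$, $f(a)=f(b)>0\Rightarrow\gamma(a)<\gamma(b)$,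 $f(a)=f(b)<0\Rightarrow\gamma(a)>\gamma(b)$; $\mathbf K_{(P,\gamma,\sigma)}=\sum_f\mathbf x_{|f(\sigma^{ -1}(1))|}\cdots\mathbf x_{|f(\sigma^{ -1}(n))|}$, and $\mathrm{NC}\Pi_n$ is the span of all such with $|X|=n$. For a peak set $B$ (subset of $\{2,\dots,n-1\}$ with no two consecutive integers) and $\sigma\in\mathfrak S_n$, $\mathbf K_{(B,\sigma)}=\mathbf K_{(P,\gamma,\sigma)}$ with $P$ the chain $1<\cdots<n$ and any $\gamma$ with $\{i:\gamma(i-1)<\gamma(i)>\gamma(i+1)\}=B$ (well defined), and $\boldsymbol\eta_{(B,\sigma)}=\sum_{C\subseteq B}(-1)^{|B|-|C|}\mathbf K_{(C,\sigma)}$. With $\mathrm{Odd}(B)=[n-1]\setminus(B\cup(B-1))$, each odd set composition $\phi$ equals $\{\sigma(1),\dots,\sigma(a_1)\}|\{\sigma(a_1+1),\dots,\sigma(a_2)\}|\cdots$ for a unique pair $(B,\sigma)$ with $\mathrm{Odd}(B)=\{a_1<a_2<\cdots\}$ and $\{i:\sigma(i)>\sigma(i+1)\}\subseteq\mathrm{Odd}(B)$; set $\boldsymbol\eta_\phi=\boldsymbol\eta_{(B,\sigma)}$. For a set partition $\pi$ of $[n]$ with all blocks odd, $\mathbf n_\pi=(-1)^{(n-\ell(\pi))/2}\sum_{\phi}\boldsymbol\eta_\phi$, summed over set compositions $\phi$ with $\pi(\phi)=\pi$. -}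

module Defs where

open import Data.Bool.Base using (Bool; true; false; _∧_; _∨_; not; _xor_; if_then_else_; T)
open import Data.Nat.Base using (ℕ; zero; suc; _+_; _∸_; _/_; _%_; _≡ᵇ_; _<ᵇ_)
open import Data.Fin.Base using (Fin; toℕ)
open import Data.List.Base using (List; []; _∷_; map; concatMap; filterᵇ; length; upTo; allFin; foldr)
open import Data.Bool.ListAction using (all; any)
open import Data.Vec.Functional using () renaming (_∷_ to _∷ᶠ_)
open import Data.Product.Base using (Σ; _×_; _,_; proj₁; proj₂; ∃)
open import Data.Integer.Base using (+_)
import Data.Rational.Base as Q
open import Data.Rational.Base using (ℚ; 0ℚ; 1ℚ)
open import Relation.Binary.PropositionalEquality using (_≡_)
open import Data.Fin.Permutation using (Permutation′; _⟨$⟩ʳ_; _⟨$⟩ˡ_)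

allFuns : ∀ n {A : Set} → List A → List (Fin n → A)
allFuns zero    xs = (λ ()) ∷ []
allFuns (suc n) xs = concatMap (λ a → map (λ f → a ∷ᶠ f) (allFuns n xs)) xs

count : {A : Set} → (A → Bool) → List A → ℕ
count p xs = length (filterᵇ p xs)

fromℕ : ℕ → ℚ
fromℕ k = Q._/_ (+ k) 1

sumℚ : List ℚ → ℚ
sumℚ = foldr Q._+_ 0ℚ

signℚ : ℕ → ℚ
signℚ k = if k % 2 ≡ᵇ 0 then 1ℚ else Q.-_ 1ℚ

_==ᶠ_ : ∀ {a b} → Fin a → Fin b → Bool
i ==ᶠ j = toℕ i ≡ᵇ toℕ j

_<ᶠ_ : ∀ {a b} → Fin a → Fin b → Bool
i <ᶠ j = toℕ i <ᵇ toℕ j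

_⇔ᵇ_ : Bool → Bool → Bool
a ⇔ᵇ b = not (a xor b)

allPairs : ∀ {n} → (Fin n → Fin n → Bool) → Bool
allPairs {n} p = all (λ j → all (λ k → p j k) (allFin n)) (allFin n)

-- Words and formal series of degree n in noncommuting variables.
-- A word x_{i_1}⋯x_{i_n} is a map Fin n → ℕ, where the letter k : ℕ
-- stands for the variable x_{k+1}.  A homogeneous series of degree n
-- is its coefficient function.

Word : ℕ → Set
Word n = Fin n → ℕ

Series : ℕ → Set
Series n = Word n → ℚ

lincomb : ∀ {n} {A : Set} → (A → Series n) → List (ℚ × A) → Series n
lincomb f L w = sumℚ (map (λ p → Q._*_ (proj₁ p) (f (proj₂ p) w)) L)

InSpan : ∀ {n} {A : Set} → (A → Series n) → Series n → Set
InSpan {n} {A} f s = Σ (List (ℚ × A)) λ L → ∀ w → s w ≡ lincomb f L w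

-- Set compositions of [n] = Fin n: a surjection onto the block indices
-- Fin ℓ (block 0 leftmost).  A set partition is represented by any set
-- composition having its blocks; two represent the same partition iff
-- they have the same blocks (sameBlocks).

record SetComp (n : ℕ) : Set where
  field
    ℓ    : ℕ
    blk  : Fin n → Fin ℓ
    surj : ∀ b → ∃ λ a → blk a ≡ b

RawComp : ℕ → Set
RawComp n = Σ ℕ λ ℓ → Fin n → Fin ℓ

toRaw : ∀ {n} → SetComp n → RawComp n
toRaw φ = SetComp.ℓ φ , SetComp.blk φ

isSurj : ∀ {n ℓ} → (Fin n → Fin ℓ) → Bool
isSurj {n} {ℓ} c = all (λ b → any (λ a → c a ==ᶠ b) (allFin n)) (allFin ℓ)

setComps : ∀ n → List (RawComp n)
setComps n = concatMap (λ ℓ → map (λ c → ℓ , c) (filterᵇ isSurj (allFuns n (allFin ℓ)))) (upTo (suc n))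

sameBlocks : ∀ {n} → RawComp n → RawComp n → Bool
sameBlocks (_ , c) (_ , d) = allPairs (λ j k → (c j ==ᶠ c k) ⇔ᵇ (d j ==ᶠ d k))

blockSize : ∀ {n ℓ} → (Fin n → Fin ℓ) → Fin ℓ → ℕ
blockSize {n} c b = count (λ a → c a ==ᶠ b) (allFin n)

M : ∀ {n} → RawComp n → Series n
M (_ , c) w =
  if allPairs (λ j k → ((w j ≡ᵇ w k) ⇔ᵇ (c j ==ᶠ c k)) ∧ ((w j <ᵇ w k) ⇔ᵇ (c j <ᶠ c k)))
  then 1ℚ else 0ℚ

m : ∀ {n} → SetComp n → Series n
m {n} π w = sumℚ (map (λ φ → M φ w) (filterᵇ (sameBlocks (toRaw π)) (setComps n)))

NCSym : ∀ n → Series n → Set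
NCSym n = InSpan (λ (π : SetComp n) → m π)

-- Enriched P-partitions.
-- A signed value ±(k+1) is encoded as (k , neg) with neg = true for the
-- negative one.  The order -1 ≺ 1 ≺ -2 ≺ 2 ≺ ⋯ becomes:
_≼_ : ℕ × Bool → ℕ × Bool → Bool
(k , s) ≼ (k' , s') = (k <ᵇ k') ∨ ((k ≡ᵇ k') ∧ (s ∨ not s'))

-- Coefficient of the word w in K: number of enriched (P,γ)-partitions f
-- with |f(τ(i))| = w i for all positions i, where τ = σ⁻¹ : [n] → X.
-- Such f are determined by their signs; lt is the strict order <_P.
Kcore : ∀ {n} {X : Set} → (X → X → Bool) → (X → ℕ) → (Fin n → X) → Series n
Kcore {n} lt γ τ w = fromℕ (count ok (allFuns n (true ∷ false ∷ [])))
  where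
  ok : (Fin n → Bool) → Bool
  ok s = allPairs λ i j →
    if lt (τ i) (τ j)
    then ((w i , s i) ≼ (w j , s j))
         ∧ (not ((w i ≡ᵇ w j) ∧ (s i ⇔ᵇ s j) ∧ not (s i)) ∨ (γ (τ i) <ᵇ γ (τ j)))
         ∧ (not ((w i ≡ᵇ w j) ∧ (s i ⇔ᵇ s j) ∧ s i) ∨ (γ (τ j) <ᵇ γ (τ i)))
    else true

record FinPoset (n : ℕ) : Set where
  field
    rel     : Fin n → Fin n → Bool
    refl    : ∀ a → T (rel a a)
    antisym : ∀ a b → T (rel a b) → T (rel b a) → a ≡ b
    trans   : ∀ a b c → T (rel a b) → T (rel b c) → T (rel a c)

K : ∀ {n} → FinPoset n × Permutation′ n × Permutation′ n → Series n
K (P , γ , σ) = Kcore (λ a b → FinPoset.rel P a b ∧ not (a ==ᶠ b))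
                      (λ x → toℕ (γ ⟨$⟩ʳ x)) (λ i → σ ⟨$⟩ˡ i)

NCΠ : ∀ n → Series n → Set
NCΠ n = InSpan (K {n})

-- η_φ for an odd set composition φ = (ℓ , c).
-- The pair (B,σ): σ lists the blocks left to right, each in increasing
-- order; chain element p (0-based) corresponds to word position σ(p), so
-- σ⁻¹(x) = rank x.  B consists of the chain positions of the elements at
-- odd 0-based offset inside their block (0-based chain positions; the
-- paper's 1-based peak is one more).

rank : ∀ {n ℓ} → (Fin n → Fin ℓ) → Fin n → ℕ
rank {n} c x = count (λ y → (c y <ᶠ c x) ∨ ((c y ==ᶠ c x) ∧ (y <ᶠ x))) (allFin n)

offset : ∀ {n ℓ} → (Fin n → Fin ℓ) → Fin n → ℕ
offset {n} c x = count (λ y → (c y ==ᶠ c x) ∧ (y <ᶠ x)) (allFin n)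

inB : ∀ {n ℓ} → (Fin n → Fin ℓ) → Fin n → Bool
inB c x = offset c x % 2 ≡ᵇ 1

-- subsets C ⊆ B, described by the elements x whose chain position rank x ∈ C
subsetsB : ∀ {n ℓ} → (Fin n → Fin ℓ) → List (Fin n → Bool)
subsetsB {n} c = filterᵇ (λ C → all (λ x → not (C x) ∨ inB c x) (allFin n))
                         (allFuns n (true ∷ false ∷ []))

-- a bijection γ_C of the chain positions {0,…,n-1} whose descent set
-- (hence peak set, as C has no two consecutive elements and 0 ∉ C) is C:
-- split at the descents into runs, give the first run the largest values.
seg : ∀ {n ℓ} → (Fin n → Fin ℓ) → (Fin n → Bool) → ℕ → ℕ
seg {n} c C p = count (λ x → C x ∧ (rank c x <ᵇ p)) (allFin n)

γpk : ∀ {n ℓ} → (Fin n → Fin ℓ) → (Fin n → Bool) → ℕ → ℕ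
γpk {n} c C p = count (λ q → seg c C p <ᵇ seg c C q) (upTo n)
              + count (λ q → (seg c C q ≡ᵇ seg c C p) ∧ (q <ᵇ p)) (upTo n)

Kpk : ∀ {n ℓ} → (Fin n → Fin ℓ) → (Fin n → Bool) → Series n
Kpk c C = Kcore _<ᵇ_ (γpk c C) (rank c)

η : ∀ {n} → RawComp n → Series n
η {n} (_ , c) w = sumℚ (map (λ C → Q._*_ (signℚ (count (inB c) (allFin n) ∸ count C (allFin n)))
                                         (Kpk c C w))
                            (subsetsB c))

record OddPart (n : ℕ) : Set where
  field
    comp : SetComp n
    odd  : ∀ b → blockSize (SetComp.blk comp) b % 2 ≡ 1

nn : ∀ {n} → OddPart n → Series n
nn {n} π w = Q._*_ (signℚ ((n ∸ SetComp.ℓ (OddPart.comp π)) / 2))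
                   (sumℚ (map (λ φ → η φ w)
                              (filterᵇ (sameBlocks (toRaw (OddPart.comp π))) (setComps n))))

SameOddPart : ∀ {n} → OddPart n → OddPart n → Set
SameOddPart π ρ = T (sameBlocks (toRaw (OddPart.comp π)) (toRaw (OddPart.comp ρ)))

{-# OPTIONS --safe #-}

-- Two facts carry the proof.
--
-- (1) Every K satisfies a noncommutative Dehn–Sommerville relation: if the
-- letter k occurs in w and k+1 does not, then the alternating sum of the
-- coefficients over all ways of raising a subset of the k's to k+1 vanishes.
-- For a symmetric series and a letter of even multiplicity this expresses twice
-- the coefficient of w through words with a finer kernel, so a symmetric series
-- in NCΠ is determined by its coefficients at words all of whose letters have
-- odd multiplicity.
--
-- (2) By a transfer matrix along the chain, the coefficient of w in η_φ is
-- ± 2^(number of letters of w) if w is constant on the blocks of φ and weakly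
-- increasing from block to block, and 0 otherwise.  Hence n_π is symmetric, is
-- supported on words constant on the blocks of π, and is triangular with
-- respect to refinement at the odd words.

module Submission where

open import Defs
open import Data.Bool.Base using (Bool; true; false; _∧_; _∨_; not; _xor_; if_then_else_; T)
open import Data.Bool.ListAction using (all; any)
import Data.Bool.Properties as Bool
open import Data.Bool.Properties using (T-∧; T-∨; T?; not-involutive; ¬-not)
open import Data.Empty using (⊥; ⊥-elim)
open import Data.Fin.Base using (Fin; zero; suc; toℕ; punchIn; punchOut; fromℕ<)
open import Data.Fin.Permutation as Perm using (Permutation′; permutation; flip; _⟨$⟩ʳ_; _⟨$⟩ˡ_; remove; punchIn-permute; inverseʳ; inverseˡ)
import Data.Fin.Properties as Fin
open import Data.Fin.Properties using (toℕ-injective; suc-injective; _≟_; injective⇒≤; punchOut-injective; toℕ-fromℕ<; toℕ<n)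
import Data.Integer.Base as ℤ
import Data.Integer.Properties as ℤ
open import Data.List.Base using (List; []; _∷_; _++_; map; concatMap; filterᵇ; length; allFin; tabulate; upTo; lookup; cartesianProduct)
open import Data.List.Membership.Propositional using (_∈_; find; lose)
open import Data.List.Membership.Propositional.Properties using (∈-allFin; ∈-filter⁺; ∈-filter⁻; ∈-concatMap⁺; ∈-concatMap⁻; ∈-∃++; ∈-map⁺; ∈-map⁻; ∈-++⁺ˡ; ∈-++⁺ʳ; ∈-++⁻; ∈-upTo⁺; ∈-lookup; ∈-cartesianProduct⁺)
open import Data.List.Properties using (map-tabulate; map-∘; length-++; length-tabulate; length-upTo)
open import Data.List.Relation.Binary.Permutation.Propositional using (↭-sym)
open import Data.List.Relation.Binary.Permutation.Propositional.Properties using (∈-resp-↭)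
open import Data.List.Relation.Unary.All as All using (All; []; _∷_)
import Data.List.Relation.Unary.All.Properties as All
open import Data.List.Relation.Unary.AllPairs as AllPairs using (AllPairs; []; _∷_)
import Data.List.Relation.Unary.AllPairs.Properties as AllPairs
open import Data.List.Relation.Unary.Any as Any using (Any; here; there; any?)
import Data.List.Relation.Unary.Any.Properties as Any
import Data.List.Relation.Unary.Linked.Properties as Linked
import Data.List.Relation.Unary.Unique.Propositional.Properties as Unique
import Data.List.Sort as Sort
open import Data.Nat.Base as ℕ using (ℕ; zero; suc; _%_; _≡ᵇ_; _<ᵇ_; _≤ᵇ_; z≤n; s≤s)
import Data.Nat.DivMod as ℕ
open import Data.Nat.Induction using (<-wellFounded)
import Data.Nat.Properties as ℕ
open import Data.Product.Base using (∃; _×_; _,_; proj₁; proj₂)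
open import Data.Rational.Base using (ℚ; 0ℚ; 1ℚ; _+_; _*_; -_; _-_; _≤_; _<_; positive; 1/_; ≢-nonZero)
import Data.Rational.Properties as ℚ
open import Data.Rational.Solver using (module +-*-Solver)
import Data.Rational.Unnormalised.Base as ℚᵘ
import Data.Rational.Unnormalised.Properties as ℚᵘ
open import Data.Sum.Base using (_⊎_; inj₁; inj₂; [_,_]′; map₂)
open import Data.Unit.Base using (⊤; tt)
open import Data.Vec.Functional using (insertAt) renaming (_∷_ to _∷ᶠ_)
open import Function.Base using (_∘_; id; case_of_)
open import Function.Bundles using (Equivalence)
open import Induction.WellFounded using (Acc; acc)
open import Relation.Binary.Bundles using (DecTotalOrder)
import Relation.Binary.Construct.On as On
open import Relation.Binary.Definitions using (tri<; tri≈; tri>)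
open import Relation.Binary.PropositionalEquality
open import Relation.Nullary using (¬_; Dec; yes; no)
open import Relation.Nullary.Decidable using (_×-dec_; ¬?; decidable-stable)
open import Algebra.Properties.CommutativeMonoid.Sum ℚ.*-1-commutativeMonoid using () renaming (sum to ∏; sum-permute to ∏-permute; sum-cong-≗ to ∏-cong)

-- `NCΠ n` is spanned by series of arbitrary labelled posets, so membership is exploited through
-- linear relations on coefficients: a relation that holds for each `K` passes to the span. The
-- relation comes from writing the signs as `s = e xor D`, where `D` is the set of raised positions.
-- At fixed `e` each position with letter k chooses between +k and -(k+1), which are neighbours in
-- the order, or between -k and +(k+1), which enclose them. One extremal position can then be
-- toggled without affecting any condition, and this reverses the sign of the term.
--
-- Symmetry of n_π is not visible in its definition, since the coefficient of w counts the
-- reorderings of π along which w increases, and this mentions the order of the letters. Re-sorting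
-- the blocks by the letters of another word with the same kernel matches the two counts.
--
-- Refinement is only a partial order. Elimination and both inductions over kernels therefore run
-- along a numerical measure, the number of pairs of equal letters, which grows strictly under
-- proper coarsening.

private
  variable
    A B : Set


-- Boolean reflection

bool-ext : ∀ {a b} → (T a → T b) → (T b → T a) → a ≡ b
bool-ext {false} {false} f g = refl
bool-ext {false} {true}  f g = ⊥-elim (g tt)
bool-ext {true}  {false} f g = ⊥-elim (f tt)
bool-ext {true}  {true}  f g = refl

T⇒≡ : ∀ {b} → T b → b ≡ true
T⇒≡ {true} _ = refl

≡⇒T : ∀ {b} → b ≡ true → T b
≡⇒T refl = tt

¬T⇒≡ : ∀ {b} → ¬ T b → b ≡ false
¬T⇒≡ {false} _ = refl
¬T⇒≡ {true} f = ⊥-elim (f tt)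

≡⇒¬T : ∀ {b} → b ≡ false → ¬ T b
≡⇒¬T refl ()

∧-elim : ∀ {a b} → T (a ∧ b) → T a × T b
∧-elim = Equivalence.to T-∧

∧-intro : ∀ {a b} → T a → T b → T (a ∧ b)
∧-intro p q = Equivalence.from T-∧ (p , q)

∨-elim : ∀ {a b} → T (a ∨ b) → T a ⊎ T b
∨-elim = Equivalence.to T-∨

∨-introˡ : ∀ {a b} → T a → T (a ∨ b)
∨-introˡ p = Equivalence.from T-∨ (inj₁ p)

∨-introʳ : ∀ {a b} → T b → T (a ∨ b)
∨-introʳ {a} p = Equivalence.from (T-∨ {a}) (inj₂ p)

not-elim : ∀ {a} → T (not a) → ¬ T a
not-elim {false} _ ()

not-intro : ∀ {a} → ¬ T a → T (not a)
not-intro {false} _ = tt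
not-intro {true} f = f tt

⇔ᵇ⇒≡ : ∀ {a b} → T (a ⇔ᵇ b) → a ≡ b
⇔ᵇ⇒≡ {false} {false} _ = refl
⇔ᵇ⇒≡ {true} {true} _ = refl

≡⇒⇔ᵇ : ∀ {a b} → a ≡ b → T (a ⇔ᵇ b)
≡⇒⇔ᵇ {false} refl = tt
≡⇒⇔ᵇ {true} refl = tt

<ᵇ-true : ∀ {m n} → m ℕ.< n → (m <ᵇ n) ≡ true
<ᵇ-true p = T⇒≡ (ℕ.<⇒<ᵇ p)

<ᵇ-false : ∀ {m n} → ¬ m ℕ.< n → (m <ᵇ n) ≡ false
<ᵇ-false p = ¬T⇒≡ (λ t → p (ℕ.<ᵇ⇒< _ _ t))

≡ᵇ-true : ∀ {m n} → m ≡ n → (m ≡ᵇ n) ≡ true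
≡ᵇ-true {m} {n} p = T⇒≡ (ℕ.≡⇒≡ᵇ m n p)

≡ᵇ-false : ∀ {m n} → m ≢ n → (m ≡ᵇ n) ≡ false
≡ᵇ-false {m} {n} p = ¬T⇒≡ (λ t → p (ℕ.≡ᵇ⇒≡ m n t))

all-elim : ∀ {n} {p : Fin n → Bool} → T (all p (allFin n)) → ∀ i → T (p i)
all-elim {n} {p} t i = All.lookup (All.all⁺ p (allFin n) t) (∈-allFin i)

all-intro : ∀ {n} {p : Fin n → Bool} → (∀ i → T (p i)) → T (all p (allFin n))
all-intro {n} {p} f = All.all⁻ p {xs = allFin n} (All.tabulate (λ {i} _ → f i))

any-elim : ∀ {n} {p : Fin n → Bool} → T (any p (allFin n)) → ∃ λ i → T (p i)
any-elim {n} {p} t = Any.satisfied (Any.any⁻ p (allFin n) t)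

any-intro : ∀ {n} {p : Fin n → Bool} i → T (p i) → T (any p (allFin n))
any-intro {n} {p} i t = Any.any⁺ p (Any.map (λ { refl → t }) (∈-allFin i))

allPairs-elim : ∀ {n} {p : Fin n → Fin n → Bool} → T (allPairs p) → ∀ i j → T (p i j)
allPairs-elim {p = p} t i j = all-elim {p = p i} (all-elim {p = λ j → all (p j) (allFin _)} t i) j

allPairs-intro : ∀ {n} {p : Fin n → Fin n → Bool} → (∀ i j → T (p i j)) → T (allPairs p)
allPairs-intro {p = p} f = all-intro {p = λ j → all (p j) (allFin _)} (λ i → all-intro {p = p i} (f i))

allPairs-cong : ∀ {n} {p q : Fin n → Fin n → Bool} → (∀ i j → p i j ≡ q i j) → allPairs p ≡ allPairs q
allPairs-cong {p = p} {q} e = bool-ext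
  (λ t → allPairs-intro {p = q} (λ i j → subst T (e i j) (allPairs-elim {p = p} t i j)))
  (λ t → allPairs-intro {p = p} (λ i j → subst T (sym (e i j)) (allPairs-elim {p = q} t i j)))

-- Sums over lists

∑ : List A → (A → ℚ) → ℚ
∑ xs F = sumℚ (map F xs)

𝟙 : Bool → ℚ
𝟙 b = if b then 1ℚ else 0ℚ

∑-cong-∈ : ∀ (xs : List A) {F G : A → ℚ} → (∀ {x} → x ∈ xs → F x ≡ G x) → ∑ xs F ≡ ∑ xs G
∑-cong-∈ [] e = refl
∑-cong-∈ (x ∷ xs) e = cong₂ _+_ (e (here refl)) (∑-cong-∈ xs (e ∘ there))

∑-cong : ∀ (xs : List A) {F G : A → ℚ} → (∀ x → F x ≡ G x) → ∑ xs F ≡ ∑ xs G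
∑-cong xs e = ∑-cong-∈ xs (λ {x} _ → e x)

∑-0 : ∀ (xs : List A) → ∑ xs (λ _ → 0ℚ) ≡ 0ℚ
∑-0 [] = refl
∑-0 (x ∷ xs) = trans (ℚ.+-identityˡ _) (∑-0 xs)

∑-zero : ∀ (xs : List A) {F : A → ℚ} → (∀ x → F x ≡ 0ℚ) → ∑ xs F ≡ 0ℚ
∑-zero xs e = trans (∑-cong xs e) (∑-0 xs)

∑-++ : ∀ (xs ys : List A) (F : A → ℚ) → ∑ (xs ++ ys) F ≡ ∑ xs F + ∑ ys F
∑-++ [] ys F = sym (ℚ.+-identityˡ _)
∑-++ (x ∷ xs) ys F = trans (cong (F x +_) (∑-++ xs ys F)) (sym (ℚ.+-assoc (F x) _ _))

interchange : ∀ a b c d → (a + b) + (c + d) ≡ (a + c) + (b + d)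
interchange = solve 4 (λ a b c d → (a :+ b) :+ (c :+ d) := (a :+ c) :+ (b :+ d)) refl
  where open +-*-Solver

∑-+ : ∀ (xs : List A) (F G : A → ℚ) → ∑ xs (λ x → F x + G x) ≡ ∑ xs F + ∑ xs G
∑-+ [] F G = refl
∑-+ (x ∷ xs) F G = trans (cong ((F x + G x) +_) (∑-+ xs F G)) (interchange (F x) (G x) _ _)

∑-*ˡ : ∀ c (xs : List A) (F : A → ℚ) → ∑ xs (λ x → c * F x) ≡ c * ∑ xs F
∑-*ˡ c [] F = sym (ℚ.*-zeroʳ c)
∑-*ˡ c (x ∷ xs) F = trans (cong (c * F x +_) (∑-*ˡ c xs F)) (sym (ℚ.*-distribˡ-+ c (F x) _))

∑-*ʳ : ∀ c (xs : List A) (F : A → ℚ) → ∑ xs (λ x → F x * c) ≡ ∑ xs F * c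
∑-*ʳ c xs F = trans (∑-cong xs (λ x → ℚ.*-comm (F x) c)) (trans (∑-*ˡ c xs F) (ℚ.*-comm c _))

∑-neg : ∀ (xs : List A) (F : A → ℚ) → ∑ xs (λ x → - F x) ≡ - ∑ xs F
∑-neg [] F = refl
∑-neg (x ∷ xs) F = trans (cong (- F x +_) (∑-neg xs F)) (sym (ℚ.neg-distrib-+ (F x) _))

∑-swap : ∀ (xs : List A) (ys : List B) (F : A → B → ℚ) →
         ∑ xs (λ x → ∑ ys (F x)) ≡ ∑ ys (λ y → ∑ xs (λ x → F x y))
∑-swap [] ys F = sym (∑-0 ys)
∑-swap (x ∷ xs) ys F = trans (cong (∑ ys (F x) +_) (∑-swap xs ys F)) (sym (∑-+ ys (F x) _))

∑-map : ∀ (f : A → B) (xs : List A) (F : B → ℚ) → ∑ (map f xs) F ≡ ∑ xs (F ∘ f)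
∑-map f xs F = cong sumℚ (sym (map-∘ xs))

∑-filter : ∀ (p : A → Bool) (xs : List A) (F : A → ℚ) →
           ∑ (filterᵇ p xs) F ≡ ∑ xs (λ x → if p x then F x else 0ℚ)
∑-filter p [] F = refl
∑-filter p (x ∷ xs) F with p x
... | true  = cong (F x +_) (∑-filter p xs F)
... | false = trans (∑-filter p xs F) (sym (ℚ.+-identityˡ _))

-- The division in `fromℕ` normalises by a gcd, which does not compute for a variable `k`; the
-- equation is checked on unnormalised fractions and transported back.
fromℕ-suc : ∀ k → fromℕ (suc k) ≡ 1ℚ + fromℕ k
fromℕ-suc k = trans (ℚ.fromℚᵘ-cong lem) (trans (ℚ.fromℚᵘ-cong (ℚᵘ.≃-sym
    (ℚᵘ.≃-trans (ℚ.toℚᵘ-homo-+ 1ℚ (fromℕ k)) (ℚᵘ.+-cong {ℚᵘ.1ℚᵘ} ℚᵘ.≃-refl (ℚ.toℚᵘ-fromℚᵘ (ℚᵘ.mkℚᵘ (ℤ.+ k) 0)))))) (ℚ.fromℚᵘ-toℚᵘ _))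
  where
  lem : ℚᵘ.mkℚᵘ (ℤ.+ suc k) 0 ℚᵘ.≃ ℚᵘ.1ℚᵘ ℚᵘ.+ ℚᵘ.mkℚᵘ (ℤ.+ k) 0
  lem = ℚᵘ.*≡* (cong (ℤ._* (ℤ.+ 1)) (cong (λ j → (ℤ.+ 1) ℤ.+ j) (sym (ℤ.*-identityʳ (ℤ.+ k)))))

fromℕ-count : ∀ (p : A → Bool) (xs : List A) → fromℕ (count p xs) ≡ ∑ xs (𝟙 ∘ p)
fromℕ-count p [] = refl
fromℕ-count p (x ∷ xs) with p x
... | true  = trans (fromℕ-suc (count p xs)) (cong (1ℚ +_) (fromℕ-count p xs))
... | false = trans (fromℕ-count p xs) (sym (ℚ.+-identityˡ _))

count-cong : ∀ {p q : A → Bool} (xs : List A) → (∀ x → p x ≡ q x) → count p xs ≡ count q xs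
count-cong [] e = refl
count-cong {p = p} {q} (x ∷ xs) e with p x | q x | e x
... | true  | _ | refl = cong suc (count-cong xs e)
... | false | _ | refl = count-cong xs e

count-≤ : ∀ {p q : A → Bool} (xs : List A) → (∀ x → T (p x) → T (q x)) → count p xs ℕ.≤ count q xs
count-≤ [] h = z≤n
count-≤ {p = p} {q} (x ∷ xs) h with p x | q x | h x
... | true  | true  | _ = s≤s (count-≤ xs h)
... | true  | false | k = ⊥-elim (k tt)
... | false | true  | _ = ℕ.m≤n⇒m≤1+n (count-≤ xs h)
... | false | false | _ = count-≤ xs h

count-< : ∀ {p q : A → Bool} {x} {xs : List A} → (∀ x → T (p x) → T (q x)) →
          x ∈ xs → T (q x) → ¬ T (p x) → count p xs ℕ.< count q xs
count-< {p = p} {q} {x} {_ ∷ xs} h (here refl) qx ¬px with p x | q x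
... | true  | _    = ⊥-elim (¬px tt)
... | false | true = s≤s (count-≤ xs h)
count-< {p = p} {q} {xs = y ∷ _} h (there x∈) qx ¬px with p y | q y | h y
... | true  | true  | _ = s≤s (count-< h x∈ qx ¬px)
... | true  | false | k = ⊥-elim (k tt)
... | false | true  | _ = ℕ.m≤n⇒m≤1+n (count-< h x∈ qx ¬px)
... | false | false | _ = count-< h x∈ qx ¬px

count-∨ : ∀ {p q : A → Bool} (xs : List A) → (∀ x → T (p x) → ¬ T (q x)) →
          count (λ x → p x ∨ q x) xs ≡ count p xs ℕ.+ count q xs
count-∨ [] h = refl
count-∨ {p = p} {q} (x ∷ xs) h with p x | q x | h x
... | true  | true  | k = ⊥-elim (k tt tt)
... | true  | false | _ = cong suc (count-∨ xs h)
... | false | true  | _ = trans (cong suc (count-∨ xs h)) (sym (ℕ.+-suc _ _))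
... | false | false | _ = count-∨ xs h

count-true : ∀ (xs : List A) → count (λ _ → true) xs ≡ length xs
count-true [] = refl
count-true (x ∷ xs) = cong suc (count-true xs)

count-map : ∀ (p : B → Bool) (f : A → B) xs → count p (map f xs) ≡ count (p ∘ f) xs
count-map p f [] = refl
count-map p f (x ∷ xs) with p (f x)
... | true  = cong suc (count-map p f xs)
... | false = count-map p f xs

count-allFin-suc : ∀ {n} (p : Fin (suc n) → Bool) →
  count p (allFin (suc n)) ≡ (if p zero then suc (count (p ∘ suc) (allFin n)) else count (p ∘ suc) (allFin n))
count-allFin-suc {n} p with p zero
... | true  = cong suc (trans (cong (count p) (sym (map-tabulate id suc))) (count-map p suc (allFin n)))
... | false = trans (cong (count p) (sym (map-tabulate id suc))) (count-map p suc (allFin n))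

-- The injection is a relation because members of the lists are functions, equal at best pointwise.
-- The partner of the head is deleted from `ys`; it cannot be the partner of a later element, so the
-- induction continues in the shortened list.
injection⇒length-≤ : (R : A → B → Set) (xs : List A) (ys : List B) →
  (∀ {x} → x ∈ xs → ∃ λ y → y ∈ ys × R x y) →
  AllPairs (λ x x′ → ∀ y → R x y → ¬ R x′ y) xs → length xs ℕ.≤ length ys
injection⇒length-≤ R [] ys h d = z≤n
injection⇒length-≤ R (x ∷ xs) ys h (dx ∷ d) with h (here refl)
... | y , y∈ , Rxy with ∈-∃++ y∈
... | us , vs , refl = subst (suc (length xs) ℕ.≤_)
        (sym (trans (length-++ us) (trans (ℕ.+-suc (length us) (length vs)) (cong suc (sym (length-++ us))))))
        (s≤s (injection⇒length-≤ R xs (us ++ vs) h′ d))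
  where
  h′ : ∀ {x′} → x′ ∈ xs → ∃ λ y′ → y′ ∈ us ++ vs × R x′ y′
  h′ x′∈ with h (there x′∈)
  ... | y′ , y′∈ , Rx′y′ with ∈-++⁻ us y′∈
  ... | inj₁ i = y′ , ∈-++⁺ˡ i , Rx′y′
  ... | inj₂ (here refl) = ⊥-elim (All.lookup dx x′∈ y Rxy Rx′y′)
  ... | inj₂ (there i) = y′ , ∈-++⁺ʳ us i , Rx′y′

count≤ : ∀ (R : A → B → Set) {p : A → Bool} {q : B → Bool} (xs : List A) (ys : List B) →
  (∀ {x} → x ∈ xs → T (p x) → ∃ λ y → y ∈ ys × T (q y) × R x y) →
  AllPairs (λ x x′ → T (p x) → T (p x′) → ∀ y → R x y → ¬ R x′ y) xs → count p xs ℕ.≤ count q ys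
count≤ R {p} {q} xs ys h d = injection⇒length-≤ (λ x y → T (p x) × R x y) (filterᵇ p xs) (filterᵇ q ys)
  (λ x∈ → let x∈′ , px = ∈-filter⁻ (T? ∘ p) {xs = xs} x∈ ; y , y∈ , qy , r = h x∈′ px in
          y , ∈-filter⁺ (T? ∘ q) y∈ qy , px , r)
  (AllPairs.filter⁺ (T? ∘ p) (AllPairs.map (λ k y (px , r) (px′ , r′) → k px px′ y r r′) d))

-- Function lists

allFuns-complete : ∀ n {xs : List A} (g : Fin n → A) → (∀ i → g i ∈ xs) → ∃ λ f → f ∈ allFuns n xs × (∀ i → f i ≡ g i)
allFuns-complete zero g h = _ , here refl , λ ()
allFuns-complete (suc n) {xs} g h with allFuns-complete n (g ∘ suc) (h ∘ suc)
... | f , f∈ , e = g zero ∷ᶠ f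
    , ∈-concatMap⁺ (λ a → map (λ f → a ∷ᶠ f) (allFuns n xs)) (lose (h zero) (∈-map⁺ (λ f → g zero ∷ᶠ f) f∈))
    , λ { zero → refl ; (suc i) → e i }

concatMap-AllPairs : ∀ {R : B → B → Set} {S : A → A → Set} (f : A → List B) {xs : List A} → AllPairs S xs →
  (∀ x → AllPairs R (f x)) → (∀ {x y a b} → S x y → a ∈ f x → b ∈ f y → R a b) → AllPairs R (concatMap f xs)
concatMap-AllPairs f [] h g = []
concatMap-AllPairs f {x ∷ xs} (dx ∷ d) h g = AllPairs.++⁺ (h x) (concatMap-AllPairs f d h g)
  (All.tabulate (λ a∈ → All.tabulate (λ b∈ → let y , y∈ , b∈′ = find (∈-concatMap⁻ f {xs = xs} b∈) in g (All.lookup dx y∈) a∈ b∈′)))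

allFuns-unique : ∀ n {xs : List A} → AllPairs _≢_ xs → AllPairs (λ f g → ¬ (∀ i → f i ≡ g i)) (allFuns n xs)
allFuns-unique zero d = [] ∷ []
allFuns-unique (suc n) {xs} d = concatMap-AllPairs (λ a → map (λ f → a ∷ᶠ f) (allFuns n xs)) d
  (λ a → AllPairs.map⁺ (AllPairs.map (λ k e → k (e ∘ suc)) (allFuns-unique n d)))
  (λ ne f∈ g∈ e → differ ne (∈-map⁻ _ f∈) (∈-map⁻ _ g∈) (e zero))
  where
  differ : ∀ {x y} {f g : Fin (suc n) → _} → x ≢ y → (∃ λ f′ → f′ ∈ allFuns n xs × f ≡ (x ∷ᶠ f′)) →
           (∃ λ g′ → g′ ∈ allFuns n xs × g ≡ (y ∷ᶠ g′)) → f zero ≢ g zero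
  differ ne (_ , _ , refl) (_ , _ , refl) = ne

AllPairs-with : ∀ {P : A → Set} {R : A → A → Set} {xs} → All P xs → AllPairs R xs → AllPairs (λ x y → P x × P y × R x y) xs
AllPairs-with [] [] = []
AllPairs-with (p ∷ ps) (r ∷ rs) = All.zipWith (λ (q , r) → p , q , r) (ps , r) ∷ AllPairs-with ps rs

-- Sums over Boolean functions

bools : ∀ n → List (Fin n → Bool)
bools n = allFuns n (true ∷ false ∷ [])

-- Function extensionality is not assumed: reindexing a sum over functions yields arguments that
-- agree only pointwise, so the summand has to respect pointwise equality.
Ext : ∀ {n} → ((Fin n → A) → B) → Set
Ext {A = A} {n = n} F = ∀ {s t : Fin n → A} → (∀ i → s i ≡ t i) → F s ≡ F t

∷ᶠ-cong : ∀ {n} {a b : A} {s t : Fin n → A} → a ≡ b → (∀ i → s i ≡ t i) → ∀ i → (a ∷ᶠ s) i ≡ (b ∷ᶠ t) i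
∷ᶠ-cong e es zero = e
∷ᶠ-cong e es (suc i) = es i

∑-bools-suc : ∀ n (F : (Fin (suc n) → Bool) → ℚ) →
  ∑ (bools (suc n)) F ≡ ∑ (bools n) (λ s → F (true ∷ᶠ s)) + ∑ (bools n) (λ s → F (false ∷ᶠ s))
∑-bools-suc n F = trans (∑-++ (map (true ∷ᶠ_) (bools n)) _ F) (cong₂ _+_ (∑-map _ (bools n) F)
  (trans (∑-++ (map (false ∷ᶠ_) (bools n)) [] F) (trans (ℚ.+-identityʳ _) (∑-map _ (bools n) F))))

-- Translation by `e` permutes the Boolean cube: in each coordinate it fixes or exchanges the two
-- halves.
∑-xor : ∀ n (e : Fin n → Bool) (F : (Fin n → Bool) → ℚ) → Ext F →
        ∑ (bools n) (λ s → F (λ i → s i xor e i)) ≡ ∑ (bools n) F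
∑-xor zero e F ext = cong (_+ 0ℚ) (ext (λ ()))
∑-xor (suc n) e F ext = trans (∑-bools-suc n _) (trans (aux (e zero) refl) (sym (∑-bools-suc n F)))
  where
  tail : ∀ b → ∑ (bools n) (λ s → F (b ∷ᶠ (λ i → s i xor e (suc i)))) ≡ ∑ (bools n) (λ s → F (b ∷ᶠ s))
  tail b = ∑-xor n (e ∘ suc) (λ s → F (b ∷ᶠ s)) (λ h → ext (∷ᶠ-cong refl h))
  head : ∀ b c → b xor e zero ≡ c → ∑ (bools n) (λ s → F (λ i → (b ∷ᶠ s) i xor e i)) ≡ ∑ (bools n) (λ s → F (c ∷ᶠ s))
  head b c eq = trans (∑-cong (bools n) (λ s → ext (λ { zero → eq ; (suc i) → refl }))) (tail c)
  aux : ∀ b → e zero ≡ b → ∑ (bools n) (λ s → F (λ i → (true ∷ᶠ s) i xor e i)) + ∑ (bools n) (λ s → F (λ i → (false ∷ᶠ s) i xor e i))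
        ≡ ∑ (bools n) (λ s → F (true ∷ᶠ s)) + ∑ (bools n) (λ s → F (false ∷ᶠ s))
  aux true  eq = trans (cong₂ _+_ (head true false (cong not eq)) (head false true eq)) (ℚ.+-comm (∑ (bools n) (λ s → F (false ∷ᶠ s))) (∑ (bools n) (λ s → F (true ∷ᶠ s))))
  aux false eq = cong₂ _+_ (head true true (cong not eq)) (head false false eq)

∑-insertAt : ∀ n (a : Fin (suc n)) (F : (Fin (suc n) → Bool) → ℚ) → Ext F →
  ∑ (bools (suc n)) F ≡ ∑ (bools n) (λ s → F (insertAt s a true)) + ∑ (bools n) (λ s → F (insertAt s a false))
∑-insertAt n zero F ext = trans (∑-bools-suc n F) (cong₂ _+_ (lem true) (lem false))
  where
  lem : ∀ b → ∑ (bools n) (λ s → F (b ∷ᶠ s)) ≡ ∑ (bools n) (λ s → F (insertAt s zero b))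
  lem b = ∑-cong (bools n) (λ s → ext (λ { zero → refl ; (suc i) → refl }))
∑-insertAt (suc n) (suc a) F ext = trans (∑-bools-suc (suc n) F)
  (trans (cong₂ _+_ (part true) (part false))
  (trans (interchange (S true true) (S true false) (S false true) (S false false)) (sym (cong₂ _+_ (∑-bools-suc n _) (∑-bools-suc n _)))))
  where
  S : Bool → Bool → ℚ
  S b c = ∑ (bools n) (λ s → F (insertAt (b ∷ᶠ s) (suc a) c))
  lem : ∀ b c → ∑ (bools n) (λ s → F (b ∷ᶠ insertAt s a c)) ≡ ∑ (bools n) (λ s → F (insertAt (b ∷ᶠ s) (suc a) c))
  lem b c = ∑-cong (bools n) (λ s → ext (λ { zero → refl ; (suc i) → refl }))
  part : ∀ b → ∑ (bools (suc n)) (λ s → F (b ∷ᶠ s)) ≡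
         ∑ (bools n) (λ s → F (insertAt (b ∷ᶠ s) (suc a) true)) + ∑ (bools n) (λ s → F (insertAt (b ∷ᶠ s) (suc a) false))
  part b = trans (∑-insertAt n a (λ s → F (b ∷ᶠ s)) (λ h → ext (∷ᶠ-cong refl h))) (cong₂ _+_ (lem b true) (lem b false))

insertAt-hit : ∀ {n} (s : Fin n → A) (a : Fin (suc n)) b → insertAt s a b a ≡ b
insertAt-hit s zero b = refl
insertAt-hit {n = suc n} s (suc a) b = insertAt-hit (s ∘ suc) a b

insertAt-punchIn : ∀ {n} (s : Fin n → A) (a : Fin (suc n)) b i → insertAt s a b (punchIn a i) ≡ s i
insertAt-punchIn s zero b i = refl
insertAt-punchIn {n = suc n} s (suc a) b zero = refl
insertAt-punchIn {n = suc n} s (suc a) b (suc i) = insertAt-punchIn (s ∘ suc) a b i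

punchIn-cover : ∀ {n} (P : Fin (suc n) → Set) (a : Fin (suc n)) → P a → (∀ i → P (punchIn a i)) → ∀ j → P j
punchIn-cover P zero pa pi zero = pa
punchIn-cover P zero pa pi (suc j) = pi j
punchIn-cover {suc n} P (suc a) pa pi zero = pi zero
punchIn-cover {suc n} P (suc a) pa pi (suc j) = punchIn-cover (P ∘ suc) a pa (pi ∘ suc) j

-- Let `a` be the position that `ρ` sends to zero. The head of `s` becomes the value at `a`, so the
-- cube is split along coordinate `a` and `ρ` with `a` removed handles the remaining coordinates.
∑-permute : ∀ n (ρ : Permutation′ n) (F : (Fin n → Bool) → ℚ) → Ext F →
            ∑ (bools n) (λ s → F (λ i → s (ρ ⟨$⟩ʳ i))) ≡ ∑ (bools n) F
∑-permute zero ρ F ext = cong (_+ 0ℚ) (ext (λ ()))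
∑-permute (suc n) ρ F ext = trans (∑-bools-suc n _) (trans (cong₂ _+_ (part true) (part false)) (sym (∑-insertAt n a F ext)))
  where
  a = ρ ⟨$⟩ˡ zero
  ρ′ = remove a ρ
  part : ∀ b → ∑ (bools n) (λ s → F (λ i → (b ∷ᶠ s) (ρ ⟨$⟩ʳ i))) ≡ ∑ (bools n) (λ s → F (insertAt s a b))
  part b = trans (∑-cong (bools n) (λ s → ext (punchIn-cover _ a
      (trans (cong (b ∷ᶠ s) (inverseʳ ρ)) (sym (insertAt-hit _ a b)))
      (λ i → trans (cong (b ∷ᶠ s) (trans (punchIn-permute ρ a i) (cong (λ z → punchIn z (ρ′ ⟨$⟩ʳ i)) (inverseʳ ρ))))
                   (sym (insertAt-punchIn (λ j → s (ρ′ ⟨$⟩ʳ j)) a b i))))))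
    (∑-permute n ρ′ (λ s → F (insertAt s a b)) (λ {s} {t} h → ext (punchIn-cover _ a
      (trans (insertAt-hit s a b) (sym (insertAt-hit t a b)))
      (λ i → trans (insertAt-punchIn s a b i) (trans (h i) (sym (insertAt-punchIn t a b i)))))))

0≤𝟙 : ∀ b → 0ℚ ≤ 𝟙 b
0≤𝟙 true  = ℚ.nonNegative⁻¹ 1ℚ
0≤𝟙 false = ℚ.≤-refl

∑-nonneg : ∀ (xs : List A) {F : A → ℚ} → (∀ x → 0ℚ ≤ F x) → 0ℚ ≤ ∑ xs F
∑-nonneg [] h = ℚ.≤-refl
∑-nonneg (x ∷ xs) {F} h = ℚ.≤-trans (ℚ.≤-reflexive (sym (ℚ.+-identityʳ 0ℚ))) (ℚ.+-mono-≤ (h x) (∑-nonneg xs h))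

∑-pos : ∀ (xs : List A) {F : A → ℚ} {x} → (∀ x → 0ℚ ≤ F x) → x ∈ xs → 0ℚ < F x → 0ℚ < ∑ xs F
∑-pos (x ∷ xs) h (here refl) p = ℚ.≤-<-trans (ℚ.≤-reflexive (sym (ℚ.+-identityʳ 0ℚ))) (ℚ.+-mono-<-≤ p (∑-nonneg xs h))
∑-pos (x ∷ xs) h (there i) p = ℚ.≤-<-trans (ℚ.≤-reflexive (sym (ℚ.+-identityʳ 0ℚ))) (ℚ.+-mono-≤-< (h x) (∑-pos xs h i p))

-- Signs

neg-neg : ∀ x → - (- x) ≡ x
neg-neg = solve 1 (λ x → :- (:- x) := x) refl
  where open +-*-Solver

signℚ-suc : ∀ k → signℚ (suc k) ≡ - signℚ k
signℚ-suc zero = refl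
signℚ-suc (suc k) = trans (cong (λ r → if r ≡ᵇ 0 then 1ℚ else - 1ℚ) (trans (cong (_% 2) (ℕ.+-comm 2 k)) (ℕ.[m+n]%n≡m%n k 2)))
  (trans (sym (neg-neg (signℚ k))) (cong -_ (sym (signℚ-suc k))))

signℚ² : ∀ k → signℚ k * signℚ k ≡ 1ℚ
signℚ² k with k % 2 ≡ᵇ 0
... | true = refl
... | false = refl

-1^ : Bool → ℚ
-1^ b = if b then - 1ℚ else 1ℚ

∏-sign : ∀ {n} (p : Fin n → Bool) → ∏ (λ i → -1^ (p i)) ≡ signℚ (count p (allFin n))
∏-sign {zero} p = refl
∏-sign {suc n} p rewrite count-allFin-suc p with p zero
... | true  = trans (cong (- 1ℚ *_) (∏-sign (p ∘ suc))) (trans (sym (ℚ.neg-distribˡ-* 1ℚ (signℚ (count (p ∘ suc) (allFin n))))) (trans (cong -_ (ℚ.*-identityˡ (signℚ (count (p ∘ suc) (allFin n))))) (sym (signℚ-suc (count (p ∘ suc) (allFin n))))))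
... | false = trans (ℚ.*-identityˡ _) (∏-sign (p ∘ suc))

∏-flip : ∀ {n} (F G : Fin n → ℚ) a → G a ≡ - F a → (∀ i → i ≢ a → G i ≡ F i) → ∏ G ≡ - ∏ F
∏-flip F G zero ea ei = trans (cong₂ _*_ ea (∏-cong (λ i → ei (suc i) (λ ())))) (sym (ℚ.neg-distribˡ-* (F zero) _))
∏-flip F G (suc a) ea ei = trans (cong₂ _*_ (ei zero (λ ())) (∏-flip (F ∘ suc) (G ∘ suc) a ea (λ i ne → ei (suc i) (ne ∘ suc-injective))))
  (sym (ℚ.neg-distribʳ-* (F zero) _))

x≡-x⇒x≡0 : ∀ {x} → x ≡ - x → x ≡ 0ℚ
x≡-x⇒x≡0 {x} e = ℚ.≤-antisym (ℚ.≮⇒≥ (λ p → ℚ.<-asym p (subst (_< 0ℚ) (sym e) (ℚ.neg-antimono-< p))))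
                              (ℚ.≮⇒≥ (λ p → ℚ.<-asym p (subst (0ℚ <_) (sym e) (ℚ.neg-antimono-< p))))

-- The enriched order on signed letters

-- As in _≼_, the sign true is the negative one.
Sg : Bool → Bool → ℕ → ℕ → Set
Sg true  false g g′ = ⊤
Sg false false g g′ = g ℕ.< g′
Sg true  true  g g′ = g′ ℕ.< g
Sg false true  g g′ = ⊥

Enr : ℕ → Bool → ℕ → ℕ → Bool → ℕ → Set
Enr k s g k′ s′ g′ = k ℕ.< k′ ⊎ (k ≡ k′ × Sg s s′ g g′)

-- The body repeats the condition inside `Kcore` literally, so that `okK` below unfolds to its local
-- test and `Kcore-∑` holds by counting alone.
enrᵇ : ℕ → Bool → ℕ → ℕ → Bool → ℕ → Bool
enrᵇ k s g k′ s′ g′ = ((k , s) ≼ (k′ , s′))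
  ∧ (not ((k ≡ᵇ k′) ∧ (s ⇔ᵇ s′) ∧ not s) ∨ (g <ᵇ g′))
  ∧ (not ((k ≡ᵇ k′) ∧ (s ⇔ᵇ s′) ∧ s) ∨ (g′ <ᵇ g))

enrᵇ-elim : ∀ {k s g k′ s′ g′} → T (enrᵇ k s g k′ s′ g′) → Enr k s g k′ s′ g′
enrᵇ-elim {k} {s} {g} {k′} {s′} {g′} t with ℕ.<-cmp k k′
... | tri< k<k′ _ _ = inj₁ k<k′
... | tri> ¬< ¬≡ _ rewrite <ᵇ-false ¬< | ≡ᵇ-false ¬≡ = ⊥-elim t
... | tri≈ ¬< refl _ rewrite <ᵇ-false ¬< | ≡ᵇ-true {k} refl = inj₂ (refl , go s s′ t)
  where
  go : ∀ s s′ → T ((s ∨ not s′) ∧ (not ((s ⇔ᵇ s′) ∧ not s) ∨ (g <ᵇ g′)) ∧ (not ((s ⇔ᵇ s′) ∧ s) ∨ (g′ <ᵇ g))) → Sg s s′ g g′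
  go false false t = ℕ.<ᵇ⇒< g g′ (proj₁ (∧-elim t))
  go true  false t = tt
  go true  true  t = ℕ.<ᵇ⇒< g′ g t

enrᵇ-intro : ∀ {k s g k′ s′ g′} → Enr k s g k′ s′ g′ → T (enrᵇ k s g k′ s′ g′)
enrᵇ-intro {k} {s} {g} {k′} {s′} {g′} (inj₁ p) rewrite <ᵇ-true p | ≡ᵇ-false (ℕ.<⇒≢ p) = tt
enrᵇ-intro {k} {s} {g} {k′} {s′} {g′} (inj₂ (refl , p)) rewrite <ᵇ-false (ℕ.n≮n k) | ≡ᵇ-true {k} refl = go s s′ p
  where
  go : ∀ s s′ → Sg s s′ g g′ → T ((s ∨ not s′) ∧ (not ((s ⇔ᵇ s′) ∧ not s) ∨ (g <ᵇ g′)) ∧ (not ((s ⇔ᵇ s′) ∧ s) ∨ (g′ <ᵇ g)))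
  go false false p = ∧-intro (ℕ.<⇒<ᵇ p) tt
  go true  false p = tt
  go true  true  p = ℕ.<⇒<ᵇ p

module _ {n : ℕ} {X : Set} (lt : X → X → Bool) (γ : X → ℕ) (τ : Fin n → X) where

  okK : Word n → (Fin n → Bool) → Bool
  okK w s = allPairs λ i j → if lt (τ i) (τ j) then enrᵇ (w i) (s i) (γ (τ i)) (w j) (s j) (γ (τ j)) else true

  Kcore-∑ : ∀ w → Kcore lt γ τ w ≡ ∑ (bools n) (λ s → 𝟙 (okK w s))
  Kcore-∑ w = fromℕ-count (okK w) (bools n)

  okK-elim : ∀ {w s} → T (okK w s) → ∀ i j → T (lt (τ i) (τ j)) → Enr (w i) (s i) (γ (τ i)) (w j) (s j) (γ (τ j))
  okK-elim {w} {s} t i j l with lt (τ i) (τ j) | allPairs-elim {p = λ i j → if lt (τ i) (τ j) then enrᵇ (w i) (s i) (γ (τ i)) (w j) (s j) (γ (τ j)) else true} t i j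
  ... | true | u = enrᵇ-elim u

  okK-intro : ∀ {w s} → (∀ i j → T (lt (τ i) (τ j)) → Enr (w i) (s i) (γ (τ i)) (w j) (s j) (γ (τ j))) → T (okK w s)
  okK-intro {w} {s} h = allPairs-intro aux
    where
    aux : ∀ i j → T (if lt (τ i) (τ j) then enrᵇ (w i) (s i) (γ (τ i)) (w j) (s j) (γ (τ j)) else true)
    aux i j with lt (τ i) (τ j) | h i j
    ... | true  | k = enrᵇ-intro (k tt)
    ... | false | _ = tt

  okK-cong : ∀ {w w′ s s′} → (∀ i → w i ≡ w′ i) → (∀ i → s i ≡ s′ i) → okK w s ≡ okK w′ s′
  okK-cong ew es = allPairs-cong (λ i j → cong (λ b → if lt (τ i) (τ j) then b else true) (cong₂ (λ f g → f g)
    (cong₂ (λ k s → λ (p : ℕ × Bool) → enrᵇ k s (γ (τ i)) (proj₁ p) (proj₂ p) (γ (τ j))) (ew i) (es i)) (cong₂ _,_ (ew j) (es j))))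

-- The Dehn–Sommerville relations

raise : ∀ {n} → Word n → ℕ → (Fin n → Bool) → Word n
raise w k D i = if (w i ≡ᵇ k) ∧ D i then suc k else w i

χ : ∀ {n} → Word n → ℕ → (Fin n → Bool) → ℚ
χ w k D = ∏ (λ i → -1^ ((w i ≡ᵇ k) ∧ D i))

-- Coefficient form of: the series does not depend on t after the adjacent
-- variables x_{k+1}, x_{k+2} (the letters k, k+1) are replaced by t, -t.
Balanced : ∀ {n} → Series n → Set
Balanced {n} f = ∀ (w : Word n) k → (∃ λ i → w i ≡ k) → (∀ i → w i ≢ suc k) →
  ∑ (bools n) (λ D → χ w k D * f (raise w k D)) ≡ 0ℚ

raise-hit : ∀ {n} {w : Word n} {k} D {i} → w i ≡ k → raise w k D i ≡ (if D i then suc k else k)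
raise-hit {w = w} D {i} refl rewrite ≡ᵇ-true {w i} refl = refl

raise-miss : ∀ {n} {w : Word n} {k} D {i} → w i ≢ k → raise w k D i ≡ w i
raise-miss D ne rewrite ≡ᵇ-false ne = refl

≢⇒<⊎> : ∀ {x y} → x ≢ y → x ℕ.< y ⊎ y ℕ.< x
≢⇒<⊎> {x} {y} ne with ℕ.<-cmp x y
... | tri< p _ _ = inj₁ p
... | tri≈ _ p _ = ⊥-elim (ne p)
... | tri> _ _ p = inj₂ p

extremal : ∀ {n} (P : Fin n → Set) → (∀ i → Dec (P i)) → (R : Fin n → Fin n → Set) →
  (∀ {i j k} → R i j → R j k → R i k) → (∀ i j → i ≢ j → R i j ⊎ R j i) →
  (∀ i → ¬ P i) ⊎ (∃ λ a → P a × (∀ b → P b → b ≢ a → R b a))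
extremal {zero} P P? R tr tot = inj₁ (λ ())
extremal {suc n} P P? R tr tot with extremal (P ∘ suc) (P? ∘ suc) (λ i j → R (suc i) (suc j)) tr (λ i j ne → tot (suc i) (suc j) (ne ∘ suc-injective)) | P? zero
... | inj₁ none | no ¬p = inj₁ (λ { zero → ¬p ; (suc i) → none i })
... | inj₁ none | yes p = inj₂ (zero , p , λ { zero _ ne → ⊥-elim (ne refl) ; (suc i) q _ → ⊥-elim (none i q) })
... | inj₂ (a , pa , h) | no ¬p = inj₂ (suc a , pa , λ { zero q _ → ⊥-elim (¬p q) ; (suc i) q ne → h i q (ne ∘ cong suc) })
... | inj₂ (a , pa , h) | yes p with tot zero (suc a) (λ ())
...   | inj₁ r = inj₂ (suc a , pa , λ { zero q _ → r ; (suc i) q ne → h i q (ne ∘ cong suc) })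
...   | inj₂ r = inj₂ (zero , p , λ { zero _ ne → ⊥-elim (ne refl) ; (suc i) q _ → below i q })
  where
  below : ∀ i → P (suc i) → R (suc i) zero
  below i q with i ≟ a
  ... | yes refl = r
  ... | no ne = tr (h i q ne) r

up : ℕ → Bool → ℕ
up k d = if d then suc k else k

-- With s = e xor D, a position of the raised block takes the values +k, -(k+1) as D
-- varies if e = false, and -k, +(k+1) if e = true.  Position a has the largest label
-- of the first kind or, if there are none, the smallest label of the second kind;
-- then toggling D at a affects none of the conditions on (D , s) but changes the sign χ.
Pivot : Bool → Bool → ℕ → ℕ → Set
Pivot ea ej ga gj = (ea ≡ false × (ej ≡ false → gj ℕ.< ga)) ⊎ (ea ≡ true × ej ≡ true × ga ℕ.< gj)

-- Each value of `j` admits both values of `a` or neither. If `a` moves between the neighbours +k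
-- and -(k+1), only a tie could tell them apart, and the largest label loses the tie at +k and wins
-- the one at -(k+1), as the order prescribes. If every position moves between -k and +(k+1), the
-- smallest label plays the same role at the two ends.
toggleˡ : ∀ k da dj ea ej ga gj → Pivot ea ej ga gj →
  Enr (up k da) (ea xor da) ga (up k dj) (ej xor dj) gj → Enr (up k (not da)) (ea xor not da) ga (up k dj) (ej xor dj) gj
toggleˡ k false false _ ej ga gj (inj₁ (refl , h)) (inj₁ p) = ⊥-elim (ℕ.n≮n k p)
toggleˡ k false false _ false ga gj (inj₁ (refl , h)) (inj₂ (_ , p)) = ⊥-elim (ℕ.<-asym p (h refl))
toggleˡ k false false _ true ga gj (inj₁ (refl , h)) (inj₂ (_ , ()))
toggleˡ k false true _ false ga gj (inj₁ (refl , h)) E = inj₂ (refl , h refl)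
toggleˡ k false true _ true ga gj (inj₁ (refl , h)) E = inj₂ (refl , tt)
toggleˡ k true false _ ej ga gj (inj₁ (refl , h)) (inj₁ p) = ⊥-elim (ℕ.1+n≰n (ℕ.<⇒≤ p))
toggleˡ k true false _ ej ga gj (inj₁ (refl , h)) (inj₂ (p , _)) = ⊥-elim (ℕ.1+n≢n p)
toggleˡ k true true _ ej ga gj (inj₁ (refl , h)) E = inj₁ (ℕ.n<1+n k)
toggleˡ k false false _ _ ga gj (inj₂ (refl , refl , h)) (inj₁ p) = ⊥-elim (ℕ.n≮n k p)
toggleˡ k false false _ _ ga gj (inj₂ (refl , refl , h)) (inj₂ (_ , p)) = ⊥-elim (ℕ.<-asym p h)
toggleˡ k false true _ _ ga gj (inj₂ (refl , refl , h)) E = inj₂ (refl , h)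
toggleˡ k true false _ _ ga gj (inj₂ (refl , refl , h)) (inj₁ p) = ⊥-elim (ℕ.1+n≰n (ℕ.<⇒≤ p))
toggleˡ k true false _ _ ga gj (inj₂ (refl , refl , h)) (inj₂ (p , _)) = ⊥-elim (ℕ.1+n≢n p)
toggleˡ k true true _ _ ga gj (inj₂ (refl , refl , h)) E = inj₁ (ℕ.n<1+n k)

toggleʳ : ∀ k da dj ea ej ga gj → Pivot ea ej ga gj →
  Enr (up k dj) (ej xor dj) gj (up k da) (ea xor da) ga → Enr (up k dj) (ej xor dj) gj (up k (not da)) (ea xor not da) ga
toggleʳ k false false _ ej ga gj _ E = inj₁ (ℕ.n<1+n k)
toggleʳ k false true _ ej ga gj _ (inj₁ p) = ⊥-elim (ℕ.1+n≰n (ℕ.<⇒≤ p))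
toggleʳ k false true _ ej ga gj _ (inj₂ (p , _)) = ⊥-elim (ℕ.1+n≢n p)
toggleʳ k true false _ false ga gj (inj₁ (refl , h)) E = inj₂ (refl , h refl)
toggleʳ k true false _ true ga gj (inj₁ (refl , h)) E = inj₂ (refl , tt)
toggleʳ k true true _ ej ga gj (inj₁ (refl , h)) (inj₁ p) = ⊥-elim (ℕ.n≮n _ p)
toggleʳ k true true _ false ga gj (inj₁ (refl , h)) (inj₂ (_ , p)) = ⊥-elim (ℕ.<-asym p (h refl))
toggleʳ k true true _ true ga gj (inj₁ (refl , h)) (inj₂ (_ , ()))
toggleʳ k true false _ _ ga gj (inj₂ (refl , refl , h)) E = inj₂ (refl , h)
toggleʳ k true true _ _ ga gj (inj₂ (refl , refl , h)) (inj₁ p) = ⊥-elim (ℕ.n≮n _ p)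
toggleʳ k true true _ _ ga gj (inj₂ (refl , refl , h)) (inj₂ (_ , p)) = ⊥-elim (ℕ.<-asym p h)

up-≤ : ∀ k d → up k d ℕ.≤ suc k
up-≤ k false = ℕ.n≤1+n k
up-≤ k true  = ℕ.≤-refl

≤-up : ∀ k d → k ℕ.≤ up k d
≤-up k false = ℕ.≤-refl
≤-up k true  = ℕ.n≤1+n k

-- A letter other than `k` and `suc k` lies strictly on one side of both, so raising cannot change
-- its comparison.
up-<ˡ : ∀ k d d′ {x} → x ≢ k → x ≢ suc k → up k d ℕ.≤ x → up k d′ ℕ.< x
up-<ˡ k d d′ ne ne′ p = ℕ.≤-<-trans (up-≤ k d′) (ℕ.≤∧≢⇒< (ℕ.≤∧≢⇒< (ℕ.≤-trans (≤-up k d) p) (ne ∘ sym)) (ne′ ∘ sym))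

up-<ʳ : ∀ k d d′ {x} → x ≢ k → x ≢ suc k → x ℕ.≤ up k d → x ℕ.< up k d′
up-<ʳ k d d′ ne ne′ p = ℕ.<-≤-trans (ℕ.≤∧≢⇒< (ℕ.≤-pred (ℕ.≤∧≢⇒< (ℕ.≤-trans p (up-≤ k d)) ne′)) ne) (≤-up k d′)

Enr-≤ : ∀ {k s g k′ s′ g′} → Enr k s g k′ s′ g′ → k ℕ.≤ k′
Enr-≤ (inj₁ p) = ℕ.<⇒≤ p
Enr-≤ (inj₂ (refl , _)) = ℕ.≤-refl

δ : ∀ {n} → Fin n → Fin n → Bool
δ a i = i ==ᶠ a

δ-hit : ∀ {n} (a : Fin n) → δ a a ≡ true
δ-hit a = ≡ᵇ-true {toℕ a} refl

δ-miss : ∀ {n} {a i : Fin n} → i ≢ a → δ a i ≡ false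
δ-miss ne = ≡ᵇ-false (ne ∘ toℕ-injective)

xor-true : ∀ b → b xor true ≡ not b
xor-true false = refl
xor-true true = refl

xor-false : ∀ b → b xor false ≡ b
xor-false false = refl
xor-false true = refl

χ-cong : ∀ {n} (w : Word n) k → Ext (χ w k)
χ-cong w k h = ∏-cong (λ i → cong (λ d → -1^ ((w i ≡ᵇ k) ∧ d)) (h i))

χ-flip : ∀ {n} (w : Word n) k D a → w a ≡ k → χ w k (λ i → D i xor δ a i) ≡ - χ w k D
χ-flip w k D a e = ∏-flip (λ i → -1^ ((w i ≡ᵇ k) ∧ D i)) (λ i → -1^ ((w i ≡ᵇ k) ∧ (D i xor δ a i))) a hit miss
  where
  neg : ∀ b → -1^ (not b) ≡ - -1^ b
  neg false = refl
  neg true = refl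
  hit : -1^ ((w a ≡ᵇ k) ∧ (D a xor δ a a)) ≡ - -1^ ((w a ≡ᵇ k) ∧ D a)
  hit rewrite ≡ᵇ-true e | δ-hit a | xor-true (D a) = neg (D a)
  miss : ∀ i → i ≢ a → -1^ ((w i ≡ᵇ k) ∧ (D i xor δ a i)) ≡ -1^ ((w i ≡ᵇ k) ∧ D i)
  miss i ne rewrite δ-miss ne | xor-false (D i) = refl

raise-cong : ∀ {n} (w : Word n) k {D D′} → (∀ i → D i ≡ D′ i) → ∀ i → raise w k D i ≡ raise w k D′ i
raise-cong w k h i = cong (λ d → if (w i ≡ᵇ k) ∧ d then suc k else w i) (h i)

module _ {n : ℕ} {X : Set} (lt : X → X → Bool) (γ : X → ℕ) (τ : Fin n → X)
         (irr : ∀ i → ¬ T (lt (τ i) (τ i))) (inj : ∀ i j → i ≢ j → γ (τ i) ≢ γ (τ j))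
         (w : Word n) (k : ℕ) (no-suc : ∀ i → w i ≢ suc k) (e : Fin n → Bool) where

  private
    g : Fin n → ℕ
    g i = γ (τ i)

  ok-xor : (Fin n → Bool) → Bool
  ok-xor D = okK lt γ τ (raise w k D) (λ i → e i xor D i)

  -- Only pairs containing `a` change. Against another letter `k` the pivot condition decides;
  -- against any other letter the comparison is strict before and after.
  ok-toggle→ : ∀ a → w a ≡ k → (∀ j → w j ≡ k → j ≢ a → Pivot (e a) (e j) (g a) (g j)) →
    ∀ D D′ → (∀ i → D′ i ≡ D i xor δ a i) → T (ok-xor D) → T (ok-xor D′)
  ok-toggle→ a wa piv D D′ eD t = okK-intro lt γ τ aux
    where
    D′a : D′ a ≡ not (D a)
    D′a = trans (eD a) (trans (cong (D a xor_) (δ-hit a)) (xor-true (D a)))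
    D′i : ∀ i → i ≢ a → D′ i ≡ D i
    D′i i ne = trans (eD i) (trans (cong (D i xor_) (δ-miss ne)) (xor-false (D i)))
    ri : ∀ i → i ≢ a → raise w k D′ i ≡ raise w k D i
    ri i ne = cong (λ d → if (w i ≡ᵇ k) ∧ d then suc k else w i) (D′i i ne)
    aux : ∀ i j → T (lt (τ i) (τ j)) → Enr (raise w k D′ i) (e i xor D′ i) (g i) (raise w k D′ j) (e j xor D′ j) (g j)
    aux i j l with okK-elim lt γ τ t i j l | i ≟ a | j ≟ a
    ... | E | yes refl | yes refl = ⊥-elim (irr i l)
    ... | E | no i≢a | no j≢a rewrite D′i i i≢a | D′i j j≢a = E
    ... | E | yes refl | no j≢a with w j ℕ.≟ k
    ...   | yes wj rewrite raise-hit {w = w} D wa | raise-hit {w = w} D wj | raise-hit {w = w} D′ wa | raise-hit {w = w} D′ wj | D′a | D′i j j≢a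
            = toggleˡ k (D i) (D j) (e i) (e j) (g i) (g j) (piv j wj j≢a) E
    ...   | no wj rewrite raise-hit {w = w} D wa | raise-miss {w = w} D wj | raise-hit {w = w} D′ wa | raise-miss {w = w} D′ wj
            = inj₁ (up-<ˡ k (D i) (D′ i) wj (no-suc j) (Enr-≤ E))
    aux i j l | E | no i≢a | yes refl with w i ℕ.≟ k
    ...   | yes wi rewrite raise-hit {w = w} D wa | raise-hit {w = w} D wi | raise-hit {w = w} D′ wa | raise-hit {w = w} D′ wi | D′a | D′i i i≢a
            = toggleʳ k (D j) (D i) (e j) (e i) (g j) (g i) (piv i wi i≢a) E
    ...   | no wi rewrite raise-hit {w = w} D wa | raise-miss {w = w} D wi | raise-hit {w = w} D′ wa | raise-miss {w = w} D′ wi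
            = inj₁ (up-<ʳ k (D j) (D′ j) wi (no-suc i) (Enr-≤ E))

  pivot-exists : (∃ λ i → w i ≡ k) → ∃ λ a → w a ≡ k × (∀ j → w j ≡ k → j ≢ a → Pivot (e a) (e j) (g a) (g j))
  pivot-exists (i₀ , wi₀) with extremal (λ i → w i ≡ k × e i ≡ false) (λ i → dec i) (λ i j → g i ℕ.< g j) ℕ.<-trans (λ i j ne → ≢⇒<⊎> (inj i j ne))
    where
    dec : ∀ i → Dec (w i ≡ k × e i ≡ false)
    dec i with w i ℕ.≟ k | e i
    ... | yes p | false = yes (p , refl)
    ... | yes p | true = no (λ ())
    ... | no p | _ = no (p ∘ proj₁)
  ... | inj₂ (a , (wa , ea) , h) = a , wa , λ j wj ne → inj₁ (ea , λ ej → h j (wj , ej) ne)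
  ... | inj₁ none with extremal (λ i → w i ≡ k) (λ i → w i ℕ.≟ k) (λ i j → g j ℕ.< g i) (λ p q → ℕ.<-trans q p) (λ i j ne → ≢⇒<⊎> (inj j i (ne ∘ sym)))
  ...   | inj₁ none′ = ⊥-elim (none′ i₀ wi₀)
  ...   | inj₂ (a , wa , h) = a , wa , λ j wj ne → inj₂ (et a wa , et j wj , h j wj ne)
    where
    et : ∀ i → w i ≡ k → e i ≡ true
    et i wi with e i in eq
    ... | true = refl
    ... | false = ⊥-elim (none i (wi , eq))

  ok-xor-cong : Ext ok-xor
  ok-xor-cong h = okK-cong lt γ τ (raise-cong w k h) (λ i → cong (e i xor_) (h i))

  -- The pivot depends on `e` and not on `D`, so toggling it is a translation of the whole cube. It
  -- preserves admissibility and reverses `χ`, hence the sum equals its own negative.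
  signed-sum-vanishes : (∃ λ i → w i ≡ k) → ∑ (bools n) (λ D → χ w k D * 𝟙 (ok-xor D)) ≡ 0ℚ
  signed-sum-vanishes ex with pivot-exists ex
  ... | a , wa , piv = x≡-x⇒x≡0 (trans (sym (∑-xor n (δ a) F ext)) (trans (∑-cong (bools n) step) (∑-neg (bools n) F)))
    where
    F : (Fin n → Bool) → ℚ
    F D = χ w k D * 𝟙 (ok-xor D)
    ext : Ext F
    ext h = cong₂ (λ x b → x * 𝟙 b) (χ-cong w k h) (ok-xor-cong h)
    invol : ∀ x y → x ≡ (x xor y) xor y
    invol false false = refl
    invol false true = refl
    invol true false = refl
    invol true true = refl
    step : ∀ D → F (λ i → D i xor δ a i) ≡ - F D
    step D = trans (cong₂ _*_ (χ-flip w k D a wa) (cong 𝟙 (sym (bool-ext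
        (ok-toggle→ a wa piv D _ (λ _ → refl))
        (ok-toggle→ a wa piv _ D (λ i → invol (D i) (δ a i)))))))
      (sym (ℚ.neg-distribˡ-* (χ w k D) _))

-- Reindexing the signs by `e xor D` separately for each `D` allows the two sums to be exchanged;
-- the inner sum over `D` then vanishes for every `e`.
Kcore-balanced : ∀ {n} {X : Set} (lt : X → X → Bool) (γ : X → ℕ) (τ : Fin n → X) →
  (∀ i → ¬ T (lt (τ i) (τ i))) → (∀ i j → i ≢ j → γ (τ i) ≢ γ (τ j)) → Balanced (Kcore lt γ τ)
Kcore-balanced {n} lt γ τ irr inj w k ex no-suc = begin
  ∑ (bools n) (λ D → χ w k D * Kcore lt γ τ (raise w k D))
    ≡⟨ ∑-cong (bools n) (λ D → trans (cong (χ w k D *_) (trans (Kcore-∑ lt γ τ (raise w k D))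
        (sym (∑-xor n D (λ s → 𝟙 (okK lt γ τ (raise w k D) s)) (λ h → cong 𝟙 (okK-cong lt γ τ {raise w k D} {raise w k D} (λ _ → refl) h))))))
        (sym (∑-*ˡ (χ w k D) (bools n) _))) ⟩
  ∑ (bools n) (λ D → ∑ (bools n) (λ e → χ w k D * 𝟙 (okK lt γ τ (raise w k D) (λ i → e i xor D i))))
    ≡⟨ ∑-swap (bools n) (bools n) _ ⟩
  ∑ (bools n) (λ e → ∑ (bools n) (λ D → χ w k D * 𝟙 (okK lt γ τ (raise w k D) (λ i → e i xor D i))))
    ≡⟨ ∑-zero (bools n) (λ e → signed-sum-vanishes lt γ τ irr inj w k no-suc e ex) ⟩
  0ℚ ∎
  where open ≡-Reasoning

-- Permutations from injections

injective⇒surjective : ∀ {n} (f : Fin n → Fin n) → (∀ {i j} → f i ≡ f j → i ≡ j) → ∀ y → ∃ λ x → f x ≡ y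
injective⇒surjective {suc n} f inj y with Fin.any? (λ x → f x ≟ y)
... | yes p = p
... | no ¬p = ⊥-elim (ℕ.1+n≰n (injective⇒≤ {f = λ x → punchOut (λ e → ¬p (x , sym e))}
                (λ {i} {j} e → inj (punchOut-injective (λ e → ¬p (i , sym e)) (λ e → ¬p (j , sym e)) e))))

injective⇒permutation : ∀ {n} (f : Fin n → Fin n) → (∀ {i j} → f i ≡ f j → i ≡ j) → ∃ λ (π : Permutation′ n) → ∀ i → π ⟨$⟩ʳ i ≡ f i
injective⇒permutation f inj = permutation f (λ y → proj₁ (srj y)) (λ y → proj₂ (srj y)) (λ x → inj (proj₂ (srj (f x)))) , λ i → refl
  where srj = injective⇒surjective f inj

abstract
  ranking⇒permutation : ∀ {n} (g : Fin n → ℕ) → (∀ i → g i ℕ.< n) → (∀ i j → i ≢ j → g i ≢ g j) →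
    ∃ λ (π : Permutation′ n) → ∀ i → toℕ (π ⟨$⟩ʳ i) ≡ g i
  ranking⇒permutation g bd inj with injective⇒permutation (λ i → fromℕ< (bd i)) (λ {i} {j} e → case i ≟ j of λ
      { (yes p) → p ; (no ne) → ⊥-elim (inj i j ne (trans (sym (toℕ-fromℕ< (bd i))) (trans (cong toℕ e) (toℕ-fromℕ< (bd j))))) })
  ... | π , h = π , λ i → trans (cong toℕ (h i)) (toℕ-fromℕ< (bd i))

-- Relations along a chain

adj : ∀ n → (Fin n → Fin n → Bool) → Bool
adj zero r = true
adj (suc zero) r = true
adj (suc (suc n)) r = r zero (suc zero) ∧ adj (suc n) (λ i j → r (suc i) (suc j))

adj-elim : ∀ n {r : Fin n → Fin n → Bool} → (∀ {i j k} → T (r i j) → T (r j k) → T (r i k)) →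
  T (adj n r) → ∀ i j → toℕ i ℕ.< toℕ j → T (r i j)
adj-elim (suc zero) tr t zero zero ()
adj-elim (suc (suc n)) tr t zero (suc zero) _ = proj₁ (∧-elim t)
adj-elim (suc (suc n)) tr t zero (suc (suc j)) _ = tr (proj₁ (∧-elim t)) (adj-elim (suc n) tr (proj₂ (∧-elim t)) zero (suc j) (s≤s z≤n))
adj-elim (suc (suc n)) tr t (suc i) (suc j) (s≤s p) = adj-elim (suc n) tr (proj₂ (∧-elim t)) i j p

adj-intro : ∀ n {r : Fin n → Fin n → Bool} → (∀ i j → toℕ i ℕ.< toℕ j → T (r i j)) → T (adj n r)
adj-intro zero h = tt
adj-intro (suc zero) h = tt
adj-intro (suc (suc n)) h = ∧-intro (h zero (suc zero) (s≤s z≤n)) (adj-intro (suc n) (λ i j p → h (suc i) (suc j) (s≤s p)))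

adj-cong : ∀ n {r r′ : Fin n → Fin n → Bool} → (∀ i j → toℕ j ≡ suc (toℕ i) → r i j ≡ r′ i j) → adj n r ≡ adj n r′
adj-cong zero h = refl
adj-cong (suc zero) h = refl
adj-cong (suc (suc n)) h = cong₂ _∧_ (h zero (suc zero) refl) (adj-cong (suc n) (λ i j e → h (suc i) (suc j) (cong suc e)))

Enr-trans : ∀ {k s g k′ s′ g′ k″ s″ g″} → Enr k s g k′ s′ g′ → Enr k′ s′ g′ k″ s″ g″ → Enr k s g k″ s″ g″
Enr-trans (inj₁ p) (inj₁ q) = inj₁ (ℕ.<-trans p q)
Enr-trans (inj₁ p) (inj₂ (refl , _)) = inj₁ p
Enr-trans (inj₂ (refl , _)) (inj₁ q) = inj₁ q
Enr-trans {s = s} {s′ = s′} {s″ = s″} (inj₂ (refl , p)) (inj₂ (refl , q)) = inj₂ (refl , go s s′ s″ p q)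
  where
  go : ∀ s s′ s″ {g g′ g″} → Sg s s′ g g′ → Sg s′ s″ g′ g″ → Sg s s″ g g″
  go true  _     false p q = tt
  go false false false p q = ℕ.<-trans p q
  go true  true  true  p q = ℕ.<-trans q p
  go true  false true  p ()
  go false true  _     () q
  go false false true  p ()

-- Enr is transitive, so only consecutive positions of a chain matter, and there the
-- labelling is known: it descends from p to the next position iff p lies in C.
sgᵇ : Bool → Bool → Bool → Bool
sgᵇ c true  false = true
sgᵇ c false false = not c
sgᵇ c true  true  = c
sgᵇ c false true  = false

step : ℕ → Bool → Bool → ℕ → Bool → Bool
step l c s l′ s′ = (l <ᵇ l′) ∨ ((l ≡ᵇ l′) ∧ sgᵇ c s s′)

enrᵇ-step : ∀ {k s g k′ s′ g′} c → (c ≡ false → g ℕ.< g′) → (c ≡ true → g′ ℕ.< g) → enrᵇ k s g k′ s′ g′ ≡ step k c s k′ s′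
enrᵇ-step {k} {s} {g} {k′} {s′} {g′} c h₀ h₁ = bool-ext (λ t → to c s s′ h₀ h₁ (enrᵇ-elim t)) (λ t → enrᵇ-intro (from c s s′ h₀ h₁ (∨-elim t)))
  where
  to : ∀ c s s′ → (c ≡ false → g ℕ.< g′) → (c ≡ true → g′ ℕ.< g) → Enr k s g k′ s′ g′ → T (step k c s k′ s′)
  to c s s′ h₀ h₁ (inj₁ p) = ∨-introˡ (ℕ.<⇒<ᵇ p)
  to c s s′ h₀ h₁ (inj₂ (refl , q)) = ∨-introʳ {k <ᵇ k} (∧-intro (ℕ.≡⇒≡ᵇ k k refl) (lem c s s′ h₀ h₁ q))
    where
    lem : ∀ c s s′ → (c ≡ false → g ℕ.< g′) → (c ≡ true → g′ ℕ.< g) → Sg s s′ g g′ → T (sgᵇ c s s′)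
    lem c true false h₀ h₁ q = tt
    lem false false false h₀ h₁ q = tt
    lem true false false h₀ h₁ q = ℕ.<-asym q (h₁ refl)
    lem false true true h₀ h₁ q = ℕ.<-asym q (h₀ refl)
    lem true true true h₀ h₁ q = tt
  from : ∀ c s s′ → (c ≡ false → g ℕ.< g′) → (c ≡ true → g′ ℕ.< g) → T (k <ᵇ k′) ⊎ T ((k ≡ᵇ k′) ∧ sgᵇ c s s′) → Enr k s g k′ s′ g′
  from c s s′ h₀ h₁ (inj₁ p) = inj₁ (ℕ.<ᵇ⇒< k k′ p)
  from c s s′ h₀ h₁ (inj₂ p) with ∧-elim {k ≡ᵇ k′} p
  ... | e , q = inj₂ (ℕ.≡ᵇ⇒≡ k k′ e , lem c s s′ h₀ h₁ q)
    where
    lem : ∀ c s s′ → (c ≡ false → g ℕ.< g′) → (c ≡ true → g′ ℕ.< g) → T (sgᵇ c s s′) → Sg s s′ g g′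
    lem c true false h₀ h₁ q = tt
    lem false false false h₀ h₁ q = h₀ refl
    lem true true true h₀ h₁ q = h₁ refl

-- Ranks

count-below-< : {A : Set} {R : A → A → Bool} (xs : List A) → (∀ {x y z} → T (R x y) → T (R y z) → T (R x z)) → (∀ x → ¬ T (R x x)) →
  ∀ {x y} → x ∈ xs → T (R x y) → count (λ z → R z x) xs ℕ.< count (λ z → R z y) xs
count-below-< xs tr irr x∈ r = count-< (λ z q → tr q r) x∈ r (irr _)

count<length : {A : Set} {p : A → Bool} (xs : List A) {x : A} → x ∈ xs → ¬ T (p x) → count p xs ℕ.< length xs
count<length {p = p} xs x∈ np = subst (count p xs ℕ.<_) (count-true xs) (count-< {p = p} {q = λ _ → true} (λ _ _ → tt) x∈ tt np)

length-allFin : ∀ n → length (allFin n) ≡ n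
length-allFin n = length-tabulate id

lex : {A : Set} (u v : A → ℕ) → A → A → Bool
lex u v y x = (u y <ᵇ u x) ∨ ((u y ≡ᵇ u x) ∧ (v y <ᵇ v x))

lex-elim : {A : Set} {u v : A → ℕ} {y x : A} → T (lex u v y x) → u y ℕ.< u x ⊎ (u y ≡ u x × v y ℕ.< v x)
lex-elim {u = u} {v} {y} {x} t with ∨-elim {u y <ᵇ u x} t
... | inj₁ p = inj₁ (ℕ.<ᵇ⇒< _ _ p)
... | inj₂ p with ∧-elim {u y ≡ᵇ u x} p
...   | e , q = inj₂ (ℕ.≡ᵇ⇒≡ _ _ e , ℕ.<ᵇ⇒< _ _ q)

lex-intro : {A : Set} {u v : A → ℕ} {y x : A} → u y ℕ.< u x ⊎ (u y ≡ u x × v y ℕ.< v x) → T (lex u v y x)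
lex-intro (inj₁ p) = ∨-introˡ (ℕ.<⇒<ᵇ p)
lex-intro {u = u} {v} {y} {x} (inj₂ (e , p)) = ∨-introʳ {u y <ᵇ u x} (∧-intro (ℕ.≡⇒≡ᵇ _ _ e) (ℕ.<⇒<ᵇ p))

lex-trans : {A : Set} {u v : A → ℕ} {x y z : A} → T (lex u v x y) → T (lex u v y z) → T (lex u v x z)
lex-trans {u = u} {v} {x} {y} {z} p q = lex-intro {u = u} {v} (go (lex-elim {u = u} {v} p) (lex-elim {u = u} {v} q))
  where
  go : u x ℕ.< u y ⊎ (u x ≡ u y × v x ℕ.< v y) → u y ℕ.< u z ⊎ (u y ≡ u z × v y ℕ.< v z) → u x ℕ.< u z ⊎ (u x ≡ u z × v x ℕ.< v z)
  go (inj₁ a) (inj₁ b) = inj₁ (ℕ.<-trans a b)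
  go (inj₁ a) (inj₂ (b , _)) = inj₁ (subst (u x ℕ.<_) b a)
  go (inj₂ (a , _)) (inj₁ b) = inj₁ (subst (ℕ._< u z) (sym a) b)
  go (inj₂ (a , a′)) (inj₂ (b , b′)) = inj₂ (trans a b , ℕ.<-trans a′ b′)

lex-irrefl : {A : Set} {u v : A → ℕ} (x : A) → ¬ T (lex u v x x)
lex-irrefl {u = u} {v} x t with lex-elim {u = u} {v} t
... | inj₁ p = ℕ.n≮n _ p
... | inj₂ (_ , p) = ℕ.n≮n _ p

lex-total : {A : Set} {u v : A → ℕ} (x y : A) → v x ≢ v y → T (lex u v x y) ⊎ T (lex u v y x)
lex-total {u = u} {v} x y ne with ℕ.<-cmp (u x) (u y) | ℕ.<-cmp (v x) (v y)
... | tri< p _ _ | _ = inj₁ (lex-intro {u = u} {v} (inj₁ p))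
... | tri> _ _ p | _ = inj₂ (lex-intro {u = u} {v} (inj₁ p))
... | tri≈ _ e _ | tri< q _ _ = inj₁ (lex-intro {u = u} {v} (inj₂ (e , q)))
... | tri≈ _ e _ | tri≈ _ q _ = ⊥-elim (ne q)
... | tri≈ _ e _ | tri> _ _ q = inj₂ (lex-intro {u = u} {v} (inj₂ (sym e , q)))

isOdd : ℕ → Bool
isOdd k = k % 2 ≡ᵇ 1

isOdd-suc : ∀ k → isOdd (suc k) ≡ not (isOdd k)
isOdd-suc zero = refl
isOdd-suc (suc k) = trans (cong (_≡ᵇ 1) (trans (cong (_% 2) (ℕ.+-comm 2 k)) (ℕ.[m+n]%n≡m%n k 2)))
  (trans (sym (not-involutive (isOdd k))) (cong not (sym (isOdd-suc k))))

-- The chain of a set composition and its labellings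

module Chain {n ℓ : ℕ} (c : Fin n → Fin ℓ) where

  key : Fin n → ℕ
  key x = toℕ (c x)

  rank-< : ∀ {x y} → T (lex key toℕ x y) → rank c x ℕ.< rank c y
  rank-< {x} {y} r = count-below-< {R = lex key toℕ} (allFin n)
    (λ {x} {y} {z} → lex-trans {u = key} {v = toℕ} {x} {y} {z}) (lex-irrefl {u = key} {v = toℕ}) (∈-allFin x) r

  rank<n : ∀ x → rank c x ℕ.< n
  rank<n x = subst (rank c x ℕ.<_) (length-allFin n) (count<length (allFin n) (∈-allFin x) (lex-irrefl {u = key} {v = toℕ} x))

  rank-cases : ∀ x y → x ≢ y → rank c x ℕ.< rank c y ⊎ rank c y ℕ.< rank c x
  rank-cases x y ne with lex-total {u = key} {v = toℕ} x y (ne ∘ toℕ-injective)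
  ... | inj₁ r = inj₁ (rank-< r)
  ... | inj₂ r = inj₂ (rank-< r)

  rank-injective : ∀ x y → x ≢ y → rank c x ≢ rank c y
  rank-injective x y ne e with rank-cases x y ne
  ... | inj₁ p = ℕ.<⇒≢ p e
  ... | inj₂ p = ℕ.<⇒≢ p (sym e)

  ρ : Permutation′ n
  ρ = proj₁ (ranking⇒permutation (rank c) rank<n rank-injective)

  ρ-rank : ∀ x → toℕ (ρ ⟨$⟩ʳ x) ≡ rank c x
  ρ-rank = proj₂ (ranking⇒permutation (rank c) rank<n rank-injective)

  -- This is the permutation that lists the blocks from left to right, each increasingly; `rank c`
  -- is its inverse.
  at : Fin n → Fin n
  at p = ρ ⟨$⟩ˡ p

  rank-at : ∀ p → rank c (at p) ≡ toℕ p
  rank-at p = trans (sym (ρ-rank (at p))) (cong toℕ (inverseʳ ρ))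

  at-rank : ∀ {p x} → rank c x ≡ toℕ p → x ≡ at p
  at-rank {p} {x} e = trans (sym (inverseˡ ρ)) (cong at (toℕ-injective (trans (ρ-rank x) e)))

  rank⇒key : ∀ {x y} → rank c x ℕ.< rank c y → key x ℕ.≤ key y
  rank⇒key {x} {y} p = ℕ.≮⇒≥ (λ q → ℕ.<-asym p (rank-< {y} {x} (lex-intro {u = key} {v = toℕ} (inj₁ q))))

  less : Fin n → ℕ
  less x = count (λ y → c y <ᶠ c x) (allFin n)

  size : Fin n → ℕ
  size x = count (λ y → c y ==ᶠ c x) (allFin n)

  rank-split : ∀ x → rank c x ≡ less x ℕ.+ offset c x
  rank-split x = count-∨ (allFin n) (λ y p q → ℕ.<⇒≢ (ℕ.<ᵇ⇒< (key y) (key x) p) (ℕ.≡ᵇ⇒≡ (key y) (key x) (proj₁ (∧-elim {c y ==ᶠ c x} q))))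

  less+size : ∀ x → less x ℕ.+ size x ≡ count (λ y → (c y <ᶠ c x) ∨ (c y ==ᶠ c x)) (allFin n)
  less+size x = sym (count-∨ (allFin n) (λ y p q → ℕ.<⇒≢ (ℕ.<ᵇ⇒< (key y) (key x) p) (ℕ.≡ᵇ⇒≡ (key y) (key x) q)))

  offset<size : ∀ x → offset c x ℕ.< size x
  offset<size x = count-< {p = λ y → (c y ==ᶠ c x) ∧ (y <ᶠ x)} {q = λ y → c y ==ᶠ c x} (λ y t → proj₁ (∧-elim {c y ==ᶠ c x} t)) (∈-allFin x)
    (ℕ.≡⇒≡ᵇ (key x) _ refl) (λ t → ℕ.n≮n (toℕ x) (ℕ.<ᵇ⇒< _ _ (proj₂ (∧-elim {c x ==ᶠ c x} t))))

  same-block : ∀ {x y} → rank c y ≡ suc (rank c x) → key x ≡ key y → offset c y ≡ suc (offset c x)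
  same-block {x} {y} e k = ℕ.+-cancelˡ-≡ (less x) _ _ (trans (cong (ℕ._+ offset c y) less≡) (trans (sym (rank-split y)) (trans e (trans (cong suc (rank-split x)) (sym (ℕ.+-suc _ _))))))
    where
    less≡ : less x ≡ less y
    less≡ = count-cong (allFin n) (λ z → cong (key z <ᵇ_) k)

  -- Everything up to the end of the block of `x` precedes the block of `y`, so `less x + size x` is
  -- at most `less y`, hence at most the rank of `y`, which is `less x + offset x + 1`. Since the
  -- offset is below the size, all these are equal.
  next-block : ∀ {x y} → rank c y ≡ suc (rank c x) → key x ℕ.< key y → suc (offset c x) ≡ size x × offset c y ≡ 0
  next-block {x} {y} e k = ℕ.≤-antisym (offset<size x) (ℕ.+-cancelˡ-≤ (less x) _ _ lem₁)
    , ℕ.n≤0⇒n≡0 (ℕ.+-cancelˡ-≤ (less y) _ _ lem₂)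
    where
    below : less x ℕ.+ size x ℕ.≤ less y
    below = subst (ℕ._≤ less y) (sym (less+size x)) (count-≤ (allFin n) (λ z t → ℕ.<⇒<ᵇ (ℕ.≤-<-trans (h z (∨-elim {key z <ᵇ key x} t)) k)))
      where
      h : ∀ z → T (key z <ᵇ key x) ⊎ T (key z ≡ᵇ key x) → key z ℕ.≤ key x
      h z (inj₁ p) = ℕ.<⇒≤ (ℕ.<ᵇ⇒< _ _ p)
      h z (inj₂ p) = ℕ.≤-reflexive (ℕ.≡ᵇ⇒≡ _ _ p)
    total : less y ℕ.+ offset c y ≡ less x ℕ.+ suc (offset c x)
    total = trans (sym (rank-split y)) (trans e (trans (cong suc (rank-split x)) (sym (ℕ.+-suc _ _))))
    lem₁ : less x ℕ.+ size x ℕ.≤ less x ℕ.+ suc (offset c x)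
    lem₁ = ℕ.≤-trans below (ℕ.≤-trans (ℕ.m≤m+n (less y) (offset c y)) (ℕ.≤-reflexive total))
    lem₂ : less y ℕ.+ offset c y ℕ.≤ less y ℕ.+ 0
    lem₂ = ℕ.≤-trans (ℕ.≤-reflexive total) (ℕ.≤-trans (ℕ.+-monoʳ-≤ (less x) (offset<size x)) (ℕ.≤-trans below (ℕ.≤-reflexive (sym (ℕ.+-identityʳ _)))))

  last-in-block : ∀ {x} → suc (rank c x) ≡ n → suc (offset c x) ≡ size x
  last-in-block {x} e = ℕ.≤-antisym (offset<size x) (ℕ.+-cancelˡ-≤ (less x) _ _ (ℕ.≤-trans le
    (ℕ.≤-reflexive (trans (sym e) (trans (cong suc (rank-split x)) (sym (ℕ.+-suc _ _)))))))
    where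
    le : less x ℕ.+ size x ℕ.≤ n
    le = subst₂ ℕ._≤_ (sym (less+size x)) (trans (count-true (allFin n)) (length-allFin n)) (count-≤ (allFin n) (λ _ _ → tt))

  first-in-block : ∀ {x} → rank c x ≡ 0 → offset c x ≡ 0
  first-in-block {x} e = ℕ.m+n≡0⇒n≡0 (less x) (trans (sym (rank-split x)) e)

  module Labels (C : Fin n → Bool) where

    sg : ℕ → ℕ
    sg = seg c C

    -- `γpk` is the rank function of this strict total order, in which later runs come first and
    -- each run is read from left to right.
    R : ℕ → ℕ → Bool
    R q p = (sg p <ᵇ sg q) ∨ ((sg q ≡ᵇ sg p) ∧ (q <ᵇ p))

    R-elim : ∀ q p → T (R q p) → sg p ℕ.< sg q ⊎ (sg q ≡ sg p × q ℕ.< p)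
    R-elim q p t with ∨-elim {sg p <ᵇ sg q} t
    ... | inj₁ u = inj₁ (ℕ.<ᵇ⇒< _ _ u)
    ... | inj₂ u with ∧-elim {sg q ≡ᵇ sg p} u
    ...   | e , v = inj₂ (ℕ.≡ᵇ⇒≡ _ _ e , ℕ.<ᵇ⇒< _ _ v)

    R-intro : ∀ q p → sg p ℕ.< sg q ⊎ (sg q ≡ sg p × q ℕ.< p) → T (R q p)
    R-intro q p (inj₁ u) = ∨-introˡ (ℕ.<⇒<ᵇ u)
    R-intro q p (inj₂ (e , v)) = ∨-introʳ {sg p <ᵇ sg q} (∧-intro (ℕ.≡⇒≡ᵇ _ _ e) (ℕ.<⇒<ᵇ v))

    R-trans : ∀ {x y z} → T (R x y) → T (R y z) → T (R x z)
    R-trans {x} {y} {z} p q = R-intro x z (go (R-elim x y p) (R-elim y z q))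
      where
      go : sg y ℕ.< sg x ⊎ (sg x ≡ sg y × x ℕ.< y) → sg z ℕ.< sg y ⊎ (sg y ≡ sg z × y ℕ.< z) → sg z ℕ.< sg x ⊎ (sg x ≡ sg z × x ℕ.< z)
      go (inj₁ a) (inj₁ b) = inj₁ (ℕ.<-trans b a)
      go (inj₁ a) (inj₂ (b , _)) = inj₁ (subst (ℕ._< sg x) b a)
      go (inj₂ (a , _)) (inj₁ b) = inj₁ (subst (sg z ℕ.<_) (sym a) b)
      go (inj₂ (a , a′)) (inj₂ (b , b′)) = inj₂ (trans a b , ℕ.<-trans a′ b′)

    R-irrefl : ∀ x → ¬ T (R x x)
    R-irrefl x t with R-elim x x t
    ... | inj₁ p = ℕ.n≮n _ p
    ... | inj₂ (_ , p) = ℕ.n≮n _ p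

    γ : ℕ → ℕ
    γ = γpk c C

    γ-count : ∀ p → γ p ≡ count (λ q → R q p) (upTo n)
    γ-count p = sym (count-∨ (upTo n) (λ q u v → ℕ.<⇒≢ (ℕ.<ᵇ⇒< (sg p) (sg q) u) (sym (ℕ.≡ᵇ⇒≡ (sg q) (sg p) (proj₁ (∧-elim {sg q ≡ᵇ sg p} v))))))

    γ-< : ∀ p q → p ℕ.< n → T (R p q) → γ p ℕ.< γ q
    γ-< p q p<n r = subst₂ ℕ._<_ (sym (γ-count p)) (sym (γ-count q))
      (count-below-< {R = R} (upTo n) (λ {x} {y} {z} → R-trans {x} {y} {z}) R-irrefl {p} {q} (∈-upTo⁺ p<n) r)

    γ<n : ∀ {p} → p ℕ.< n → γ p ℕ.< n
    γ<n {p} p<n = subst₂ ℕ._<_ (sym (γ-count p)) (length-upTo n) (count<length {p = λ q → R q p} (upTo n) (∈-upTo⁺ p<n) (R-irrefl p))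

    γ-injective : ∀ {p q} → p ℕ.< n → q ℕ.< n → p ≢ q → γ p ≢ γ q
    γ-injective {p} {q} p<n q<n ne e with ℕ.<-cmp (sg p) (sg q) | ℕ.<-cmp p q
    ... | tri< a _ _ | _ = ℕ.<⇒≢ (γ-< q p q<n (R-intro q p (inj₁ a))) (sym e)
    ... | tri> _ _ a | _ = ℕ.<⇒≢ (γ-< p q p<n (R-intro p q (inj₁ a))) e
    ... | tri≈ _ a _ | tri< b _ _ = ℕ.<⇒≢ (γ-< p q p<n (R-intro p q (inj₂ (a , b)))) e
    ... | tri≈ _ a _ | tri≈ _ b _ = ne b
    ... | tri≈ _ a _ | tri> _ _ b = ℕ.<⇒≢ (γ-< q p q<n (R-intro q p (inj₂ (sym a , b)))) (sym e)

    -- `seg` counts the elements of `C` strictly before a position, so only the element at `p` can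
    -- make it change from `p` to the next position.
    seg-ascent : ∀ p → C (at p) ≡ false → sg (suc (toℕ p)) ≡ sg (toℕ p)
    seg-ascent p Cp = count-cong (allFin n) lem
      where
      lem : ∀ x → (C x ∧ (rank c x <ᵇ suc (toℕ p))) ≡ (C x ∧ (rank c x <ᵇ toℕ p))
      lem x with rank c x ℕ.≟ toℕ p
      ... | yes e rewrite at-rank {p} {x} e | Cp = refl
      ... | no ne = cong (C x ∧_) (bool-ext (λ t → ℕ.<⇒<ᵇ (ℕ.≤∧≢⇒< (ℕ.≤-pred (ℕ.<ᵇ⇒< (rank c x) (suc (toℕ p)) t)) ne)) (λ t → ℕ.<⇒<ᵇ (ℕ.m≤n⇒m≤1+n (ℕ.<ᵇ⇒< (rank c x) (toℕ p) t))))

    seg-descent : ∀ p → C (at p) ≡ true → sg (toℕ p) ℕ.< sg (suc (toℕ p))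
    seg-descent p Cp = count-< {p = λ x → C x ∧ (rank c x <ᵇ toℕ p)} {q = λ x → C x ∧ (rank c x <ᵇ suc (toℕ p))}
      (λ x t → ∧-intro (proj₁ (∧-elim {C x} t)) (ℕ.<⇒<ᵇ (ℕ.m≤n⇒m≤1+n (ℕ.<ᵇ⇒< (rank c x) (toℕ p) (proj₂ (∧-elim {C x} t))))))
      (∈-allFin (at p)) (∧-intro (≡⇒T Cp) (ℕ.<⇒<ᵇ (s≤s (ℕ.≤-reflexive (rank-at p)))))
      (λ t → ℕ.<⇒≢ (ℕ.<ᵇ⇒< (rank c (at p)) (toℕ p) (proj₂ (∧-elim {C (at p)} t))) (rank-at p))

    okK-chain : ∀ w s → okK _<ᵇ_ γ (rank c) w s ≡
      adj n (λ p q → step (w (at p)) (C (at p)) (s (at p)) (w (at q)) (s (at q)))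
    okK-chain w s = trans (bool-ext to from) (adj-cong n consecutive)
      where
      r : Fin n → Fin n → Bool
      r p q = enrᵇ (w (at p)) (s (at p)) (γ (toℕ p)) (w (at q)) (s (at q)) (γ (toℕ q))
      to : T (okK _<ᵇ_ γ (rank c) w s) → T (adj n r)
      to t = adj-intro n (λ p q p<q → enrᵇ-intro (subst₂ (λ a b → Enr (w (at p)) (s (at p)) (γ a) (w (at q)) (s (at q)) (γ b)) (rank-at p) (rank-at q)
        (okK-elim _<ᵇ_ γ (rank c) {w} {s} t (at p) (at q) (ℕ.<⇒<ᵇ (subst₂ ℕ._<_ (sym (rank-at p)) (sym (rank-at q)) p<q)))))
      from : T (adj n r) → T (okK _<ᵇ_ γ (rank c) w s)
      from t = okK-intro _<ᵇ_ γ (rank c) {w} {s} (λ i j l → subst₂ P (inverseˡ ρ) (inverseˡ ρ) (pair (ρ ⟨$⟩ʳ i) (ρ ⟨$⟩ʳ j)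
          (subst₂ ℕ._<_ (sym (ρ-rank i)) (sym (ρ-rank j)) (ℕ.<ᵇ⇒< (rank c i) (rank c j) l))))
        where
        P : Fin n → Fin n → Set
        P i j = Enr (w i) (s i) (γ (rank c i)) (w j) (s j) (γ (rank c j))
        pair : ∀ p q → toℕ p ℕ.< toℕ q → P (at p) (at q)
        pair p q p<q = subst₂ (λ a b → Enr (w (at p)) (s (at p)) (γ a) (w (at q)) (s (at q)) (γ b)) (sym (rank-at p)) (sym (rank-at q))
          (enrᵇ-elim (adj-elim n {r} (λ {i} {j} {k} u v → enrᵇ-intro (Enr-trans (enrᵇ-elim {w (at i)} {s (at i)} {γ (toℕ i)} {w (at j)} {s (at j)} {γ (toℕ j)} u) (enrᵇ-elim {w (at j)} {s (at j)} {γ (toℕ j)} {w (at k)} {s (at k)} {γ (toℕ k)} v))) t p q p<q))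
      consecutive : ∀ p q → toℕ q ≡ suc (toℕ p) → r p q ≡ step (w (at p)) (C (at p)) (s (at p)) (w (at q)) (s (at q))
      consecutive p q e = enrᵇ-step {w (at p)} {s (at p)} {γ (toℕ p)} {w (at q)} {s (at q)} {γ (toℕ q)} (C (at p))
        (λ Cp → γ-< (toℕ p) (toℕ q) (toℕ<n p) (R-intro (toℕ p) (toℕ q) (inj₂ (sym (trans (cong sg e) (seg-ascent p Cp)) , ℕ.≤-reflexive (sym e)))))
        (λ Cp → γ-< (toℕ q) (toℕ p) (toℕ<n q) (R-intro (toℕ q) (toℕ p) (inj₁ (subst (λ z → sg (toℕ p) ℕ.< sg z) (sym e) (seg-descent p Cp)))))

-- Transfer matrices

𝟙-∧ : ∀ a b → 𝟙 (a ∧ b) ≡ 𝟙 a * 𝟙 b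
𝟙-∧ true  b = sym (ℚ.*-identityˡ (𝟙 b))
𝟙-∧ false b = sym (ℚ.*-zeroˡ (𝟙 b))

-- weight B C is (-1)^(|B| - |C|) if C ⊆ B and 0 otherwise, written as a product.
coeff : Bool → Bool → ℚ
coeff false false = 1ℚ
coeff false true  = 0ℚ
coeff true  false = - 1ℚ
coeff true  true  = 1ℚ

weight : ∀ {n} → (Fin n → Bool) → (Fin n → Bool) → ℚ
weight b C = ∏ (λ p → coeff (b p) (C p))

weight-cong : ∀ {n} (b : Fin n → Bool) → Ext (weight b)
weight-cong b h = ∏-cong (λ p → cong (coeff (b p)) (h p))

all-suc : ∀ {n} (p : Fin (suc n) → Bool) → all p (allFin (suc n)) ≡ p zero ∧ all (λ i → p (suc i)) (allFin n)
all-suc {n} p = bool-ext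
  (λ t → ∧-intro (all-elim {p = p} t zero) (all-intro {p = λ i → p (suc i)} (λ i → all-elim {p = p} t (suc i))))
  (λ t → all-intro {p = p} (λ { zero → proj₁ (∧-elim {p zero} t) ; (suc i) → all-elim {p = λ i → p (suc i)} (proj₂ (∧-elim {p zero} t)) i }))

subᵇ : ∀ {n} → (Fin n → Bool) → (Fin n → Bool) → Bool
subᵇ {n} C B = all (λ x → not (C x) ∨ B x) (allFin n)

subᵇ-count : ∀ {n} (C B : Fin n → Bool) → T (subᵇ C B) → count C (allFin n) ℕ.≤ count B (allFin n)
subᵇ-count {n} C B t = count-≤ (allFin n) (λ x → lem (C x) (B x) (all-elim {p = λ x → not (C x) ∨ B x} t x))
  where
  lem : ∀ a b → T (not a ∨ b) → T a → T b
  lem true b t _ = t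

weight-signed : ∀ {n} (C B : Fin n → Bool) →
  (if subᵇ C B then signℚ (count B (allFin n) ℕ.∸ count C (allFin n)) else 0ℚ) ≡ weight B C
weight-signed {zero} C B = refl
weight-signed {suc n} C B rewrite all-suc (λ x → not (C x) ∨ B x) | count-allFin-suc B | count-allFin-suc C
  = go (C zero) (B zero) (subᵇ C′ B′) refl (weight-signed C′ B′)
  where
  C′ B′ : Fin n → Bool
  C′ i = C (suc i)
  B′ i = B (suc i)
  cC cB : ℕ
  cC = count C′ (allFin n)
  cB = count B′ (allFin n)
  go : ∀ c b a → subᵇ C′ B′ ≡ a → (if a then signℚ (cB ℕ.∸ cC) else 0ℚ) ≡ weight B′ C′ →
    (if (not c ∨ b) ∧ a then signℚ ((if b then suc cB else cB) ℕ.∸ (if c then suc cC else cC)) else 0ℚ) ≡ coeff b c * weight B′ C′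
  go true  false a     eq h = sym (ℚ.*-zeroˡ (weight B′ C′))
  go c     b     false eq h = trans (lem c b) (trans (sym (ℚ.*-zeroʳ (coeff b c))) (cong (coeff b c *_) h))
    where
    lem : ∀ c b → (if (not c ∨ b) ∧ false then signℚ ((if b then suc cB else cB) ℕ.∸ (if c then suc cC else cC)) else 0ℚ) ≡ 0ℚ
    lem false false = refl
    lem false true = refl
    lem true false = refl
    lem true true = refl
  go true  true  true eq h = trans h (sym (ℚ.*-identityˡ (weight B′ C′)))
  go false false true eq h = trans h (sym (ℚ.*-identityˡ (weight B′ C′)))
  -- Truncated subtraction is exact here: `C′ ⊆ B′` gives `cC ≤ cB`, so the extra element of the
  -- peak set contributes one sign change.
  go false true  true eq h = trans (cong signℚ (ℕ.+-∸-assoc 1 (subᵇ-count C′ B′ (≡⇒T eq)))) (trans (signℚ-suc (cB ℕ.∸ cC))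
    (trans (cong -_ h) (trans (cong -_ (sym (ℚ.*-identityˡ (weight B′ C′)))) (ℚ.neg-distribˡ-* 1ℚ (weight B′ C′)))))

stepR : ∀ {n} → (Fin n → ℕ) → (Fin n → Bool) → (Fin n → Bool) → Fin n → Fin n → Bool
stepR l C s p q = step (l p) (C p) (s p) (l q) (s q)

stepR-cong : ∀ {n} (l : Fin n → ℕ) {C C′ s s′} → (∀ i → C i ≡ C′ i) → (∀ i → s i ≡ s′ i) → adj n (stepR l C s) ≡ adj n (stepR l C′ s′)
stepR-cong {n} l hC hs = adj-cong n (λ p q _ → lem {l p} {l q} (hC p) (hs p) (hs q))
  where
  lem : ∀ {k k′ c c′ a a′ b b′} → c ≡ c′ → a ≡ a′ → b ≡ b′ → step k c a k′ b ≡ step k c′ a′ k′ b′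
  lem refl refl refl = refl

-- The two-by-two transfer matrix in the signs `x` and `y` of neighbouring positions, with the
-- membership of the first position in `C` already summed out.
entry : ℕ → Bool → Bool → ℕ → Bool → ℚ
entry l b x l′ y = coeff b true * 𝟙 (step l true x l′ y) + coeff b false * 𝟙 (step l false x l′ y)

-- The sum over C and over all signs but the first, which is x.
suffixSum : ∀ m → (Fin (suc m) → ℕ) → (Fin (suc m) → Bool) → Bool → ℚ
suffixSum zero    l b x = coeff (b zero) true + coeff (b zero) false
suffixSum (suc m) l b x = entry (l zero) (b zero) x (l (suc zero)) true  * suffixSum m (λ i → l (suc i)) (λ i → b (suc i)) true
                + entry (l zero) (b zero) x (l (suc zero)) false * suffixSum m (λ i → l (suc i)) (λ i → b (suc i)) false

-- Membership of a position in `C` enters only its own `coeff` and the step leaving it, so the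
-- double sum factors position by position.
transfer : ∀ m l b x →
  ∑ (bools (suc m)) (λ C → ∑ (bools m) (λ s → weight b C * 𝟙 (adj (suc m) (stepR l C (x ∷ᶠ s))))) ≡ suffixSum m l b x
transfer zero l b x = lem (b zero)
  where
  lem : ∀ c → (((coeff c true * 1ℚ) * 1ℚ) + 0ℚ) + ((((coeff c false * 1ℚ) * 1ℚ) + 0ℚ) + 0ℚ) ≡ coeff c true + coeff c false
  lem true = refl
  lem false = refl
transfer (suc m) l b x = trans (∑-bools-suc (suc m) _) (trans (cong₂ _+_ (half true) (half false))
  (regroup (coeff (b zero) true) (coeff (b zero) false) (𝟙 (step l₀ true x l₁ true)) (𝟙 (step l₀ true x l₁ false))
           (𝟙 (step l₀ false x l₁ true)) (𝟙 (step l₀ false x l₁ false)) (suffixSum m l′ b′ true) (suffixSum m l′ b′ false)))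
  where
  l₀ l₁ : ℕ
  l₀ = l zero
  l₁ = l (suc zero)
  l′ : Fin (suc m) → ℕ
  l′ i = l (suc i)
  b′ : Fin (suc m) → Bool
  b′ i = b (suc i)
  open +-*-Solver
  regroup : ∀ p q α β γ δ z y → (((p * α) * z) + ((p * β) * y)) + (((q * γ) * z) + ((q * δ) * y)) ≡ (p * α + q * γ) * z + (p * β + q * δ) * y
  regroup = solve 8 (λ p q α β γ δ z y → (((p :* α) :* z) :+ ((p :* β) :* y)) :+ (((q :* γ) :* z) :+ ((q :* δ) :* y)) := (p :* α :+ q :* γ) :* z :+ (p :* β :+ q :* δ) :* y) refl
  shuffle : ∀ a b c d → (a * b) * (c * d) ≡ (a * c) * (b * d)
  shuffle = solve 4 (λ a b c d → (a :* b) :* (c :* d) := (a :* c) :* (b :* d)) refl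
  G : (Fin (suc (suc m)) → Bool) → (Fin (suc m) → Bool) → ℚ
  G C s = weight b C * 𝟙 (adj (suc (suc m)) (stepR l C (x ∷ᶠ s)))
  quarter : ∀ c y → ∑ (bools (suc m)) (λ C → ∑ (bools m) (λ s → G (c ∷ᶠ C) (y ∷ᶠ s))) ≡ (coeff (b zero) c * 𝟙 (step l₀ c x l₁ y)) * suffixSum m l′ b′ y
  quarter c y = begin
    ∑ (bools (suc m)) (λ C → ∑ (bools m) (λ s → G (c ∷ᶠ C) (y ∷ᶠ s)))
      ≡⟨ ∑-cong (bools (suc m)) (λ C → trans (∑-cong (bools m) (λ s → trans
           (cong (weight b (c ∷ᶠ C) *_) (𝟙-∧ (step l₀ c x l₁ y) (adj (suc m) (stepR l′ C (y ∷ᶠ s)))))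
           (shuffle (coeff (b zero) c) (weight b′ C) (𝟙 (step l₀ c x l₁ y)) _)))
         (∑-*ˡ (coeff (b zero) c * 𝟙 (step l₀ c x l₁ y)) (bools m) _)) ⟩
    ∑ (bools (suc m)) (λ C → (coeff (b zero) c * 𝟙 (step l₀ c x l₁ y)) * ∑ (bools m) (λ s → weight b′ C * 𝟙 (adj (suc m) (stepR l′ C (y ∷ᶠ s)))))
      ≡⟨ ∑-*ˡ (coeff (b zero) c * 𝟙 (step l₀ c x l₁ y)) (bools (suc m)) _ ⟩
    (coeff (b zero) c * 𝟙 (step l₀ c x l₁ y)) * ∑ (bools (suc m)) (λ C → ∑ (bools m) (λ s → weight b′ C * 𝟙 (adj (suc m) (stepR l′ C (y ∷ᶠ s)))))
      ≡⟨ cong ((coeff (b zero) c * 𝟙 (step l₀ c x l₁ y)) *_) (transfer m l′ b′ y) ⟩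
    (coeff (b zero) c * 𝟙 (step l₀ c x l₁ y)) * suffixSum m l′ b′ y ∎
    where open ≡-Reasoning
  half : ∀ c → ∑ (bools (suc m)) (λ C → ∑ (bools (suc m)) (G (c ∷ᶠ C))) ≡
    (coeff (b zero) c * 𝟙 (step l₀ c x l₁ true)) * suffixSum m l′ b′ true + (coeff (b zero) c * 𝟙 (step l₀ c x l₁ false)) * suffixSum m l′ b′ false
  half c = trans (∑-cong (bools (suc m)) (λ C → ∑-bools-suc m (G (c ∷ᶠ C))))
    (trans (∑-+ (bools (suc m)) _ _) (cong₂ _+_ (quarter c true) (quarter c false)))

-- Closed form of the transfer product

equalEntry : Bool → Bool → Bool → ℚ
equalEntry false x     false = 1ℚ
equalEntry false x     true  = 0ℚ
equalEntry true  true  true  = 1ℚ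
equalEntry true  false false = - 1ℚ
equalEntry true  true  false = 0ℚ
equalEntry true  false true  = 0ℚ

entry-< : ∀ {l l′} b x y → l ℕ.< l′ → entry l b x l′ y ≡ (if b then 0ℚ else 1ℚ)
entry-< {l} {l′} b x y p rewrite <ᵇ-true p = go b
  where
  go : ∀ b → coeff b true * 1ℚ + coeff b false * 1ℚ ≡ (if b then 0ℚ else 1ℚ)
  go true = refl
  go false = refl

-- Off the peak set the matrix forgets `x` and forces the next sign to be positive. On the peak set
-- the alternating sum over `C` leaves the diagonal matrix with entries 1 and -1.
entry-≡ : ∀ {l} b x y → entry l b x l y ≡ equalEntry b x y
entry-≡ {l} b x y rewrite <ᵇ-false (ℕ.n≮n l) | ≡ᵇ-true {l} refl = go b x y
  where
  go : ∀ b x y → coeff b true * 𝟙 (sgᵇ true x y) + coeff b false * 𝟙 (sgᵇ false x y) ≡ equalEntry b x y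
  go false false false = refl
  go false true  false = refl
  go false false true  = refl
  go false true  true  = refl
  go true  true  true  = refl
  go true  false false = refl
  go true  true  false = refl
  go true  false true  = refl

entry-> : ∀ {l l′} b x y → l′ ℕ.< l → entry l b x l′ y ≡ 0ℚ
entry-> {l} {l′} b x y p rewrite <ᵇ-false (ℕ.<⇒≯ p) | ≡ᵇ-false (ℕ.>⇒≢ p) = go b
  where
  go : ∀ b → coeff b true * 0ℚ + coeff b false * 0ℚ ≡ 0ℚ
  go true = refl
  go false = refl

-- The local form of "constant on blocks and weakly increasing between blocks"; it is transitive, so
-- it can be tested on neighbours of the chain.
cmp : ℕ → ℕ → ℕ → ℕ → Bool
cmp k l k′ l′ = ((k <ᵇ k′) ∧ not (l′ <ᵇ l)) ∨ ((k ≡ᵇ k′) ∧ (l ≡ᵇ l′))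

-- The whole dependence of a suffix sum on its first sign: that sign matters only at a position of
-- the peak set.
headSign : Bool → Bool → ℚ
headSign x b = -1^ (b ∧ x)

leaps : ℕ → ℕ → ℚ
leaps l l′ = if l <ᵇ l′ then 1ℚ + 1ℚ else 1ℚ

-- For weakly increasing `l` this is 2^(number of letters - 1).
letterWeight : ∀ m → (Fin (suc m) → ℕ) → ℚ
letterWeight zero    l = 1ℚ
letterWeight (suc m) l = leaps (l zero) (l (suc zero)) * letterWeight m (λ i → l (suc i))

peakSign : ∀ {n} → (Fin n → Bool) → ℚ
peakSign b = ∏ (λ p → -1^ (b p))

-- Oddness of the blocks enters here. Inside a block the parity of the offset alternates; a block of
-- odd size ends at an even offset and the next one starts at offset 0, so both sides of a boundary
-- lie outside the peak set.
Shape : ℕ → Bool → ℕ → Bool → Set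
Shape k b k′ b′ = (k ≡ k′ × b′ ≡ not b) ⊎ (k ℕ.< k′ × b ≡ false × b′ ≡ false)

-- A strict increase inside a block contributes 0: leaving a peak the matrix vanishes, and entering
-- a peak the two next signs cancel. A strict increase between blocks leaves the next sign free,
-- which gives the factor 2. Equal letters determine the next sign, and a decrease is never allowed.
transfer-step : ∀ l₀ l₁ k₀ k₁ b₀ b₁ x a z t → Shape k₀ b₀ k₁ b₁ →
  entry l₀ b₀ x l₁ true * (if a then (headSign true b₁ * z) * t else 0ℚ) + entry l₀ b₀ x l₁ false * (if a then (headSign false b₁ * z) * t else 0ℚ)
  ≡ (if cmp k₀ l₀ k₁ l₁ ∧ a then (headSign x b₀ * (-1^ b₀ * z)) * (leaps l₀ l₁ * t) else 0ℚ)
transfer-step l₀ l₁ k₀ k₁ b₀ b₁ x false z t sh = trans (cong₂ _+_ (ℚ.*-zeroʳ (entry l₀ b₀ x l₁ true)) (ℚ.*-zeroʳ (entry l₀ b₀ x l₁ false))) (lem (cmp k₀ l₀ k₁ l₁))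
  where
  lem : ∀ c {r} → 0ℚ + 0ℚ ≡ (if c ∧ false then r else 0ℚ)
  lem true = refl
  lem false = refl
transfer-step l₀ l₁ k₀ k₁ b₀ b₁ x true z t sh with ℕ.<-cmp l₀ l₁
transfer-step l₀ l₁ k₀ .k₀ b₀ b₁ x true z t (inj₁ (refl , e)) | tri< p ne _
  rewrite entry-< b₀ x true p | entry-< b₀ x false p | <ᵇ-false (ℕ.n≮n k₀) | ≡ᵇ-true {k₀} refl | ≡ᵇ-false ne | e = go b₀
  where
  open +-*-Solver
  go : ∀ b → (if b then 0ℚ else 1ℚ) * ((headSign true (not b) * z) * t) + (if b then 0ℚ else 1ℚ) * ((headSign false (not b) * z) * t) ≡ 0ℚ
  go true  = solve 2 (λ z t → con 0ℚ :* ((con 1ℚ :* z) :* t) :+ con 0ℚ :* ((con 1ℚ :* z) :* t) := con 0ℚ) refl z t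
  go false = solve 2 (λ z t → con 1ℚ :* ((con (- 1ℚ) :* z) :* t) :+ con 1ℚ :* ((con 1ℚ :* z) :* t) := con 0ℚ) refl z t
transfer-step l₀ l₁ k₀ k₁ b₀ b₁ x true z t (inj₂ (k< , refl , refl)) | tri< p _ ≯
  rewrite entry-< false x true p | entry-< false x false p | <ᵇ-true k< | <ᵇ-false ≯ | <ᵇ-true p
  = solve 2 (λ z t → con 1ℚ :* ((con 1ℚ :* z) :* t) :+ con 1ℚ :* ((con 1ℚ :* z) :* t) := (con 1ℚ :* (con 1ℚ :* z)) :* (con (1ℚ + 1ℚ) :* t)) refl z t
  where open +-*-Solver
transfer-step l₀ .l₀ k₀ .k₀ b₀ b₁ x true z t (inj₁ (refl , e)) | tri≈ _ refl _
  rewrite entry-≡ {l₀} b₀ x true | entry-≡ {l₀} b₀ x false | <ᵇ-false (ℕ.n≮n k₀) | ≡ᵇ-true {k₀} refl | <ᵇ-false (ℕ.n≮n l₀) | ≡ᵇ-true {l₀} refl | e = go b₀ x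
  where
  open +-*-Solver
  go : ∀ b x → equalEntry b x true * ((headSign true (not b) * z) * t) + equalEntry b x false * ((headSign false (not b) * z) * t) ≡ (headSign x b * (-1^ b * z)) * (1ℚ * t)
  go true true = solve 2 (λ z t → con 1ℚ :* ((con 1ℚ :* z) :* t) :+ con 0ℚ :* ((con 1ℚ :* z) :* t) := (con (- 1ℚ) :* (con (- 1ℚ) :* z)) :* (con 1ℚ :* t)) refl z t
  go true false = solve 2 (λ z t → con 0ℚ :* ((con 1ℚ :* z) :* t) :+ con (- 1ℚ) :* ((con 1ℚ :* z) :* t) := (con 1ℚ :* (con (- 1ℚ) :* z)) :* (con 1ℚ :* t)) refl z t
  go false x = solve 2 (λ z t → con 0ℚ :* ((con (- 1ℚ) :* z) :* t) :+ con 1ℚ :* ((con 1ℚ :* z) :* t) := (con 1ℚ :* (con 1ℚ :* z)) :* (con 1ℚ :* t)) refl z t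
transfer-step l₀ .l₀ k₀ k₁ b₀ b₁ x true z t (inj₂ (k< , refl , refl)) | tri≈ _ refl _
  rewrite entry-≡ {l₀} false x true | entry-≡ {l₀} false x false | <ᵇ-true k< | <ᵇ-false (ℕ.n≮n l₀)
  = solve 2 (λ z t → con 0ℚ :* ((con 1ℚ :* z) :* t) :+ con 1ℚ :* ((con 1ℚ :* z) :* t) := (con 1ℚ :* (con 1ℚ :* z)) :* (con 1ℚ :* t)) refl z t
  where open +-*-Solver
transfer-step l₀ l₁ k₀ k₁ b₀ b₁ x true z t sh | tri> _ ne p
  rewrite entry-> {l₀} {l₁} b₀ x true p | entry-> {l₀} {l₁} b₀ x false p | <ᵇ-true p | ≡ᵇ-false ne = trans (cong₂ _+_ (ℚ.*-zeroˡ ((headSign true b₁ * z) * t)) (ℚ.*-zeroˡ ((headSign false b₁ * z) * t))) (lem (k₀ <ᵇ k₁) (k₀ ≡ᵇ k₁))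
  where
  lem : ∀ a b {r} → 0ℚ + 0ℚ ≡ (if (a ∧ false ∨ b ∧ false) ∧ true then r else 0ℚ)
  lem true true = refl
  lem true false = refl
  lem false true = refl
  lem false false = refl

compat : ∀ n → (Fin n → ℕ) → (Fin n → ℕ) → Bool
compat n k l = adj n (λ p q → cmp (k p) (l p) (k q) (l q))

suffixSum-formula : ∀ m (l k : Fin (suc m) → ℕ) b →
  (∀ p q → toℕ q ≡ suc (toℕ p) → Shape (k p) (b p) (k q) (b q)) → (∀ p → suc (toℕ p) ≡ suc m → b p ≡ false) →
  ∀ x → suffixSum m l b x ≡ (if compat (suc m) k l then (headSign x (b zero) * peakSign b) * letterWeight m l else 0ℚ)
suffixSum-formula zero l k b sh last x rewrite last zero refl = refl
suffixSum-formula (suc m) l k b sh last x = trans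
  (cong₂ (λ y z → entry (l zero) (b zero) x (l (suc zero)) true * y + entry (l zero) (b zero) x (l (suc zero)) false * z) (ih true) (ih false))
  (transfer-step (l zero) (l (suc zero)) (k zero) (k (suc zero)) (b zero) (b (suc zero)) x (compat (suc m) k′ l′) (peakSign b′) (letterWeight m l′) (sh zero (suc zero) refl))
  where
  l′ k′ : Fin (suc m) → ℕ
  l′ i = l (suc i)
  k′ i = k (suc i)
  b′ : Fin (suc m) → Bool
  b′ i = b (suc i)
  ih : ∀ x → suffixSum m l′ b′ x ≡ (if compat (suc m) k′ l′ then (headSign x (b (suc zero)) * peakSign b′) * letterWeight m l′ else 0ℚ)
  ih = suffixSum-formula m l′ k′ b′ (λ p q e → sh (suc p) (suc q) (cong suc e)) (λ p e → last (suc p) (cong suc e))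

-- Sign functions constant on the blocks of the kernel

constᵇ : ∀ {n} → Word n → (Fin n → Bool) → Bool
constᵇ w s = allPairs λ i j → not (w i ≡ᵇ w j) ∨ (s i ⇔ᵇ s j)

-- This is 2^(number of letters of w), in a form that visibly depends on the kernel only
-- and can be evaluated by the same recursion along the chain as η.
signings : ∀ {n} → Word n → ℚ
signings {n} w = ∑ (bools n) (λ s → 𝟙 (constᵇ w s))

constᵇ-elim : ∀ {n} {w : Word n} {s} → T (constᵇ w s) → ∀ i j → w i ≡ w j → s i ≡ s j
constᵇ-elim {w = w} {s} t i j e with ∨-elim {not (w i ≡ᵇ w j)} (allPairs-elim {p = λ i j → not (w i ≡ᵇ w j) ∨ (s i ⇔ᵇ s j)} t i j)
... | inj₁ ne = ⊥-elim (not-elim {w i ≡ᵇ w j} ne (ℕ.≡⇒≡ᵇ (w i) (w j) e))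
... | inj₂ p = ⇔ᵇ⇒≡ p

constᵇ-intro : ∀ {n} {w : Word n} {s} → (∀ i j → w i ≡ w j → s i ≡ s j) → T (constᵇ w s)
constᵇ-intro {w = w} {s} h = allPairs-intro aux
  where
  aux : ∀ i j → T (not (w i ≡ᵇ w j) ∨ (s i ⇔ᵇ s j))
  aux i j with w i ℕ.≟ w j
  ... | yes e = ∨-introʳ {not (w i ≡ᵇ w j)} (≡⇒⇔ᵇ (h i j e))
  ... | no ne rewrite ≡ᵇ-false ne = tt

constᵇ-cong : ∀ {n} (w : Word n) → Ext (constᵇ w)
constᵇ-cong w h = allPairs-cong (λ i j → cong₂ (λ a b → not (w i ≡ᵇ w j) ∨ (a ⇔ᵇ b)) (h i) (h j))

signings-permute : ∀ {n} (ρ : Permutation′ n) (w : Word n) → signings w ≡ signings (λ p → w (ρ ⟨$⟩ʳ p))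
signings-permute {n} ρ w = trans (∑-cong (bools n) (λ s → cong 𝟙 (bool-ext
    (λ t → constᵇ-intro {w = λ p → w (ρ ⟨$⟩ʳ p)} {s = λ p → s (ρ ⟨$⟩ʳ p)} (λ i j e → constᵇ-elim {w = w} {s} t (ρ ⟨$⟩ʳ i) (ρ ⟨$⟩ʳ j) e))
    (λ t → constᵇ-intro {s = s} (λ i j e → trans (sym (cong s (inverseʳ ρ))) (trans (constᵇ-elim {w = λ p → w (ρ ⟨$⟩ʳ p)} {λ p → s (ρ ⟨$⟩ʳ p)} t (ρ ⟨$⟩ˡ i) (ρ ⟨$⟩ˡ j)
      (trans (cong w (inverseʳ ρ)) (trans e (sym (cong w (inverseʳ ρ)))))) (cong s (inverseʳ ρ))))))))
  (∑-permute n ρ (λ s → 𝟙 (constᵇ (λ p → w (ρ ⟨$⟩ʳ p)) s)) (λ h → cong 𝟙 (constᵇ-cong (λ p → w (ρ ⟨$⟩ʳ p)) h)))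

stepS : ℕ → Bool → ℕ → Bool → Bool
stepS l s l′ s′ = (l <ᵇ l′) ∨ ((l ≡ᵇ l′) ∧ (s ⇔ᵇ s′))

stepS-elim : ∀ l s l′ s′ → T (stepS l s l′ s′) → l ℕ.< l′ ⊎ (l ≡ l′ × s ≡ s′)
stepS-elim l s l′ s′ t with ∨-elim {l <ᵇ l′} t
... | inj₁ p = inj₁ (ℕ.<ᵇ⇒< l l′ p)
... | inj₂ p with ∧-elim {l ≡ᵇ l′} p
...   | e , q = inj₂ (ℕ.≡ᵇ⇒≡ l l′ e , ⇔ᵇ⇒≡ q)

stepS-intro : ∀ l s l′ s′ → l ℕ.< l′ ⊎ (l ≡ l′ × s ≡ s′) → T (stepS l s l′ s′)
stepS-intro l s l′ s′ (inj₁ p) = ∨-introˡ (ℕ.<⇒<ᵇ p)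
stepS-intro l s l′ s′ (inj₂ (e , q)) = ∨-introʳ {l <ᵇ l′} (∧-intro (ℕ.≡⇒≡ᵇ l l′ e) (≡⇒⇔ᵇ q))

Monotone : ∀ {n} → (Fin n → ℕ) → Set
Monotone l = ∀ p q → toℕ p ℕ.< toℕ q → l p ℕ.≤ l q

-- For a weakly increasing word equal letters form intervals, so constancy of the signs on letters
-- can be tested between neighbours.
constᵇ-chain : ∀ {n} (l : Fin n → ℕ) s → Monotone l → constᵇ l s ≡ adj n (λ p q → stepS (l p) (s p) (l q) (s q))
constᵇ-chain {n} l s mono = bool-ext
  (λ t → adj-intro n (λ p q p<q → stepS-intro (l p) (s p) (l q) (s q) (split p q p<q t)))
  (λ t → constᵇ-intro (λ i j e → same t i j e))
  where
  r : Fin n → Fin n → Bool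
  r p q = stepS (l p) (s p) (l q) (s q)
  split : ∀ p q → toℕ p ℕ.< toℕ q → T (constᵇ l s) → l p ℕ.< l q ⊎ (l p ≡ l q × s p ≡ s q)
  split p q p<q t with l p ℕ.≟ l q
  ... | yes e = inj₂ (e , constᵇ-elim {w = l} {s} t p q e)
  ... | no ne = inj₁ (ℕ.≤∧≢⇒< (mono p q p<q) ne)
  tr : ∀ {i j k} → T (r i j) → T (r j k) → T (r i k)
  tr {i} {j} {k} a b = stepS-intro (l i) (s i) (l k) (s k) (go (stepS-elim (l i) (s i) (l j) (s j) a) (stepS-elim (l j) (s j) (l k) (s k) b))
    where
    go : l i ℕ.< l j ⊎ (l i ≡ l j × s i ≡ s j) → l j ℕ.< l k ⊎ (l j ≡ l k × s j ≡ s k) → l i ℕ.< l k ⊎ (l i ≡ l k × s i ≡ s k)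
    go (inj₁ a) (inj₁ b) = inj₁ (ℕ.<-trans a b)
    go (inj₁ a) (inj₂ (b , _)) = inj₁ (subst (l i ℕ.<_) b a)
    go (inj₂ (a , _)) (inj₁ b) = inj₁ (subst (ℕ._< l k) (sym a) b)
    go (inj₂ (a , a′)) (inj₂ (b , b′)) = inj₂ (trans a b , trans a′ b′)
  forward : T (adj n r) → ∀ i j → toℕ i ℕ.< toℕ j → l i ≡ l j → s i ≡ s j
  forward t i j i<j e with stepS-elim (l i) (s i) (l j) (s j) (adj-elim n {r} tr t i j i<j)
  ... | inj₁ p = ⊥-elim (ℕ.<⇒≢ p e)
  ... | inj₂ (_ , q) = q
  same : T (adj n r) → ∀ i j → l i ≡ l j → s i ≡ s j
  same t i j e with ℕ.<-cmp (toℕ i) (toℕ j)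
  ... | tri< p _ _ = forward t i j p e
  ... | tri≈ _ p _ = cong s (toℕ-injective p)
  ... | tri> _ _ p = sym (forward t j i p (sym e))

letterWeight-counts : ∀ m (l : Fin (suc m) → ℕ) → Monotone l → ∀ x →
  ∑ (bools m) (λ s → 𝟙 (adj (suc m) (λ p q → stepS (l p) ((x ∷ᶠ s) p) (l q) ((x ∷ᶠ s) q)))) ≡ letterWeight m l
letterWeight-counts zero l mono x = refl
letterWeight-counts (suc m) l mono x = trans (∑-bools-suc m _) (trans (cong₂ _+_ (part true) (part false)) (combine x))
  where
  l′ : Fin (suc m) → ℕ
  l′ i = l (suc i)
  part : ∀ y → ∑ (bools m) (λ s → 𝟙 (adj (suc (suc m)) (λ p q → stepS (l p) ((x ∷ᶠ (y ∷ᶠ s)) p) (l q) ((x ∷ᶠ (y ∷ᶠ s)) q))))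
         ≡ 𝟙 (stepS (l zero) x (l (suc zero)) y) * letterWeight m l′
  part y = trans (∑-cong (bools m) (λ s → 𝟙-∧ (stepS (l zero) x (l (suc zero)) y) _))
    (trans (∑-*ˡ (𝟙 (stepS (l zero) x (l (suc zero)) y)) (bools m) _) (cong (𝟙 (stepS (l zero) x (l (suc zero)) y) *_) (letterWeight-counts m l′ (λ p q p<q → mono (suc p) (suc q) (s≤s p<q)) y)))
  combine : ∀ x → 𝟙 (stepS (l zero) x (l (suc zero)) true) * letterWeight m l′ + 𝟙 (stepS (l zero) x (l (suc zero)) false) * letterWeight m l′ ≡ leaps (l zero) (l (suc zero)) * letterWeight m l′
  combine x with ℕ.m≤n⇒m<n∨m≡n (mono zero (suc zero) (s≤s z≤n))
  combine x | inj₁ p rewrite <ᵇ-true p = sym (ℚ.*-distribʳ-+ (letterWeight m l′) 1ℚ 1ℚ)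
  combine true  | inj₂ e rewrite sym e | <ᵇ-false (ℕ.n≮n (l zero)) | ≡ᵇ-true {l zero} refl = solve 1 (λ t → con 1ℚ :* t :+ con 0ℚ :* t := con 1ℚ :* t) refl (letterWeight m l′)
    where open +-*-Solver
  combine false | inj₂ e rewrite sym e | <ᵇ-false (ℕ.n≮n (l zero)) | ≡ᵇ-true {l zero} refl = solve 1 (λ t → con 0ℚ :* t :+ con 1ℚ :* t := con 1ℚ :* t) refl (letterWeight m l′)
    where open +-*-Solver

-- The sign of the first letter is free as well, which doubles the count of signs for the later
-- letters.
signings-mono : ∀ m (l : Fin (suc m) → ℕ) → Monotone l → signings l ≡ letterWeight m l + letterWeight m l
signings-mono m l mono = trans (∑-cong (bools (suc m)) (λ s → cong 𝟙 (constᵇ-chain l s mono)))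
  (trans (∑-bools-suc m _) (cong₂ _+_ (letterWeight-counts m l mono true) (letterWeight-counts m l mono false)))

-- The coefficients of η

monoᵇ : ∀ {n ℓ} → (Fin n → Fin ℓ) → Word n → Bool
monoᵇ c w = allPairs λ i j → (c j <ᶠ c i) ∨ cmp (toℕ (c i)) (w i) (toℕ (c j)) (w j)

OddBlocks : ∀ {n ℓ} → (Fin n → Fin ℓ) → Set
OddBlocks {n} c = ∀ x → isOdd (count (λ a → c a ==ᶠ c x) (allFin n)) ≡ true

cmp-elim : ∀ k l k′ l′ → T (cmp k l k′ l′) → (k ℕ.< k′ × l ℕ.≤ l′) ⊎ (k ≡ k′ × l ≡ l′)
cmp-elim k l k′ l′ t with ∨-elim {(k <ᵇ k′) ∧ not (l′ <ᵇ l)} t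
... | inj₁ p with ∧-elim {k <ᵇ k′} p
...   | a , b = inj₁ (ℕ.<ᵇ⇒< k k′ a , ℕ.≮⇒≥ (λ q → not-elim {l′ <ᵇ l} b (ℕ.<⇒<ᵇ q)))
cmp-elim k l k′ l′ t | inj₂ p with ∧-elim {k ≡ᵇ k′} p
...   | a , b = inj₂ (ℕ.≡ᵇ⇒≡ k k′ a , ℕ.≡ᵇ⇒≡ l l′ b)

cmp-intro : ∀ k l k′ l′ → (k ℕ.< k′ × l ℕ.≤ l′) ⊎ (k ≡ k′ × l ≡ l′) → T (cmp k l k′ l′)
cmp-intro k l k′ l′ (inj₁ (a , b)) = ∨-introˡ (∧-intro (ℕ.<⇒<ᵇ a) (not-intro {l′ <ᵇ l} (λ q → ℕ.<⇒≱ (ℕ.<ᵇ⇒< l′ l q) b)))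
cmp-intro k l k′ l′ (inj₂ (a , b)) = ∨-introʳ {(k <ᵇ k′) ∧ not (l′ <ᵇ l)} (∧-intro (ℕ.≡⇒≡ᵇ k k′ a) (ℕ.≡⇒≡ᵇ l l′ b))

cmp-trans : ∀ k l k′ l′ k″ l″ → T (cmp k l k′ l′) → T (cmp k′ l′ k″ l″) → T (cmp k l k″ l″)
cmp-trans k l k′ l′ k″ l″ s t = cmp-intro k l k″ l″ (go (cmp-elim k l k′ l′ s) (cmp-elim k′ l′ k″ l″ t))
  where
  go : (k ℕ.< k′ × l ℕ.≤ l′) ⊎ (k ≡ k′ × l ≡ l′) → (k′ ℕ.< k″ × l′ ℕ.≤ l″) ⊎ (k′ ≡ k″ × l′ ≡ l″) → (k ℕ.< k″ × l ℕ.≤ l″) ⊎ (k ≡ k″ × l ≡ l″)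
  go (inj₁ (a , b)) (inj₁ (a′ , b′)) = inj₁ (ℕ.<-trans a a′ , ℕ.≤-trans b b′)
  go (inj₁ p) (inj₂ (refl , refl)) = inj₁ p
  go (inj₂ (refl , refl)) (inj₁ p) = inj₁ p
  go (inj₂ (refl , refl)) (inj₂ p) = inj₂ p

cmp-≤ : ∀ k l k′ l′ → T (cmp k l k′ l′) → l ℕ.≤ l′
cmp-≤ k l k′ l′ t with cmp-elim k l k′ l′ t
... | inj₁ (_ , p) = p
... | inj₂ (_ , refl) = ℕ.≤-refl

compat-elim : ∀ {n} (k l : Fin n → ℕ) → T (compat n k l) → ∀ p q → toℕ p ℕ.< toℕ q → T (cmp (k p) (l p) (k q) (l q))
compat-elim {n} k l = adj-elim n {λ p q → cmp (k p) (l p) (k q) (l q)} (λ {i} {j} {m} → cmp-trans (k i) (l i) (k j) (l j) (k m) (l m))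

monoᵇ-elim : ∀ {n ℓ} (c : Fin n → Fin ℓ) w → T (monoᵇ c w) → ∀ i j → toℕ (c i) ℕ.≤ toℕ (c j) →
  (toℕ (c i) ℕ.< toℕ (c j) × w i ℕ.≤ w j) ⊎ (toℕ (c i) ≡ toℕ (c j) × w i ≡ w j)
monoᵇ-elim c w t i j le with ∨-elim {c j <ᶠ c i} (allPairs-elim {p = λ i j → (c j <ᶠ c i) ∨ cmp (toℕ (c i)) (w i) (toℕ (c j)) (w j)} t i j)
... | inj₁ p = ⊥-elim (ℕ.<⇒≱ (ℕ.<ᵇ⇒< (toℕ (c j)) (toℕ (c i)) p) le)
... | inj₂ q = cmp-elim (toℕ (c i)) (w i) (toℕ (c j)) (w j) q

monoᵇ-intro : ∀ {n ℓ} (c : Fin n → Fin ℓ) w →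
  (∀ i j → toℕ (c i) ℕ.≤ toℕ (c j) → (toℕ (c i) ℕ.< toℕ (c j) × w i ℕ.≤ w j) ⊎ (toℕ (c i) ≡ toℕ (c j) × w i ≡ w j)) → T (monoᵇ c w)
monoᵇ-intro c w h = allPairs-intro aux
  where
  aux : ∀ i j → T ((c j <ᶠ c i) ∨ cmp (toℕ (c i)) (w i) (toℕ (c j)) (w j))
  aux i j with toℕ (c i) ℕ.≤? toℕ (c j)
  ... | yes le = ∨-introʳ {c j <ᶠ c i} (cmp-intro (toℕ (c i)) (w i) (toℕ (c j)) (w j) (h i j le))
  ... | no ≰ = ∨-introˡ (ℕ.<⇒<ᵇ (ℕ.≰⇒> ≰))

module Eta {n ℓ : ℕ} (c : Fin n → Fin ℓ) where

  open Chain c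

  monoᵇ-chain : ∀ w → monoᵇ c w ≡ compat n (λ p → key (at p)) (λ p → w (at p))
  monoᵇ-chain w = bool-ext to from
    where
    k l : Fin n → ℕ
    k p = key (at p)
    l p = w (at p)
    to : T (monoᵇ c w) → T (compat n k l)
    to t = adj-intro n (λ p q p<q → cmp-intro (k p) (l p) (k q) (l q) (monoᵇ-elim c w t (at p) (at q)
      (rank⇒key {at p} {at q} (subst₂ ℕ._<_ (sym (rank-at p)) (sym (rank-at q)) p<q))))
    from : T (compat n k l) → T (monoᵇ c w)
    from t = monoᵇ-intro c w (λ i j le → subst₂ P (inverseˡ ρ) (inverseˡ ρ)
        (pair (ρ ⟨$⟩ʳ i) (ρ ⟨$⟩ʳ j)) le)
      where
      P : Fin n → Fin n → Set
      P i j = key i ℕ.≤ key j → (key i ℕ.< key j × w i ℕ.≤ w j) ⊎ (key i ≡ key j × w i ≡ w j)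
      pair : ∀ p q → P (at p) (at q)
      pair p q le with ℕ.<-cmp (toℕ p) (toℕ q)
      ... | tri< a _ _ = cmp-elim (k p) (l p) (k q) (l q) (compat-elim k l t p q a)
      ... | tri≈ _ a _ rewrite toℕ-injective a = inj₂ (refl , refl)
      ... | tri> _ _ a with cmp-elim (k q) (l q) (k p) (l p) (compat-elim k l t q p a)
      ...   | inj₁ (b , _) = ⊥-elim (ℕ.<⇒≱ b le)
      ...   | inj₂ (b , e) = inj₂ (sym b , sym e)

  -- The product of coefficients, the sum over `C` and the sum over signs are all moved from word
  -- positions to chain positions by the same permutation.
  η-chain : ∀ w → η (ℓ , c) w ≡ ∑ (bools n) (λ C → ∑ (bools n) (λ s →
    weight (λ p → inB c (at p)) C * 𝟙 (adj n (stepR (λ p → w (at p)) C s))))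
  η-chain w = begin
    η (ℓ , c) w
      ≡⟨ ∑-filter (λ C → subᵇ C (inB c)) (bools n) _ ⟩
    ∑ (bools n) (λ C → if subᵇ C (inB c) then signℚ (count (inB c) (allFin n) ℕ.∸ count C (allFin n)) * Kpk c C w else 0ℚ)
      ≡⟨ ∑-cong (bools n) (λ C → trans (if-* (subᵇ C (inB c)) (signℚ (count (inB c) (allFin n) ℕ.∸ count C (allFin n))) (Kpk c C w))
           (trans (cong₂ _*_ (trans (weight-signed C (inB c)) (∏-permute (λ p → coeff (inB c p) (C p)) (flip ρ))) (inner C))
                  (sym (∑-*ˡ (weight (λ p → inB c (at p)) (λ p → C (at p))) (bools n) _)))) ⟩
    ∑ (bools n) (λ C → G (λ p → C (at p)))
      ≡⟨ ∑-permute n (flip ρ) G (λ {C} {C′} h → ∑-cong (bools n) (λ s → cong₂ (λ x b → x * 𝟙 b) (weight-cong (λ p → inB c (at p)) h) (stepR-cong l {s = s} {s} h (λ _ → refl)))) ⟩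
    ∑ (bools n) G ∎
    where
    open ≡-Reasoning
    l : Fin n → ℕ
    l p = w (at p)
    G : (Fin n → Bool) → ℚ
    G C = ∑ (bools n) (λ s → weight (λ p → inB c (at p)) C * 𝟙 (adj n (stepR l C s)))
    if-* : ∀ a x y → (if a then x * y else 0ℚ) ≡ (if a then x else 0ℚ) * y
    if-* true x y = refl
    if-* false x y = sym (ℚ.*-zeroˡ y)
    inner : ∀ C → Kpk c C w ≡ ∑ (bools n) (λ s → 𝟙 (adj n (stepR l (λ p → C (at p)) s)))
    inner C = trans (Kcore-∑ _<ᵇ_ (γpk c C) (rank c) w) (trans (∑-cong (bools n) (λ s → cong 𝟙 (Labels.okK-chain C w s)))
      (∑-permute n (flip ρ) (λ s → 𝟙 (adj n (stepR l (λ p → C (at p)) s))) (λ h → cong 𝟙 (stepR-cong l {C = λ p → C (at p)} {λ p → C (at p)} (λ _ → refl) h))))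

  module _ (odd : OddBlocks c) where

    complete-block : ∀ {x} → suc (offset c x) ≡ size x → inB c x ≡ false
    complete-block {x} e = trans (sym (not-involutive (isOdd (offset c x)))) (cong not (trans (sym (isOdd-suc (offset c x))) (trans (cong isOdd e) (odd x))))

    shape : ∀ p q → toℕ q ≡ suc (toℕ p) → Shape (key (at p)) (inB c (at p)) (key (at q)) (inB c (at q))
    shape p q e = shape-of (trans (rank-at q) (trans e (cong suc (sym (rank-at p)))))
      where
      shape-of : ∀ {x y} → rank c y ≡ suc (rank c x) → Shape (key x) (inB c x) (key y) (inB c y)
      shape-of {x} {y} r = [ (λ k< → inj₂ (k< , complete-block (proj₁ (next-block {x} {y} r k<)) , cong isOdd (proj₂ (next-block {x} {y} r k<))))
                           , (λ k≡ → inj₁ (k≡ , trans (cong isOdd (same-block {x} {y} r k≡)) (isOdd-suc (offset c x))))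
                           ]′ (ℕ.m≤n⇒m<n∨m≡n (rank⇒key {x} {y} (ℕ.≤-reflexive (sym r))))

    last-shape : ∀ p → suc (toℕ p) ≡ n → inB c (at p) ≡ false
    last-shape p e = complete-block (last-in-block {at p} (trans (cong suc (rank-at p)) e))

    first-shape : ∀ p → toℕ p ≡ 0 → inB c (at p) ≡ false
    first-shape p e = cong isOdd (first-in-block {at p} (trans (rank-at p) e))

η-coefficient : ∀ {n ℓ} (c : Fin n → Fin ℓ) → OddBlocks c → ∀ w →
  η (ℓ , c) w ≡ (if monoᵇ c w then signℚ (count (inB c) (allFin n)) * signings w else 0ℚ)
η-coefficient {zero} c odd w = Eta.η-chain c w
η-coefficient {suc m} {ℓ} c odd w = begin
  η (ℓ , c) w
    ≡⟨ η-chain w ⟩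
  ∑ (bools (suc m)) (λ C → ∑ (bools (suc m)) (λ s → weight b C * 𝟙 (adj (suc m) (stepR l C s))))
    ≡⟨ trans (∑-cong (bools (suc m)) (λ C → ∑-bools-suc m _)) (∑-+ (bools (suc m)) _ _) ⟩
  ∑ (bools (suc m)) (λ C → ∑ (bools m) (λ s → weight b C * 𝟙 (adj (suc m) (stepR l C (true ∷ᶠ s)))))
    + ∑ (bools (suc m)) (λ C → ∑ (bools m) (λ s → weight b C * 𝟙 (adj (suc m) (stepR l C (false ∷ᶠ s)))))
    ≡⟨ cong₂ _+_ (trans (transfer m l b true) (formula true)) (trans (transfer m l b false) (formula false)) ⟩
  (if compat (suc m) k l then (headSign true (b zero) * peakSign b) * letterWeight m l else 0ℚ) + (if compat (suc m) k l then (headSign false (b zero) * peakSign b) * letterWeight m l else 0ℚ)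
    -- The first chain position has offset 0 and is no peak, so both values of its sign contribute
    -- equally; their sum turns `letterWeight` into `signings`.
    ≡⟨ cong (λ z → (if compat (suc m) k l then (headSign true z * peakSign b) * letterWeight m l else 0ℚ) + (if compat (suc m) k l then (headSign false z * peakSign b) * letterWeight m l else 0ℚ)) (first-shape odd zero refl) ⟩
  (if compat (suc m) k l then (1ℚ * peakSign b) * letterWeight m l else 0ℚ) + (if compat (suc m) k l then (1ℚ * peakSign b) * letterWeight m l else 0ℚ)
    ≡⟨ finish (compat (suc m) k l) refl ⟩
  (if compat (suc m) k l then signℚ (count (inB c) (allFin (suc m))) * signings w else 0ℚ)
    ≡⟨ cong (λ z → if z then signℚ (count (inB c) (allFin (suc m))) * signings w else 0ℚ) (sym (monoᵇ-chain w)) ⟩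
  (if monoᵇ c w then signℚ (count (inB c) (allFin (suc m))) * signings w else 0ℚ) ∎
  where
  open ≡-Reasoning
  open Chain c
  open Eta c
  l k : Fin (suc m) → ℕ
  l p = w (at p)
  k p = key (at p)
  b : Fin (suc m) → Bool
  b p = inB c (at p)
  formula : ∀ x → suffixSum m l b x ≡ (if compat (suc m) k l then (headSign x (b zero) * peakSign b) * letterWeight m l else 0ℚ)
  formula = suffixSum-formula m l k b (shape odd) (last-shape odd)
  peakSign-b : peakSign b ≡ signℚ (count (inB c) (allFin (suc m)))
  peakSign-b = trans (sym (∏-permute (λ p → -1^ (inB c p)) (flip ρ))) (∏-sign (inB c))
  double : ∀ z t → (1ℚ * z) * t + (1ℚ * z) * t ≡ z * (t + t)
  double = solve 2 (λ z t → (con 1ℚ :* z) :* t :+ (con 1ℚ :* z) :* t := z :* (t :+ t)) refl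
    where open +-*-Solver
  finish : ∀ a → compat (suc m) k l ≡ a → (if a then (1ℚ * peakSign b) * letterWeight m l else 0ℚ) + (if a then (1ℚ * peakSign b) * letterWeight m l else 0ℚ)
    ≡ (if a then signℚ (count (inB c) (allFin (suc m))) * signings w else 0ℚ)
  finish false e = refl
  finish true e = trans (double (peakSign b) (letterWeight m l)) (cong₂ _*_ peakSign-b
    (sym (trans (signings-permute (flip ρ) w) (signings-mono m l (λ p q p<q → cmp-≤ (k p) (l p) (k q) (l q) (compat-elim k l (≡⇒T e) p q p<q))))))

-- Set compositions and words

-- Compositions with different numbers of blocks have different types; they are compared through the
-- order that they induce on positions, which determines the block indices of a surjection.
SameOrder : ∀ {n ℓ ℓ′} → (Fin n → Fin ℓ) → (Fin n → Fin ℓ′) → Set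
SameOrder c d = ∀ i j → (c i <ᶠ c j) ≡ (d i <ᶠ d j)

record SameKer {n} (w w′ : Word n) : Set where
  constructor sameKer
  field
    ≡ᵇ-≡ : ∀ i j → (w i ≡ᵇ w j) ≡ (w′ i ≡ᵇ w′ j)

open SameKer

SameKer-sym : ∀ {n} {w w′ : Word n} → SameKer w w′ → SameKer w′ w
SameKer-sym h = sameKer (λ i j → sym (≡ᵇ-≡ h i j))

SameKer-trans : ∀ {n} {w w′ w″ : Word n} → SameKer w w′ → SameKer w′ w″ → SameKer w w″
SameKer-trans h h′ = sameKer (λ i j → trans (≡ᵇ-≡ h i j) (≡ᵇ-≡ h′ i j))

SameKer-elim : ∀ {n} {w w′ : Word n} → SameKer w w′ → ∀ {i j} → w i ≡ w j → w′ i ≡ w′ j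
SameKer-elim {w = w} {w′} h {i} {j} e = ℕ.≡ᵇ⇒≡ (w′ i) (w′ j) (subst T (≡ᵇ-≡ h i j) (ℕ.≡⇒≡ᵇ (w i) (w j) e))

SameKer-intro : ∀ {n} {w w′ : Word n} → (∀ i j → w i ≡ w j → w′ i ≡ w′ j) → (∀ i j → w′ i ≡ w′ j → w i ≡ w j) → SameKer w w′
SameKer-intro {w = w} {w′} f g = sameKer λ i j → bool-ext
  (λ t → ℕ.≡⇒≡ᵇ (w′ i) (w′ j) (f i j (ℕ.≡ᵇ⇒≡ (w i) (w j) t)))
  (λ t → ℕ.≡⇒≡ᵇ (w i) (w j) (g i j (ℕ.≡ᵇ⇒≡ (w′ i) (w′ j) t)))

module _ {n : ℕ} {w w′ : Word n} (h : ∀ i j → (w i <ᵇ w j) ≡ (w′ i <ᵇ w′ j)) where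

  order-≤ : ∀ i j → w i ℕ.≤ w j → w′ i ℕ.≤ w′ j
  order-≤ i j p = ℕ.≮⇒≥ (λ q → ℕ.<⇒≱ (ℕ.<ᵇ⇒< (w j) (w i) (subst T (sym (h j i)) (ℕ.<⇒<ᵇ q))) p)

  order-≡ : ∀ i j → w i ≡ w j → w′ i ≡ w′ j
  order-≡ i j e = ℕ.≤-antisym (order-≤ i j (ℕ.≤-reflexive e)) (order-≤ j i (ℕ.≤-reflexive (sym e)))

order⇒SameKer : ∀ {n} {w w′ : Word n} → (∀ i j → (w i <ᵇ w j) ≡ (w′ i <ᵇ w′ j)) → SameKer w w′
order⇒SameKer {w = w} {w′} h = SameKer-intro (order-≡ {w = w} {w′} h) (order-≡ {w = w′} {w} (λ i j → sym (h i j)))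

bounded : ∀ {n} (w : Word n) → ∃ λ N → ∀ i → w i ℕ.< N
bounded {zero} w = 0 , λ ()
bounded {suc n} w with bounded (w ∘ suc)
... | N , h = suc (w zero) ℕ.+ N , λ { zero → s≤s (ℕ.m≤m+n (w zero) N) ; (suc i) → ℕ.≤-trans (h i) (ℕ.m≤n+m N (suc (w zero))) }

lookup-mono : ∀ {xs : List ℕ} → AllPairs ℕ._<_ xs → ∀ i j → toℕ i ℕ.< toℕ j → lookup xs i ℕ.< lookup xs j
lookup-mono (d ∷ ds) zero (suc j) p = All.lookup d (∈-lookup j)
lookup-mono (d ∷ ds) (suc i) (suc j) (s≤s p) = lookup-mono ds i j p

word : ∀ {n} → SetComp n → Word n
word φ i = toℕ (SetComp.blk φ i)

-- The block index of a position is the index of its letter in the increasing list of the letters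
-- that occur.
pack : ∀ {n} (w : Word n) → ∃ λ (φ : SetComp n) → ∀ i j → (w i <ᵇ w j) ≡ (word φ i <ᵇ word φ j)
pack {n} w = record { ℓ = length letters ; blk = blk ; surj = surj } , λ i j → bool-ext (to i j) (from i j)
  where
  N = proj₁ (bounded w)
  occurs : ℕ → Bool
  occurs k = any (λ i → w i ≡ᵇ k) (allFin n)
  letters = filterᵇ occurs (upTo N)
  increasing : AllPairs ℕ._<_ letters
  increasing = AllPairs.filter⁺ (T? ∘ occurs) (AllPairs.applyUpTo⁺₁ id N (λ p _ → p))
  mem : ∀ i → w i ∈ letters
  mem i = ∈-filter⁺ (T? ∘ occurs) (∈-upTo⁺ (proj₂ (bounded w) i)) (any-intro {p = λ j → w j ≡ᵇ w i} i (ℕ.≡⇒≡ᵇ (w i) (w i) refl))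
  blk : Fin n → Fin (length letters)
  blk i = Any.index (mem i)
  letter : ∀ i → w i ≡ lookup letters (blk i)
  letter i = Any.lookup-index (mem i)
  from : ∀ i j → T (toℕ (blk i) <ᵇ toℕ (blk j)) → T (w i <ᵇ w j)
  from i j t = ℕ.<⇒<ᵇ (subst₂ ℕ._<_ (sym (letter i)) (sym (letter j)) (lookup-mono increasing (blk i) (blk j) (ℕ.<ᵇ⇒< _ _ t)))
  lookup-injective : ∀ a b → lookup letters a ≡ lookup letters b → a ≡ b
  lookup-injective a b e with ℕ.<-cmp (toℕ a) (toℕ b)
  ... | tri< p _ _ = ⊥-elim (ℕ.<⇒≢ (lookup-mono increasing a b p) e)
  ... | tri≈ _ p _ = toℕ-injective p
  ... | tri> _ _ p = ⊥-elim (ℕ.<⇒≢ (lookup-mono increasing b a p) (sym e))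
  to : ∀ i j → T (w i <ᵇ w j) → T (toℕ (blk i) <ᵇ toℕ (blk j))
  to i j t with ℕ.<-cmp (toℕ (blk i)) (toℕ (blk j))
  ... | tri< p _ _ = ℕ.<⇒<ᵇ p
  ... | tri≈ _ p _ = ⊥-elim (ℕ.<⇒≢ (ℕ.<ᵇ⇒< (w i) (w j) t) (trans (letter i) (trans (cong (lookup letters) (toℕ-injective p)) (sym (letter j)))))
  ... | tri> _ _ p = ⊥-elim (ℕ.<-asym (ℕ.<ᵇ⇒< (w i) (w j) t) (ℕ.<ᵇ⇒< (w j) (w i) (from j i (ℕ.<⇒<ᵇ p))))
  surj : ∀ b → ∃ λ a → blk a ≡ b
  surj b with any-elim {p = λ i → w i ≡ᵇ lookup letters b} (proj₂ (∈-filter⁻ (T? ∘ occurs) {xs = upTo N} (∈-lookup b)))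
  ... | i , t = i , lookup-injective (blk i) b (trans (sym (letter i)) (ℕ.≡ᵇ⇒≡ (w i) (lookup letters b) t))

Surj : ∀ {n ℓ} → (Fin n → Fin ℓ) → Set
Surj c = ∀ b → ∃ λ a → c a ≡ b

isSurj-intro : ∀ {n ℓ} (c : Fin n → Fin ℓ) → Surj c → T (isSurj c)
isSurj-intro {n} c s = all-intro {p = λ b → any (λ a → c a ==ᶠ b) (allFin n)}
  (λ b → any-intro {p = λ a → c a ==ᶠ b} (proj₁ (s b)) (ℕ.≡⇒≡ᵇ _ _ (cong toℕ (proj₂ (s b)))))

isSurj-elim : ∀ {n ℓ} (c : Fin n → Fin ℓ) → T (isSurj c) → Surj c
isSurj-elim {n} c t b with any-elim {p = λ a → c a ==ᶠ b} (all-elim {p = λ b → any (λ a → c a ==ᶠ b) (allFin n)} t b)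
... | a , e = a , toℕ-injective (ℕ.≡ᵇ⇒≡ _ _ e)

-- Induction on the block index: surjectivity supplies an element of the preceding block, which `d`
-- must also place strictly before `i`.
SameOrder-≤ : ∀ {n ℓ ℓ′} (c : Fin n → Fin ℓ) (d : Fin n → Fin ℓ′) → Surj c → SameOrder c d → ∀ b i → toℕ (c i) ≡ b → b ℕ.≤ toℕ (d i)
SameOrder-≤ c d s h zero i e = z≤n
SameOrder-≤ {ℓ = ℓ} c d s h (suc b) i e = ℕ.≤-<-trans (SameOrder-≤ c d s h b a a≡) (ℕ.<ᵇ⇒< _ _ (subst T (h a i) (ℕ.<⇒<ᵇ a<i)))
  where
  b<ℓ : b ℕ.< ℓ
  b<ℓ = ℕ.<-trans (ℕ.n<1+n b) (subst (ℕ._< ℓ) e (toℕ<n (c i)))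
  a = proj₁ (s (fromℕ< b<ℓ))
  a≡ : toℕ (c a) ≡ b
  a≡ = trans (cong toℕ (proj₂ (s (fromℕ< b<ℓ)))) (toℕ-fromℕ< b<ℓ)
  a<i : toℕ (c a) ℕ.< toℕ (c i)
  a<i = subst₂ ℕ._<_ (sym a≡) (sym e) (ℕ.n<1+n b)

SameOrder⇒≡ : ∀ {n ℓ ℓ′} (c : Fin n → Fin ℓ) (d : Fin n → Fin ℓ′) → Surj c → Surj d → SameOrder c d → ∀ i → toℕ (c i) ≡ toℕ (d i)
SameOrder⇒≡ c d s s′ h i = ℕ.≤-antisym (SameOrder-≤ c d s h _ i refl) (SameOrder-≤ d c s′ (λ i j → sym (h i j)) _ i refl)

Surj-≮ : ∀ {n ℓ ℓ′} (c : Fin n → Fin ℓ) (d : Fin n → Fin ℓ′) → Surj d → (∀ i → toℕ (c i) ≡ toℕ (d i)) → ¬ (ℓ ℕ.< ℓ′)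
Surj-≮ c d s h p with s (fromℕ< p)
... | a , e = ℕ.<⇒≢ (toℕ<n (c a)) (trans (h a) (trans (cong toℕ e) (toℕ-fromℕ< p)))

surjections : ∀ n ℓ → List (Fin n → Fin ℓ)
surjections n ℓ = filterᵇ isSurj (allFuns n (allFin ℓ))

-- This makes counting over `setComps` faithful: each ordering of blocks is counted at most once.
setComps-distinct : ∀ n → AllPairs (λ φ ψ → ¬ SameOrder (proj₂ φ) (proj₂ ψ)) (setComps n)
setComps-distinct n = concatMap-AllPairs (λ ℓ → map (λ c → ℓ , c) (surjections n ℓ)) (Unique.upTo⁺ (suc n)) within across
  where
  within : ∀ ℓ → AllPairs (λ φ ψ → ¬ SameOrder (proj₂ φ) (proj₂ ψ)) (map (λ c → ℓ , c) (surjections n ℓ))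
  within ℓ = AllPairs.map⁺ (AllPairs.map
    (λ {c} {d} (s , s′ , ne) h → ne (λ i → toℕ-injective (SameOrder⇒≡ c d (isSurj-elim c s) (isSurj-elim d s′) h i)))
    (AllPairs-with (All.all-filter (T? ∘ isSurj) (allFuns n (allFin ℓ)))
                   (AllPairs.filter⁺ (T? ∘ isSurj) (allFuns-unique n (Unique.allFin⁺ ℓ)))))
  sj : ∀ {ℓ} (c : Fin n → Fin ℓ) → c ∈ surjections n ℓ → Surj c
  sj c c∈ = isSurj-elim c (proj₂ (∈-filter⁻ (T? ∘ isSurj) {xs = allFuns n (allFin _)} c∈))
  differ : ∀ {ℓ ℓ′} → ℓ ≢ ℓ′ → ∀ {c d} → c ∈ surjections n ℓ → d ∈ surjections n ℓ′ → ¬ SameOrder c d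
  differ {ℓ} {ℓ′} ne {c} {d} c∈ d∈ h with ℕ.<-cmp ℓ ℓ′
  ... | tri< p _ _ = Surj-≮ c d (sj d d∈) (SameOrder⇒≡ c d (sj c c∈) (sj d d∈) h) p
  ... | tri≈ _ p _ = ne p
  ... | tri> _ _ p = Surj-≮ d c (sj c c∈) (SameOrder⇒≡ d c (sj d d∈) (sj c c∈) (λ i j → sym (h i j))) p
  across : ∀ {ℓ ℓ′ φ ψ} → ℓ ≢ ℓ′ → φ ∈ map (λ c → ℓ , c) (surjections n ℓ) → ψ ∈ map (λ c → ℓ′ , c) (surjections n ℓ′) → ¬ SameOrder (proj₂ φ) (proj₂ ψ)
  across {ℓ} {ℓ′} ne φ∈ ψ∈ with ∈-map⁻ (λ c → ℓ , c) φ∈ | ∈-map⁻ (λ c → ℓ′ , c) ψ∈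
  ... | c , c∈ , refl | d , d∈ , refl = differ ne c∈ d∈

length-≤ : ∀ {n} (φ : SetComp n) → SetComp.ℓ φ ℕ.≤ n
length-≤ φ = injective⇒≤ {f = λ b → proj₁ (surj b)} (λ {b} {b′} e → trans (sym (proj₂ (surj b))) (trans (cong blk e) (proj₂ (surj b′))))
  where open SetComp φ

setComps-complete : ∀ {n} (φ : SetComp n) → ∃ λ ψ → ψ ∈ setComps n × (∀ i → toℕ (proj₂ ψ i) ≡ word φ i)
setComps-complete {n} φ with allFuns-complete n (SetComp.blk φ) (λ i → ∈-allFin (SetComp.blk φ i))
... | c , c∈ , e = (SetComp.ℓ φ , c)
    , ∈-concatMap⁺ (λ ℓ → map (λ c → ℓ , c) (surjections n ℓ)) (lose (∈-upTo⁺ (s≤s (length-≤ φ)))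
        (∈-map⁺ (λ c → SetComp.ℓ φ , c) (∈-filter⁺ (T? ∘ isSurj) c∈ (isSurj-intro c (λ b → proj₁ (SetComp.surj φ b) , trans (e _) (proj₂ (SetComp.surj φ b)))))))
    , λ i → cong toℕ (e i)

setComps-order : ∀ {n} (w : Word n) → ∃ λ ψ → ψ ∈ setComps n × (∀ i j → (w i <ᵇ w j) ≡ (proj₂ ψ i <ᶠ proj₂ ψ j))
setComps-order w = let φ , h = pack w ; ψ , ψ∈ , e = setComps-complete φ in
  ψ , ψ∈ , λ i j → trans (h i j) (sym (cong₂ _<ᵇ_ (e i) (e j)))

sameBlocks-elim : ∀ {n} {φ ψ : RawComp n} → T (sameBlocks φ ψ) → SameKer (toℕ ∘ proj₂ φ) (toℕ ∘ proj₂ ψ)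
sameBlocks-elim {φ = _ , c} {_ , d} t = sameKer λ i j → ⇔ᵇ⇒≡ (allPairs-elim {p = λ j k → (c j ==ᶠ c k) ⇔ᵇ (d j ==ᶠ d k)} t i j)

sameBlocks-intro : ∀ {n} {φ ψ : RawComp n} → SameKer (toℕ ∘ proj₂ φ) (toℕ ∘ proj₂ ψ) → T (sameBlocks φ ψ)
sameBlocks-intro {φ = _ , c} {_ , d} h = allPairs-intro {p = λ j k → (c j ==ᶠ c k) ⇔ᵇ (d j ==ᶠ d k)} (λ i j → ≡⇒⇔ᵇ (≡ᵇ-≡ h i j))

-- The coefficients of m

Mᵇ : ∀ {n} → RawComp n → Word n → Bool
Mᵇ (_ , c) w = allPairs (λ j k → ((w j ≡ᵇ w k) ⇔ᵇ (c j ==ᶠ c k)) ∧ ((w j <ᵇ w k) ⇔ᵇ (c j <ᶠ c k)))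

Mᵇ-elim : ∀ {n} (φ : RawComp n) w → T (Mᵇ φ w) → ∀ i j → (w i <ᵇ w j) ≡ (proj₂ φ i <ᶠ proj₂ φ j)
Mᵇ-elim (_ , c) w t i j = ⇔ᵇ⇒≡ (proj₂ (∧-elim {(w i ≡ᵇ w j) ⇔ᵇ (c i ==ᶠ c j)} (allPairs-elim {p = λ j k → ((w j ≡ᵇ w k) ⇔ᵇ (c j ==ᶠ c k)) ∧ ((w j <ᵇ w k) ⇔ᵇ (c j <ᶠ c k))} t i j)))

Mᵇ-intro : ∀ {n} (φ : RawComp n) w → (∀ i j → (w i <ᵇ w j) ≡ (proj₂ φ i <ᶠ proj₂ φ j)) → T (Mᵇ φ w)
Mᵇ-intro (_ , c) w h = allPairs-intro {p = λ j k → ((w j ≡ᵇ w k) ⇔ᵇ (c j ==ᶠ c k)) ∧ ((w j <ᵇ w k) ⇔ᵇ (c j <ᶠ c k))}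
  (λ i j → ∧-intro (≡⇒⇔ᵇ (≡ᵇ-≡ (order⇒SameKer {w = w} {λ i → toℕ (c i)} h) i j)) (≡⇒⇔ᵇ (h i j)))

count-∈ : {A : Set} (p : A → Bool) {x : A} (xs : List A) → x ∈ xs → T (p x) → 1 ℕ.≤ count p xs
count-∈ p xs x∈ px = ℕ.≤-<-trans z≤n (count-< {p = λ _ → false} {q = p} (λ _ ()) x∈ px (λ ()))

count-unique : {A : Set} (p : A → Bool) (xs : List A) → AllPairs (λ x y → T (p x) → ¬ T (p y)) xs → count p xs ℕ.≤ 1
count-unique p xs d = count≤ (λ _ _ → ⊤) {p = p} {q = λ _ → true} xs (tt ∷ []) (λ _ _ → tt , here refl , tt , tt)
  (AllPairs.map (λ k px py _ _ _ → k px py) d)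

m-count : ∀ {n} (π : SetComp n) w → m π w ≡ fromℕ (count (λ φ → Mᵇ φ w) (filterᵇ (sameBlocks (toRaw π)) (setComps n)))
m-count {n} π w = sym (fromℕ-count (λ φ → Mᵇ φ w) (filterᵇ (sameBlocks (toRaw π)) (setComps n)))

-- Exactly one listed composition orders the blocks of `π` as `w` orders its letters: packing `w`
-- provides it, and distinctness of the list makes it unique.
m-hit : ∀ {n} (π : SetComp n) w → SameKer (word π) w → m π w ≡ 1ℚ
m-hit {n} π w h = trans (m-count π w) (cong fromℕ (ℕ.≤-antisym
    (count-unique (λ φ → Mᵇ φ w) _ (AllPairs.filter⁺ (T? ∘ sameBlocks (toRaw π)) (AllPairs.map
      (λ {φ} {ψ} ne t t′ → ne (λ i j → trans (sym (Mᵇ-elim φ w t i j)) (Mᵇ-elim ψ w t′ i j))) (setComps-distinct n))))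
    at-least))
  where
  at-least : 1 ℕ.≤ count (λ φ → Mᵇ φ w) (filterᵇ (sameBlocks (toRaw π)) (setComps n))
  at-least = let ψ , ψ∈ , o = setComps-order w in
    count-∈ (λ φ → Mᵇ φ w) _ (∈-filter⁺ (T? ∘ sameBlocks (toRaw π)) ψ∈
      (sameBlocks-intro {φ = toRaw π} {ψ} (SameKer-trans h (order⇒SameKer {w = w} {λ i → toℕ (proj₂ ψ i)} o)))) (Mᵇ-intro ψ w o)

m-miss : ∀ {n} (π : SetComp n) w → ¬ SameKer (word π) w → m π w ≡ 0ℚ
m-miss {n} π w h = trans (∑-cong-∈ (filterᵇ (sameBlocks (toRaw π)) (setComps n)) {F = λ φ → M φ w} (λ {φ} φ∈ → cong 𝟙 (¬T⇒≡ {Mᵇ φ w} (λ t →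
  h (SameKer-trans {w = word π} {λ i → toℕ (proj₂ φ i)} {w} (sameBlocks-elim {φ = toRaw π} {φ} (proj₂ (∈-filter⁻ (T? ∘ sameBlocks (toRaw π)) {xs = setComps n} φ∈)))
     (SameKer-sym {w = w} {λ i → toℕ (proj₂ φ i)} (order⇒SameKer {w = w} {λ i → toℕ (proj₂ φ i)} (Mᵇ-elim φ w t))))))))
  (∑-0 (filterᵇ (sameBlocks (toRaw π)) (setComps n)))

SameKer? : ∀ {n} (w w′ : Word n) → Dec (SameKer w w′)
SameKer? w w′ with T? (allPairs (λ i j → (w i ≡ᵇ w j) ⇔ᵇ (w′ i ≡ᵇ w′ j)))
... | yes t = yes (sameKer λ i j → ⇔ᵇ⇒≡ (allPairs-elim {p = λ i j → (w i ≡ᵇ w j) ⇔ᵇ (w′ i ≡ᵇ w′ j)} t i j))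
... | no ¬t = no (λ h → ¬t (allPairs-intro (λ i j → ≡⇒⇔ᵇ (≡ᵇ-≡ h i j))))

-- The coefficients of n

OddPart-blocks : ∀ {n} (π : OddPart n) → OddBlocks (SetComp.blk (OddPart.comp π))
OddPart-blocks π x = ≡ᵇ-true (OddPart.odd π (SetComp.blk (OddPart.comp π) x))

module _ {n ℓ ℓ′ : ℕ} {c : Fin n → Fin ℓ} {d : Fin n → Fin ℓ′} (h : SameKer (toℕ ∘ c) (toℕ ∘ d)) where

  OddBlocks-resp : OddBlocks c → OddBlocks d
  OddBlocks-resp odd x = trans (cong isOdd (count-cong (allFin n) (λ a → sym (≡ᵇ-≡ h a x)))) (odd x)

  inB-resp : ∀ x → inB c x ≡ inB d x
  inB-resp x = cong isOdd (count-cong (allFin n) (λ y → cong (_∧ (y <ᶠ x)) (≡ᵇ-≡ h y x)))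

module NN {n : ℕ} (π : OddPart n) where

  comp : SetComp n
  comp = OddPart.comp π

  reorderings : List (RawComp n)
  reorderings = filterᵇ (sameBlocks (toRaw comp)) (setComps n)

  reorderings-elim : ∀ {φ} → φ ∈ reorderings → SameKer (word comp) (toℕ ∘ proj₂ φ)
  reorderings-elim {φ} φ∈ = sameBlocks-elim {φ = toRaw comp} {φ} (proj₂ (∈-filter⁻ (T? ∘ sameBlocks (toRaw comp)) {xs = setComps n} φ∈))

  monos : Word n → ℕ
  monos w = count (λ φ → monoᵇ (proj₂ φ) w) reorderings

  -- A block of size 2t+1 has t elements at odd offset, so the normalising sign of n_π agrees with
  -- the sign of the `η φ`, which is the same for all reorderings `φ`.
  sign₁ sign₂ : ℚ
  sign₁ = signℚ ((n ℕ.∸ SetComp.ℓ comp) ℕ./ 2)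
  sign₂ = signℚ (count (inB (SetComp.blk comp)) (allFin n))

  nn-formula : ∀ w → nn π w ≡ sign₁ * (sign₂ * (signings w * fromℕ (monos w)))
  nn-formula w = cong (sign₁ *_) (begin
    ∑ reorderings (λ φ → η φ w)
      ≡⟨ ∑-cong-∈ reorderings (λ {φ} φ∈ → trans (η-coefficient (proj₂ φ) (OddBlocks-resp (reorderings-elim {φ} φ∈) (OddPart-blocks π)) w)
          (trans (cong (λ z → if monoᵇ (proj₂ φ) w then signℚ z * signings w else 0ℚ) (count-cong (allFin n) (λ x → sym (inB-resp (reorderings-elim {φ} φ∈) x))))
                 (if-𝟙 (monoᵇ (proj₂ φ) w) (sign₂ * signings w)))) ⟩
    ∑ reorderings (λ φ → (sign₂ * signings w) * 𝟙 (monoᵇ (proj₂ φ) w))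
      ≡⟨ ∑-*ˡ (sign₂ * signings w) reorderings _ ⟩
    (sign₂ * signings w) * ∑ reorderings (λ φ → 𝟙 (monoᵇ (proj₂ φ) w))
      ≡⟨ cong ((sign₂ * signings w) *_) (sym (fromℕ-count (λ φ → monoᵇ (proj₂ φ) w) reorderings)) ⟩
    (sign₂ * signings w) * fromℕ (monos w)
      ≡⟨ ℚ.*-assoc sign₂ (signings w) (fromℕ (monos w)) ⟩
    sign₂ * (signings w * fromℕ (monos w)) ∎)
    where
    open ≡-Reasoning
    if-𝟙 : ∀ a x → (if a then x else 0ℚ) ≡ x * 𝟙 a
    if-𝟙 true x = sym (ℚ.*-identityʳ x)
    if-𝟙 false x = sym (ℚ.*-zeroʳ x)

  Coarser : Word n → Set
  Coarser w = ∀ i j → word comp i ≡ word comp j → w i ≡ w j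

  monoᵇ-const : ∀ {φ : RawComp n} {w : Word n} → T (monoᵇ (proj₂ φ) w) → ∀ i j → toℕ (proj₂ φ i) ≡ toℕ (proj₂ φ j) → w i ≡ w j
  monoᵇ-const {φ} {w} t i j e with monoᵇ-elim (proj₂ φ) w t i j (ℕ.≤-reflexive e)
  ... | inj₁ (p , _) = ⊥-elim (ℕ.<⇒≢ p e)
  ... | inj₂ (_ , q) = q

  nn-support : ∀ w → nn π w ≡ 0ℚ ⊎ Coarser w
  nn-support w = cases (any? (λ φ → T? (monoᵇ (proj₂ φ) w)) reorderings)
    where
    vanish : ¬ Any (λ φ → T (monoᵇ (proj₂ φ) w)) reorderings → fromℕ (monos w) ≡ 0ℚ
    vanish none = trans (fromℕ-count (λ φ → monoᵇ (proj₂ φ) w) reorderings)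
      (trans (∑-cong-∈ reorderings (λ {φ} φ∈ → cong 𝟙 (¬T⇒≡ {monoᵇ (proj₂ φ) w} (λ t → none (lose φ∈ t))))) (∑-0 reorderings))
    cases : Dec (Any (λ φ → T (monoᵇ (proj₂ φ) w)) reorderings) → nn π w ≡ 0ℚ ⊎ Coarser w
    cases (yes ex) = let φ , φ∈ , t = find ex in inj₂ (λ i j e → monoᵇ-const {φ} {w} t i j (SameKer-elim (reorderings-elim {φ} φ∈) e))
    cases (no none) = inj₁ (trans (nn-formula w) (trans (cong (λ z → sign₁ * (sign₂ * (signings w * z))) (vanish none))
      (trans (cong (λ z → sign₁ * (sign₂ * z)) (ℚ.*-zeroʳ (signings w))) (trans (cong (sign₁ *_) (ℚ.*-zeroʳ sign₂)) (ℚ.*-zeroʳ sign₁)))))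

  lexword : ∀ w {ℓ} (c : Fin n → Fin ℓ) → ∃ λ (v : Word n) → ∀ i j → (v i <ᵇ v j) ≡ lex w (toℕ ∘ c) i j
  lexword w {ℓ} c = v , λ i j → bool-ext (to i j) (λ t → ℕ.<⇒<ᵇ (from i j (lex-elim {u = w} {toℕ ∘ c} {i} {j} t)))
    where
    v : Word n
    -- Since `toℕ (c i)` is below `ℓ`, it acts as the last digit in base `ℓ`, and comparing these
    -- numbers is the lexicographic comparison.
    v i = w i ℕ.* ℓ ℕ.+ toℕ (c i)
    from : ∀ i j → w i ℕ.< w j ⊎ (w i ≡ w j × toℕ (c i) ℕ.< toℕ (c j)) → v i ℕ.< v j
    from i j (inj₁ p) = ℕ.<-≤-trans (ℕ.+-monoʳ-< (w i ℕ.* ℓ) (toℕ<n (c i))) (ℕ.≤-trans (ℕ.≤-reflexive (ℕ.+-comm (w i ℕ.* ℓ) ℓ))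
      (ℕ.≤-trans (ℕ.*-monoˡ-≤ ℓ p) (ℕ.m≤m+n (w j ℕ.* ℓ) (toℕ (c j)))))
    from i j (inj₂ (e , p)) rewrite e = ℕ.+-monoʳ-< (w j ℕ.* ℓ) p
    to : ∀ i j → T (v i <ᵇ v j) → T (lex w (toℕ ∘ c) i j)
    to i j t with ℕ.<-cmp (toℕ (c i)) (toℕ (c j)) | ℕ.<-cmp (w i) (w j)
    ... | _ | tri< p _ _ = lex-intro {u = w} {toℕ ∘ c} {i} {j} (inj₁ p)
    ... | _ | tri> _ _ p = ⊥-elim (ℕ.<-asym (ℕ.<ᵇ⇒< (v i) (v j) t) (from j i (inj₁ p)))
    ... | tri< q _ _ | tri≈ _ e _ = lex-intro {u = w} {toℕ ∘ c} {i} {j} (inj₂ (e , q))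
    ... | tri≈ _ q _ | tri≈ _ e _ = ⊥-elim (ℕ.<⇒≢ (ℕ.<ᵇ⇒< (v i) (v j) t) (cong₂ (λ a b → a ℕ.* ℓ ℕ.+ b) e q))
    ... | tri> _ _ q | tri≈ _ e _ = ⊥-elim (ℕ.<-asym (ℕ.<ᵇ⇒< (v i) (v j) t) (from j i (inj₂ (sym e , q))))

  Refines : Word n → RawComp n → RawComp n → Set
  Refines w φ ψ = ∀ i j → (proj₂ ψ i <ᶠ proj₂ ψ j) ≡ lex w (toℕ ∘ proj₂ φ) i j

  -- A mono composition for w turns into one for w′ by sorting its blocks by w′ first;
  -- within a letter the order of the blocks is kept, so it can be recovered.
  monos-≤ : ∀ w w′ → SameKer w w′ → monos w ℕ.≤ monos w′
  monos-≤ w w′ ker = count≤ (Refines w′) reorderings reorderings resort distinct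
    where
    resort : ∀ {φ} → φ ∈ reorderings → T (monoᵇ (proj₂ φ) w) → ∃ λ ψ → ψ ∈ reorderings × T (monoᵇ (proj₂ ψ) w′) × Refines w′ φ ψ
    resort {φ} φ∈ t = ψ , ∈-filter⁺ (T? ∘ sameBlocks (toRaw comp)) ψ∈ (sameBlocks-intro {φ = toRaw comp} {ψ}
        (SameKer-trans (reorderings-elim {φ} φ∈) (SameKer-intro {w = a} {b} ker→ ker←))) , mono , ref
      where
      v : Word n
      v = proj₁ (lexword w′ (proj₂ φ))
      hv = proj₂ (lexword w′ (proj₂ φ))
      ψ : RawComp n
      ψ = proj₁ (setComps-order v)
      ψ∈ = proj₁ (proj₂ (setComps-order v))
      hψ = proj₂ (proj₂ (setComps-order v))
      a b : Word n
      a i = toℕ (proj₂ φ i)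
      b i = toℕ (proj₂ ψ i)
      ref : Refines w′ φ ψ
      ref i j = trans (sym (hψ i j)) (hv i j)
      b-< : ∀ i j → w′ i ℕ.< w′ j ⊎ (w′ i ≡ w′ j × a i ℕ.< a j) → b i ℕ.< b j
      b-< i j p = ℕ.<ᵇ⇒< (b i) (b j) (subst T (sym (ref i j)) (lex-intro {u = w′} {a} {i} {j} p))
      b-<⁻ : ∀ i j → b i ℕ.< b j → w′ i ℕ.< w′ j ⊎ (w′ i ≡ w′ j × a i ℕ.< a j)
      b-<⁻ i j p = lex-elim {u = w′} {a} {i} {j} (subst T (ref i j) (ℕ.<⇒<ᵇ p))
      const : ∀ i j → a i ≡ a j → w′ i ≡ w′ j
      const i j e = SameKer-elim ker (monoᵇ-const {φ} {w} t i j e)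
      ker→ : ∀ i j → a i ≡ a j → b i ≡ b j
      ker→ i j e = ℕ.≤-antisym (ℕ.≮⇒≥ (not-< j i (sym e))) (ℕ.≮⇒≥ (not-< i j e))
        where
        not-< : ∀ i j → a i ≡ a j → ¬ b i ℕ.< b j
        not-< i j e p with b-<⁻ i j p
        ... | inj₁ q = ℕ.<⇒≢ q (const i j e)
        ... | inj₂ (_ , q) = ℕ.<⇒≢ q e
      trichotomy : ∀ i j → b i ≡ b j → w′ i ≡ w′ j × a i ≡ a j
      trichotomy i j e with ℕ.<-cmp (w′ i) (w′ j) | ℕ.<-cmp (a i) (a j)
      ... | tri< p _ _ | _ = ⊥-elim (ℕ.<⇒≢ (b-< i j (inj₁ p)) e)
      ... | tri> _ _ p | _ = ⊥-elim (ℕ.<⇒≢ (b-< j i (inj₁ p)) (sym e))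
      ... | tri≈ _ p _ | tri< q _ _ = ⊥-elim (ℕ.<⇒≢ (b-< i j (inj₂ (p , q))) e)
      ... | tri≈ _ p _ | tri≈ _ q _ = p , q
      ... | tri≈ _ p _ | tri> _ _ q = ⊥-elim (ℕ.<⇒≢ (b-< j i (inj₂ (sym p , q))) (sym e))
      ker← : ∀ i j → b i ≡ b j → a i ≡ a j
      ker← i j e = proj₂ (trichotomy i j e)
      mono : T (monoᵇ (proj₂ ψ) w′)
      mono = monoᵇ-intro (proj₂ ψ) w′ cases
        where
        cases : ∀ i j → b i ℕ.≤ b j → (b i ℕ.< b j × w′ i ℕ.≤ w′ j) ⊎ (b i ≡ b j × w′ i ≡ w′ j)
        cases i j le with ℕ.m≤n⇒m<n∨m≡n le
        ... | inj₂ e = inj₂ (e , proj₁ (trichotomy i j e))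
        ... | inj₁ p with b-<⁻ i j p
        ...   | inj₁ q = inj₁ (p , ℕ.<⇒≤ q)
        ...   | inj₂ (q , _) = inj₁ (p , ℕ.≤-reflexive q)
    recover : ∀ φ φ′ ψ → T (monoᵇ (proj₂ φ) w) → T (monoᵇ (proj₂ φ′) w) → Refines w′ φ ψ → Refines w′ φ′ ψ →
      ∀ i j → toℕ (proj₂ φ i) ℕ.< toℕ (proj₂ φ j) → toℕ (proj₂ φ′ i) ℕ.< toℕ (proj₂ φ′ j)
    recover φ φ′ ψ t t′ r r′ i j p with ℕ.m≤n⇒m<n∨m≡n mono-le
      where
      mono-le : w i ℕ.≤ w j
      mono-le with monoᵇ-elim (proj₂ φ) w t i j (ℕ.<⇒≤ p)
      ... | inj₁ (_ , q) = q
      ... | inj₂ (e , _) = ⊥-elim (ℕ.<⇒≢ p e)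
    ... | inj₂ e with lex-elim {u = w′} {toℕ ∘ proj₂ φ′} {i} {j} (subst T (trans (sym (r i j)) (r′ i j))
                        (lex-intro {u = w′} {toℕ ∘ proj₂ φ} {i} {j} (inj₂ (SameKer-elim ker e , p))))
    ...   | inj₁ q = ⊥-elim (ℕ.<⇒≢ q (SameKer-elim ker e))
    ...   | inj₂ (_ , q) = q
    -- Between different letters `ψ` shows only the order of `w′`, which need not be that of `w`;
    -- there the monotonicity of `φ′` for `w` fixes the order.
    recover φ φ′ ψ t t′ r r′ i j p | inj₁ w< = ℕ.≰⇒> (λ le → ℕ.<⇒≱ w< (weak le))
      where
      weak : toℕ (proj₂ φ′ j) ℕ.≤ toℕ (proj₂ φ′ i) → w j ℕ.≤ w i
      weak le with monoᵇ-elim (proj₂ φ′) w t′ j i le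
      ... | inj₁ (_ , q) = q
      ... | inj₂ (_ , q) = ℕ.≤-reflexive q
    distinct : AllPairs (λ φ φ′ → T (monoᵇ (proj₂ φ) w) → T (monoᵇ (proj₂ φ′) w) → ∀ ψ → Refines w′ φ ψ → ¬ Refines w′ φ′ ψ) reorderings
    distinct = AllPairs.filter⁺ (T? ∘ sameBlocks (toRaw comp)) (AllPairs.map
      (λ {φ} {φ′} ne t t′ ψ r r′ → ne (λ i j → bool-ext
        (λ p → ℕ.<⇒<ᵇ (recover φ φ′ ψ t t′ r r′ i j (ℕ.<ᵇ⇒< (toℕ (proj₂ φ i)) (toℕ (proj₂ φ j)) p)))
        (λ p → ℕ.<⇒<ᵇ (recover φ′ φ ψ t′ t r′ r i j (ℕ.<ᵇ⇒< (toℕ (proj₂ φ′ i)) (toℕ (proj₂ φ′ j)) p)))))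
      (setComps-distinct n))

  nn-symmetric : ∀ w w′ → SameKer w w′ → nn π w ≡ nn π w′
  nn-symmetric w w′ ker = trans (nn-formula w) (trans (cong₂ (λ x y → sign₁ * (sign₂ * (x * fromℕ y)))
      (∑-cong (bools n) (λ s → cong 𝟙 (allPairs-cong (λ i j → cong (λ b → not b ∨ (s i ⇔ᵇ s j)) (≡ᵇ-≡ ker i j)))))
      (ℕ.≤-antisym (monos-≤ w w′ ker) (monos-≤ w′ w (SameKer-sym {w = w} {w′} ker)))) (sym (nn-formula w′)))

  -- The word of `π` increases along the composition `comp` itself and admits constant signs, so
  -- both counts in `nn-formula` are positive; the two signs have square 1 and cannot annihilate
  -- them.
  nn-nonzero : nn π (word comp) ≢ 0ℚ
  nn-nonzero e = ℚ.<⇒≢ SF>0 (sym zero-product)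
    where
    S F : ℚ
    S = signings (word comp)
    F = fromℕ (monos (word comp))
    zero-product : S * F ≡ 0ℚ
    zero-product = begin
      S * F ≡⟨ sym (trans (cong₂ (λ x y → x * y * (S * F)) (signℚ² ((n ℕ.∸ SetComp.ℓ comp) ℕ./ 2)) (signℚ² (count (inB (SetComp.blk comp)) (allFin n))))
                (trans (cong (_* (S * F)) (ℚ.*-identityˡ 1ℚ)) (ℚ.*-identityˡ (S * F)))) ⟩
      (sign₁ * sign₁) * (sign₂ * sign₂) * (S * F) ≡⟨ rearrange sign₁ sign₂ (S * F) ⟩
      (sign₁ * sign₂) * (sign₁ * (sign₂ * (S * F))) ≡⟨ cong ((sign₁ * sign₂) *_) (trans (sym (nn-formula (word comp))) e) ⟩
      (sign₁ * sign₂) * 0ℚ ≡⟨ ℚ.*-zeroʳ (sign₁ * sign₂) ⟩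
      0ℚ ∎
      where
      open ≡-Reasoning
      rearrange : ∀ a b x → (a * a) * (b * b) * x ≡ (a * b) * (a * (b * x))
      rearrange = solve 3 (λ a b x → (a :* a) :* (b :* b) :* x := (a :* b) :* (a :* (b :* x))) refl
        where open +-*-Solver
    0<𝟙 : ∀ {b} → T b → 0ℚ < 𝟙 b
    0<𝟙 {true} _ = ℚ.positive⁻¹ 1ℚ
    S>0 : 0ℚ < S
    S>0 = let s , s∈ , e = allFuns-complete n {true ∷ false ∷ []} (λ _ → true) (λ _ → here refl) in
      ∑-pos (bools n) (λ s → 0≤𝟙 (constᵇ (word comp) s)) s∈ (0<𝟙 (constᵇ-intro {w = word comp} {s} (λ i j _ → trans (e i) (sym (e j)))))
    F>0 : 0ℚ < F
    F>0 = subst (0ℚ <_) (sym (fromℕ-count (λ φ → monoᵇ (proj₂ φ) (word comp)) reorderings))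
          (∑-pos reorderings (λ φ → 0≤𝟙 (monoᵇ (proj₂ φ) (word comp)))
            (∈-filter⁺ (T? ∘ sameBlocks (toRaw comp)) φ∈ (sameBlocks-intro {φ = toRaw comp} {φ} (sameKer λ i j → sym (cong₂ _≡ᵇ_ (φ≡ i) (φ≡ j)))))
            (0<𝟙 (monoᵇ-intro (proj₂ φ) (word comp) cases)))
      where
      φ : RawComp n
      φ = proj₁ (setComps-complete comp)
      φ∈ = proj₁ (proj₂ (setComps-complete comp))
      φ≡ = proj₂ (proj₂ (setComps-complete comp))
      cases : ∀ i j → toℕ (proj₂ φ i) ℕ.≤ toℕ (proj₂ φ j) → (toℕ (proj₂ φ i) ℕ.< toℕ (proj₂ φ j) × word comp i ℕ.≤ word comp j) ⊎ (toℕ (proj₂ φ i) ≡ toℕ (proj₂ φ j) × word comp i ≡ word comp j)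
      cases i j le with ℕ.m≤n⇒m<n∨m≡n le
      ... | inj₁ p = inj₁ (p , subst₂ ℕ._≤_ (φ≡ i) (φ≡ j) le)
      ... | inj₂ p = inj₂ (p , trans (sym (φ≡ i)) (trans p (φ≡ j)))
    SF>0 : 0ℚ < S * F
    SF>0 = ℚ.positive⁻¹ (S * F) {{ℚ.pos*pos⇒pos S {{positive S>0}} F {{positive F>0}}}}

-- Linear combinations

-- The coefficient form of membership in `NCSym n`: renaming letters injectively does not change a
-- coefficient.
KerInv : ∀ {n} → Series n → Set
KerInv {n} f = ∀ (w w′ : Word n) → SameKer w w′ → f w ≡ f w′

KerInv-lincomb : ∀ {n} {A : Set} {f : A → Series n} → (∀ a → KerInv (f a)) → ∀ L → KerInv (lincomb f L)
KerInv-lincomb h L w w′ ker = ∑-cong L (λ p → cong (proj₁ p *_) (h (proj₂ p) w w′ ker))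

KerInv-InSpan : ∀ {n} {A : Set} {f : A → Series n} → (∀ a → KerInv (f a)) → ∀ {s} → InSpan f s → KerInv s
KerInv-InSpan h (L , e) w w′ ker = trans (e w) (trans (KerInv-lincomb h L w w′ ker) (sym (e w′)))

Balanced-lincomb : ∀ {n} {A : Set} {f : A → Series n} → (∀ a → Balanced (f a)) → ∀ L → Balanced (lincomb f L)
Balanced-lincomb {n} {f = f} h L w k ex no-suc = begin
  ∑ (bools n) (λ D → χ w k D * ∑ L (λ p → proj₁ p * f (proj₂ p) (raise w k D)))
    ≡⟨ ∑-cong (bools n) (λ D → sym (∑-*ˡ (χ w k D) L _)) ⟩
  ∑ (bools n) (λ D → ∑ L (λ p → χ w k D * (proj₁ p * f (proj₂ p) (raise w k D))))
    ≡⟨ ∑-swap (bools n) L _ ⟩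
  ∑ L (λ p → ∑ (bools n) (λ D → χ w k D * (proj₁ p * f (proj₂ p) (raise w k D))))
    ≡⟨ ∑-zero L (λ p → trans (∑-cong (bools n) (λ D → swap-left (χ w k D) (proj₁ p) (f (proj₂ p) (raise w k D))))
        (trans (∑-*ˡ (proj₁ p) (bools n) _) (trans (cong (proj₁ p *_) (h (proj₂ p) w k ex no-suc)) (ℚ.*-zeroʳ (proj₁ p))))) ⟩
  0ℚ ∎
  where
  open ≡-Reasoning
  swap-left : ∀ a b c → a * (b * c) ≡ b * (a * c)
  swap-left = solve 3 (λ a b c → a :* (b :* c) := b :* (a :* c)) refl
    where open +-*-Solver

Balanced-InSpan : ∀ {n} {A : Set} {f : A → Series n} → (∀ a → Balanced (f a)) → ∀ {s} → InSpan f s → Balanced s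
Balanced-InSpan {n} {f = f} h (L , e) w k ex no-suc = trans (∑-cong (bools n) (λ D → cong (χ w k D *_) (e (raise w k D)))) (Balanced-lincomb {f = f} h L w k ex no-suc)

Balanced-minus : ∀ {n} {f g : Series n} → Balanced f → Balanced g → Balanced (λ w → f w - g w)
Balanced-minus {n} {f} {g} hf hg w k ex no-suc = begin
  ∑ (bools n) (λ D → χ w k D * (f (raise w k D) - g (raise w k D)))
    ≡⟨ ∑-cong (bools n) (λ D → distrib (χ w k D) (f (raise w k D)) (g (raise w k D))) ⟩
  ∑ (bools n) (λ D → χ w k D * f (raise w k D) + - (χ w k D * g (raise w k D)))
    ≡⟨ ∑-+ (bools n) _ _ ⟩
  ∑ (bools n) (λ D → χ w k D * f (raise w k D)) + ∑ (bools n) (λ D → - (χ w k D * g (raise w k D)))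
    ≡⟨ cong₂ _+_ (hf w k ex no-suc) (trans (∑-neg (bools n) _) (cong -_ (hg w k ex no-suc))) ⟩
  0ℚ ∎
  where
  open ≡-Reasoning
  distrib : ∀ a b c → a * (b - c) ≡ a * b + - (a * c)
  distrib = solve 3 (λ a b c → a :* (b :- c) := a :* b :+ :- (a :* c)) refl
    where open +-*-Solver

-- Closure of spans, and triangular elimination

InSpan-∑ : ∀ {n} {A B : Set} {f : A → Series n} (xs : List B) (g : B → Series n) → (∀ b → InSpan f (g b)) → InSpan f (λ w → ∑ xs (λ b → g b w))
InSpan-∑ [] g h = [] , λ w → refl
InSpan-∑ {f = f} (x ∷ xs) g h = proj₁ (h x) ++ proj₁ (InSpan-∑ xs g h) , λ w → trans
  (cong₂ _+_ (proj₂ (h x) w) (proj₂ (InSpan-∑ xs g h) w)) (sym (∑-++ (proj₁ (h x)) _ (λ p → proj₁ p * f (proj₂ p) w)))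

InSpan-* : ∀ {n} {A : Set} {f : A → Series n} c {s} → InSpan f s → InSpan f (λ w → c * s w)
InSpan-* {f = f} c (L , e) = map (λ p → c * proj₁ p , proj₂ p) L , λ w → trans (cong (c *_) (e w)) (trans (sym (∑-*ˡ c L _))
  (trans (∑-cong L (λ p → sym (ℚ.*-assoc c (proj₁ p) (f (proj₂ p) w)))) (sym (∑-map _ L _))))

x-y≡0⇒x≡y : ∀ {x y} → x - y ≡ 0ℚ → x ≡ y
x-y≡0⇒x≡y {x} {y} e = trans (solve 2 (λ x y → x := (x :- y) :+ y) refl x y) (trans (cong (_+ y) e) (ℚ.+-identityˡ y))
  where open +-*-Solver

divide : ∀ {a} b → a ≢ 0ℚ → ∃ λ c → c * a ≡ b
divide {a} b ne = b * inv , trans (ℚ.*-assoc b inv a) (trans (cong (b *_) (ℚ.*-inverseˡ a {{≢-nonZero ne}})) (ℚ.*-identityʳ b))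
  where inv = (1/ a) {{≢-nonZero ne}}

cancel : ∀ {a x} → a ≢ 0ℚ → a * x ≡ 0ℚ → x ≡ 0ℚ
cancel {a} {x} ne e with divide 1ℚ ne
... | c , ca = trans (sym (ℚ.*-identityˡ x)) (trans (cong (_* x) (sym ca)) (trans (ℚ.*-assoc c a x) (trans (cong (c *_) e) (ℚ.*-zeroʳ c))))

All-⊎ : {A : Set} {P Q : A → Set} {xs : List A} → All (λ a → P a ⊎ Q a) xs → All P xs ⊎ Any Q xs
All-⊎ [] = inj₁ []
All-⊎ (inj₂ q ∷ h) = inj₂ (here q)
All-⊎ (inj₁ p ∷ h) with All-⊎ h
... | inj₁ ps = inj₁ (p ∷ ps)
... | inj₂ q = inj₂ (there q)

-- Triangular elimination: f is matched successively at the test words t a.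
eliminate : ∀ {n} {A : Set} (F : A → Series n) (t : A → Word n) → (∀ a → KerInv (F a)) → (∀ a → F a (t a) ≢ 0ℚ) →
  ∀ xs → AllPairs (λ a b → F b (t a) ≡ 0ℚ ⊎ SameKer (t a) (t b)) xs → ∀ f → KerInv f →
  ∃ λ L → (∀ w → All (λ a → F a w ≡ 0ℚ) xs → lincomb F L w ≡ 0ℚ) × All (λ a → f (t a) ≡ lincomb F L (t a)) xs
eliminate F t inv nz [] [] f f-inv = [] , (λ w _ → refl) , []
eliminate F t inv nz (x ∷ xs) (dx ∷ d) f f-inv with divide (f (t x)) (nz x)
... | c , c≡ with eliminate F t inv nz xs d (λ w → f w - c * F x w) (λ w w′ ker → cong₂ (λ a b → a - c * b) (f-inv w w′ ker) (inv x w w′ ker))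
...   | L , vanish , hit = (c , x) ∷ L , vanish′ , hit-x ∷ All.map (λ {a} e → add e) hit
  where
  add : ∀ {a b l} → a - b ≡ l → a ≡ b + l
  add {a} {b} e = trans (solve 2 (λ a b → a := b :+ (a :- b)) refl a b) (cong (b +_) e)
    where open +-*-Solver
  vanish′ : ∀ w → All (λ a → F a w ≡ 0ℚ) (x ∷ xs) → lincomb F ((c , x) ∷ L) w ≡ 0ℚ
  vanish′ w (px ∷ pxs) = trans (cong₂ _+_ (trans (cong (c *_) px) (ℚ.*-zeroʳ c)) (vanish w pxs)) (ℚ.+-identityʳ 0ℚ)
  residue : f (t x) - c * F x (t x) ≡ 0ℚ
  residue = trans (cong (λ z → f (t x) - z) c≡) (ℚ.+-inverseʳ (f (t x)))
  -- Either every later series vanishes at `t x`, or a later test word has the same kernel. In the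
  -- second case `L` already matches the residue there, and the residue vanishes at `t x`. This is
  -- what lets `xs` contain repetitions up to kernel.
  rest : lincomb F L (t x) ≡ 0ℚ
  rest with All-⊎ dx
  ... | inj₁ zeros = vanish (t x) zeros
  ... | inj₂ ex with find ex
  ...   | a , a∈ , ker = trans (KerInv-lincomb inv L (t x) (t a) ker) (trans (sym (All.lookup hit a∈))
            (trans (sym (cong₂ (λ a b → a - c * b) (f-inv (t x) (t a) ker) (inv x (t x) (t a) ker))) residue))
  hit-x : f (t x) ≡ lincomb F ((c , x) ∷ L) (t x)
  hit-x = add (trans residue (sym rest))

-- The number of pairs of equal letters

pairs : ∀ n → List (Fin n × Fin n)
pairs n = cartesianProduct (allFin n) (allFin n)

-- As ordered pairs are counted, this is the sum of the squares of the multiplicities of the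
-- letters. It is a measure of coarseness that serves for all inductions over kernels.
μ : ∀ {n} → Word n → ℕ
μ {n} w = count (λ p → w (proj₁ p) ≡ᵇ w (proj₂ p)) (pairs n)

μ-cong : ∀ {n} {w w′ : Word n} → SameKer w w′ → μ w ≡ μ w′
μ-cong {n} ker = count-cong (pairs n) (λ p → ≡ᵇ-≡ ker (proj₁ p) (proj₂ p))

μ-< : ∀ {n} {w w′ : Word n} → (∀ i j → w i ≡ w j → w′ i ≡ w′ j) → ∀ i j → w′ i ≡ w′ j → w i ≢ w j → μ w ℕ.< μ w′
μ-< {n} {w} {w′} h i j e ne = count-< {p = λ p → w (proj₁ p) ≡ᵇ w (proj₂ p)} {q = λ p → w′ (proj₁ p) ≡ᵇ w′ (proj₂ p)}
  (λ p t → ℕ.≡⇒≡ᵇ (w′ (proj₁ p)) (w′ (proj₂ p)) (h _ _ (ℕ.≡ᵇ⇒≡ (w (proj₁ p)) (w (proj₂ p)) t)))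
  (∈-cartesianProduct⁺ (∈-allFin i) (∈-allFin j)) (ℕ.≡⇒≡ᵇ (w′ i) (w′ j) e) (λ t → ne (ℕ.≡ᵇ⇒≡ (w i) (w j) t))

μ-dichotomy : ∀ {n} {w w′ : Word n} → (∀ i j → w i ≡ w j → w′ i ≡ w′ j) → μ w ℕ.< μ w′ ⊎ SameKer w w′
μ-dichotomy {n} {w} {w′} h with Fin.any? (λ i → Fin.any? (λ j → (w′ i ℕ.≟ w′ j) ×-dec ¬? (w i ℕ.≟ w j)))
... | yes (i , j , e , ne) = inj₁ (μ-< h i j e ne)
... | no none = inj₂ (SameKer-intro h (λ i j e → decidable-stable (w i ℕ.≟ w j) (λ ne → none (i , j , e , ne))))

-- A balanced symmetric series is determined by its coefficients at odd words

OddWord : ∀ {n} → Word n → Set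
OddWord {n} w = ∀ i → isOdd (count (λ a → w a ≡ᵇ w i) (allFin n)) ≡ true

signℚ-isOdd : ∀ k → signℚ k ≡ -1^ (isOdd k)
signℚ-isOdd zero = refl
signℚ-isOdd (suc k) = trans (signℚ-suc k) (trans (cong -_ (signℚ-isOdd k)) (trans (neg (isOdd k)) (cong -1^ (sym (isOdd-suc k)))))
  where
  neg : ∀ b → - -1^ b ≡ -1^ (not b)
  neg true = refl
  neg false = refl

∏-one : ∀ {n} {F : Fin n → ℚ} → (∀ i → F i ≡ 1ℚ) → ∏ F ≡ 1ℚ
∏-one {zero} h = refl
∏-one {suc n} h = trans (cong₂ _*_ (h zero) (∏-one (h ∘ suc))) (ℚ.*-identityˡ 1ℚ)

module Split {n : ℕ} (v : Word n) (k : ℕ) (no-suc : ∀ i → v i ≢ suc k) where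

  isK : Fin n → Bool
  isK i = v i ≡ᵇ k

  some missing : (Fin n → Bool) → Bool
  some D = any (λ i → isK i ∧ D i) (allFin n)
  missing D = any (λ i → isK i ∧ not (D i)) (allFin n)

  trivial : (Fin n → Bool) → Bool
  trivial D = not (some D) ∨ not (missing D)

  missing-intro : ∀ D i → v i ≡ k → ¬ T (D i) → T (missing D)
  missing-intro D i e d = any-intro {p = λ i → isK i ∧ not (D i)} i (∧-intro (ℕ.≡⇒≡ᵇ (v i) k e) (not-intro {D i} d))

  -- The letter `suc k` is absent from `v`, so raising can split the letter `k` but cannot merge
  -- anything.
  raise-refines : ∀ D i j → raise v k D i ≡ raise v k D j → v i ≡ v j
  raise-refines D i j e = go (T? (isK i)) (T? (isK j)) (T? (D i)) (T? (D j))
    where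
    to : ∀ i → T (isK i) → v i ≡ k
    to i = ℕ.≡ᵇ⇒≡ (v i) k
    hit : ∀ i → T (isK i) → raise v k D i ≡ (if D i then suc k else k)
    hit i t = raise-hit {w = v} D (to i t)
    miss : ∀ i → ¬ T (isK i) → raise v k D i ≡ v i
    miss i t = raise-miss {w = v} D (λ e → t (ℕ.≡⇒≡ᵇ (v i) k e))
    far : ∀ i j → T (isK i) → ¬ T (isK j) → raise v k D i ≡ raise v k D j → v i ≡ v j
    far i j t t′ e = lem (D i) (trans (sym (hit i t)) (trans e (miss j t′)))
      where
      lem : ∀ d → (if d then suc k else k) ≡ v j → v i ≡ v j
      lem true q = ⊥-elim (no-suc j (sym q))
      lem false q = trans (to i t) q
    go : Dec (T (isK i)) → Dec (T (isK j)) → Dec (T (D i)) → Dec (T (D j)) → v i ≡ v j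
    go (yes p) (yes q) _ _ = trans (to i p) (sym (to j q))
    go (yes p) (no q) _ _ = far i j p q e
    go (no p) (yes q) _ _ = sym (far j i q p (sym e))
    go (no p) (no q) _ _ = trans (sym (miss i p)) (trans e (miss j q))

  raise-none : ∀ D → ¬ T (some D) → ∀ i → raise v k D i ≡ v i
  raise-none D h i with T? (isK i ∧ D i)
  ... | yes t = ⊥-elim (h (any-intro {p = λ i → isK i ∧ D i} i t))
  ... | no t = cong (λ b → if b then suc k else v i) (¬T⇒≡ {isK i ∧ D i} t)

  χ-none : ∀ D → ¬ T (some D) → χ v k D ≡ 1ℚ
  χ-none D h = ∏-one (λ i → cong -1^ (¬T⇒≡ {isK i ∧ D i} (λ t → h (any-intro {p = λ i → isK i ∧ D i} i t))))

  full-∧ : ∀ D → ¬ T (missing D) → ∀ i → (isK i ∧ D i) ≡ isK i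
  full-∧ D h i = bool-ext (λ t → proj₁ (∧-elim {isK i} t)) (λ t → ∧-intro t (decidable-stable (T? (D i)) (λ d → h (missing-intro D i (ℕ.≡ᵇ⇒≡ (v i) k t) d))))

  χ-full : ∀ D → ¬ T (missing D) → isOdd (count isK (allFin n)) ≡ false → χ v k D ≡ 1ℚ
  χ-full D h even = trans (∏-cong (λ i → cong -1^ (full-∧ D h i))) (trans (∏-sign isK) (trans (signℚ-isOdd (count isK (allFin n))) (cong -1^ even)))

  raise-full : ∀ D → ¬ T (missing D) → SameKer (raise v k D) v
  raise-full D h = SameKer-intro (raise-refines D) (λ i j e → cong₂ (λ b x → if b then suc k else x)
    (trans (full-∧ D h i) (trans (cong (_≡ᵇ k) e) (sym (full-∧ D h j)))) e)

  raise-proper : ∀ D → T (some D) → T (missing D) → μ (raise v k D) ℕ.< μ v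
  raise-proper D s m with any-elim {p = λ i → isK i ∧ D i} s | any-elim {p = λ i → isK i ∧ not (D i)} m
  ... | i , t | j , t′ = μ-< (raise-refines D) i j (trans vi (sym vj)) (λ e → ℕ.1+n≢n (trans (sym ri) (trans e rj)))
    where
    vi : v i ≡ k
    vi = ℕ.≡ᵇ⇒≡ (v i) k (proj₁ (∧-elim {isK i} t))
    vj : v j ≡ k
    vj = ℕ.≡ᵇ⇒≡ (v j) k (proj₁ (∧-elim {isK j} t′))
    ri : raise v k D i ≡ suc k
    ri = trans (raise-hit {w = v} D vi) (cong (λ b → if b then suc k else k) (T⇒≡ (proj₂ (∧-elim {isK i} t))))
    rj : raise v k D j ≡ k
    rj = trans (raise-hit {w = v} D vj) (cong (λ b → if b then suc k else k) (¬T⇒≡ (not-elim {D j} (proj₂ (∧-elim {isK j} t′)))))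

module _ {n : ℕ} {f : Series n} (f-inv : KerInv f) (f-bal : Balanced f) where

  -- Raising none or all of an even block preserves the kernel and has sign +1; all other
  -- terms of the relation are finer words.
  even-step : ∀ (v : Word n) k → (∃ λ i → v i ≡ k) → (∀ i → v i ≢ suc k) → isOdd (count (λ i → v i ≡ᵇ k) (allFin n)) ≡ false →
    (∀ u → μ u ℕ.< μ v → f u ≡ 0ℚ) → f v ≡ 0ℚ
  -- The relation collapses to the number of trivial `D` times `f v`. That number need not be 2,
  -- because `D` is free at positions with other letters, but it is positive: the empty `D` is
  -- trivial.
  even-step v k ex no-suc even ih = cancel (λ e → ℚ.<⇒≢ total>0 (sym e)) (trans (sym (∑-*ʳ (f v) (bools n) (λ D → 𝟙 (trivial D))))
      (trans (∑-cong (bools n) (λ D → sym (term D (T? (some D)) (T? (missing D))))) (f-bal v k ex no-suc)))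
    where
    open Split v k no-suc
    term : ∀ D → Dec (T (some D)) → Dec (T (missing D)) → χ v k D * f (raise v k D) ≡ 𝟙 (trivial D) * f v
    term D (no s) _ = cong₂ _*_ (trans (χ-none D s) (cong 𝟙 (sym triv))) (f-inv _ _ (sameKer λ i j → cong₂ _≡ᵇ_ (raise-none D s i) (raise-none D s j)))
      where
      triv : trivial D ≡ true
      triv = cong (λ a → not a ∨ not (missing D)) (¬T⇒≡ s)
    term D (yes s) (no m) = cong₂ _*_ (trans (χ-full D m even) (cong 𝟙 (sym triv))) (f-inv _ _ (raise-full D m))
      where
      triv : trivial D ≡ true
      triv = cong₂ (λ a b → not a ∨ not b) (T⇒≡ s) (¬T⇒≡ m)
    term D (yes s) (yes m) = trans (cong (χ v k D *_) (ih _ (raise-proper D s m)))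
      (trans (ℚ.*-zeroʳ (χ v k D)) (trans (sym (ℚ.*-zeroˡ (f v))) (cong (λ b → 𝟙 b * f v) (sym triv))))
      where
      triv : trivial D ≡ false
      triv = cong₂ (λ a b → not a ∨ not b) (T⇒≡ s) (T⇒≡ m)
    total>0 : 0ℚ < ∑ (bools n) (λ D → 𝟙 (trivial D))
    total>0 = ∑-pos (bools n) (λ D → 0≤𝟙 (trivial D)) (proj₁ (proj₂ empty)) (subst (λ b → 0ℚ < 𝟙 (not b ∨ not (missing (proj₁ empty)))) (sym (¬T⇒≡ none)) (ℚ.positive⁻¹ 1ℚ))
      where
      empty : ∃ λ D → D ∈ bools n × (∀ i → D i ≡ false)
      empty = allFuns-complete n {true ∷ false ∷ []} (λ _ → false) (λ _ → there (here refl))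
      none : ¬ T (some (proj₁ empty))
      none t = let i , u = any-elim {p = λ i → isK i ∧ proj₁ empty i} t in ≡⇒¬T (proj₂ (proj₂ empty) i) (proj₂ (∧-elim {isK i} u))

  vanishing : (∀ w → OddWord w → f w ≡ 0ℚ) → ∀ w → f w ≡ 0ℚ
  vanishing odd-zero w = go w (<-wellFounded (μ w))
    where
    go : ∀ w → Acc ℕ._<_ (μ w) → f w ≡ 0ℚ
    go w (acc rec) with Fin.any? (λ i → isOdd (count (λ a → w a ≡ᵇ w i) (allFin n)) Bool.≟ false)
    ... | no none = odd-zero w (λ i → ¬-not (λ e → none (i , e)))
    ... | yes (i , even) = trans (f-inv w v same) (even-step v (v i) (i , refl) (λ j e → ℕ.even≢odd (w j) (w i) e)
            (trans (cong isOdd (count-cong (allFin n) (λ a → sym (≡ᵇ-≡ same a i)))) even)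
            (λ u lt → go u (rec (subst (μ u ℕ.<_) (sym (μ-cong same)) lt))))
      where
      -- Doubling all letters preserves the kernel and leaves the letter after `v i` unoccupied, as
      -- the relation requires.
      v : Word n
      v a = 2 ℕ.* w a
      same : SameKer w v
      same = SameKer-intro (λ a b → cong (2 ℕ.*_)) (λ a b → ℕ.*-cancelˡ-≡ (w a) (w b) 2)

-- Every symmetric series is spanned by the m

-- Every kernel is represented, possibly several times; `eliminate` tolerates the repetitions.
comps : ∀ n → List (SetComp n)
comps n = map (λ w → proj₁ (pack w)) (allFuns n (upTo n))

-- Packing `w` first brings its letters below `n`. The packed word occurs in the list of words only
-- up to pointwise equality, so it is the packing of that listed copy that represents `w`.
comps-complete : ∀ {n} (w : Word n) → ∃ λ φ → φ ∈ comps n × SameKer w (word φ)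
comps-complete {n} w = proj₁ (pack v) , ∈-map⁺ (λ w → proj₁ (pack w)) v∈
    , SameKer-trans (order⇒SameKer {w = w} {word φ} (proj₂ (pack w))) (SameKer-trans (sameKer λ i j → sym (cong₂ _≡ᵇ_ (v≡ i) (v≡ j)))
        (order⇒SameKer {w = v} {word (proj₁ (pack v))} (proj₂ (pack v))))
  where
  φ : SetComp n
  φ = proj₁ (pack w)
  representative : ∃ λ v → v ∈ allFuns n (upTo n) × (∀ i → v i ≡ word φ i)
  representative = allFuns-complete n (word φ) (λ i → ∈-upTo⁺ (ℕ.<-≤-trans (toℕ<n (SetComp.blk φ i)) (length-≤ φ)))
  v = proj₁ representative
  v∈ = proj₁ (proj₂ representative)
  v≡ = proj₂ (proj₂ representative)

m-KerInv : ∀ {n} (π : SetComp n) → KerInv (m π)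
m-KerInv π w w′ ker = cases (SameKer? (word π) w)
  where
  cases : Dec (SameKer (word π) w) → m π w ≡ m π w′
  cases (yes p) = trans (m-hit π w p) (sym (m-hit π w′ (SameKer-trans p ker)))
  cases (no ¬p) = trans (m-miss π w ¬p) (sym (m-miss π w′ (λ p → ¬p (SameKer-trans p (SameKer-sym ker)))))

-- The series `m ρ` and the words of partitions are dual up to kernel, so elimination works in any
-- order and matches `f` at a representative of every kernel.
KerInv⇒NCSym : ∀ {n} {f : Series n} → KerInv f → NCSym n f
KerInv⇒NCSym {n} {f} f-inv = L , agree
  where
  dichotomy : ∀ π ρ → m ρ (word π) ≡ 0ℚ ⊎ SameKer (word π) (word ρ)
  dichotomy π ρ = cases (SameKer? (word ρ) (word π))
    where
    cases : Dec (SameKer (word ρ) (word π)) → m ρ (word π) ≡ 0ℚ ⊎ SameKer (word π) (word ρ)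
    cases (yes p) = inj₂ (SameKer-sym p)
    cases (no ¬p) = inj₁ (m-miss ρ (word π) ¬p)
  AllPairs-all : ∀ {A : Set} {R : A → A → Set} xs → (∀ x y → R x y) → AllPairs R xs
  AllPairs-all [] h = []
  AllPairs-all (x ∷ xs) h = All.tabulate (λ {y} _ → h x y) ∷ AllPairs-all xs h
  m-nonzero : ∀ π → m π (word π) ≢ 0ℚ
  m-nonzero π e = ℚ.<⇒≢ (ℚ.positive⁻¹ 1ℚ) (sym (trans (sym (m-hit π (word π) (sameKer λ _ _ → refl))) e))
  elimination = eliminate m word m-KerInv m-nonzero (comps n) (AllPairs-all (comps n) dichotomy) f f-inv
  L = proj₁ elimination
  agree : ∀ w → f w ≡ lincomb m L w
  agree w = let φ , φ∈ , ker = comps-complete w in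
    trans (f-inv w (word φ) ker) (trans (All.lookup (proj₂ (proj₂ elimination)) φ∈) (sym (KerInv-lincomb m-KerInv L w (word φ) ker)))

-- Membership in NCΠ

K-balanced : ∀ {n} (t : FinPoset n × Permutation′ n × Permutation′ n) → Balanced (K t)
K-balanced (P , γ , σ) = Kcore-balanced (λ a b → FinPoset.rel P a b ∧ not (a ==ᶠ b)) (λ x → toℕ (γ ⟨$⟩ʳ x)) (λ i → σ ⟨$⟩ˡ i)
  (λ i t → not-elim {(σ ⟨$⟩ˡ i) ==ᶠ (σ ⟨$⟩ˡ i)} (proj₂ (∧-elim {FinPoset.rel P (σ ⟨$⟩ˡ i) (σ ⟨$⟩ˡ i)} t)) (ℕ.≡⇒≡ᵇ (toℕ (σ ⟨$⟩ˡ i)) _ refl))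
  (λ i j ne e → ne (trans (sym (inverseʳ σ)) (trans (cong (σ ⟨$⟩ʳ_) (trans (sym (inverseˡ γ)) (trans (cong (γ ⟨$⟩ˡ_) (toℕ-injective e)) (inverseˡ γ)))) (inverseʳ σ))))

module _ {n ℓ : ℕ} (c : Fin n → Fin ℓ) where

  open Chain c

  -- The chain order is transported to the word positions themselves, which allows the identity to
  -- serve as `σ`.
  rankPoset : FinPoset n
  rankPoset = record
    { rel     = λ i j → rank c i ≤ᵇ rank c j
    ; refl    = λ i → ℕ.≤⇒≤ᵇ (ℕ.≤-refl {rank c i})
    ; antisym = λ i j p q → decidable-stable (i Fin.≟ j) (λ ne → rank-injective i j ne (ℕ.≤-antisym (ℕ.≤ᵇ⇒≤ _ _ p) (ℕ.≤ᵇ⇒≤ _ _ q)))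
    ; trans   = λ i j k p q → ℕ.≤⇒≤ᵇ (ℕ.≤-trans (ℕ.≤ᵇ⇒≤ (rank c i) (rank c j) p) (ℕ.≤ᵇ⇒≤ (rank c j) (rank c k) q))
    }

  module _ (C : Fin n → Bool) where

    open Labels C

    label : ∃ λ (π : Permutation′ n) → ∀ i → toℕ (π ⟨$⟩ʳ i) ≡ γ (rank c i)
    label = ranking⇒permutation (λ i → γ (rank c i)) (λ i → γ<n (rank<n i)) (λ i j ne → γ-injective (rank<n i) (rank<n j) (rank-injective i j ne))

    Kpk≡K : ∀ w → Kpk c C w ≡ K (rankPoset , proj₁ label , Perm.id) w
    Kpk≡K w = trans (Kcore-∑ _<ᵇ_ γ (rank c) w) (trans (∑-cong (bools n) (λ s → cong 𝟙 (allPairs-cong (λ i j →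
        cong₂ (λ b e → if b then e else true) (strict i j) (cong₂ (λ g g′ → enrᵇ (w i) (s i) g (w j) (s j) g′) (sym (proj₂ label i)) (sym (proj₂ label j)))))))
      (sym (Kcore-∑ (λ a b → (rank c a ≤ᵇ rank c b) ∧ not (a ==ᶠ b)) (λ x → toℕ (proj₁ label ⟨$⟩ʳ x)) (λ i → i) w)))
      where
      strict : ∀ i j → (rank c i <ᵇ rank c j) ≡ (rank c i ≤ᵇ rank c j) ∧ not (i ==ᶠ j)
      strict i j = bool-ext
        (λ t → let p = ℕ.<ᵇ⇒< (rank c i) (rank c j) t in
               ∧-intro (ℕ.≤⇒≤ᵇ (ℕ.<⇒≤ p)) (not-intro {i ==ᶠ j} (λ e → ℕ.<⇒≢ p (cong (rank c) (toℕ-injective (ℕ.≡ᵇ⇒≡ (toℕ i) (toℕ j) e))))))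
        (λ t → let p , q = ∧-elim {rank c i ≤ᵇ rank c j} t in
               ℕ.<⇒<ᵇ (ℕ.≤∧≢⇒< (ℕ.≤ᵇ⇒≤ (rank c i) (rank c j) p) (rank-injective i j (λ e → not-elim {i ==ᶠ j} q (ℕ.≡⇒≡ᵇ (toℕ i) (toℕ j) (cong toℕ e))))))

  η∈NCΠ : NCΠ n (η (ℓ , c))
  η∈NCΠ = InSpan-∑ (subsetsB c) (λ C w → sign C * Kpk c C w) (λ C → (sign C , rankPoset , proj₁ (label C) , Perm.id) ∷ [] , λ w →
      trans (cong (sign C *_) (Kpk≡K C w)) (sym (ℚ.+-identityʳ _)))
    where
    sign : (Fin n → Bool) → ℚ
    sign C = signℚ (count (inB c) (allFin n) ℕ.∸ count C (allFin n))

nn∈NCΠ : ∀ {n} (π : OddPart n) → NCΠ n (nn π)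
nn∈NCΠ π = InSpan-* (NN.sign₁ π) (InSpan-∑ (NN.reorderings π) η (λ φ → η∈NCΠ (proj₂ φ)))

-- Odd set partitions

partition : ∀ {n} → OddPart n → Word n
partition π = word (OddPart.comp π)

oddPart : ∀ {n} → SetComp n → List (OddPart n)
oddPart φ with Fin.all? (λ b → blockSize (SetComp.blk φ) b % 2 ℕ.≟ 1)
... | yes odd = record { comp = φ ; odd = odd } ∷ []
... | no _ = []

oddPart-complete : ∀ {n} (φ : SetComp n) → OddWord (word φ) → ∃ λ π → π ∈ oddPart φ × OddPart.comp π ≡ φ
oddPart-complete φ h with Fin.all? (λ b → blockSize (SetComp.blk φ) b % 2 ℕ.≟ 1)
... | yes odd = _ , here refl , refl
... | no ¬odd = ⊥-elim (¬odd (λ b → subst (λ b → blockSize (SetComp.blk φ) b % 2 ≡ 1) (proj₂ (SetComp.surj φ b))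
        (ℕ.≡ᵇ⇒≡ _ 1 (≡⇒T (h (proj₁ (SetComp.surj φ b)))))))

byEqualPairs : ℕ → DecTotalOrder _ _ _
byEqualPairs n = On.decTotalOrder ℕ.≤-decTotalOrder (λ (π : OddPart n) → μ (partition π))

-- Listing the finer partitions first makes the matrix triangular: a later n_ρ can be nonzero at an
-- earlier partition only if the two have the same blocks.
oddParts : ∀ n → List (OddPart n)
oddParts n = Sort.sort (byEqualPairs n) (concatMap oddPart (comps n))

oddParts-sorted : ∀ n → AllPairs (λ π ρ → μ (partition π) ℕ.≤ μ (partition ρ)) (oddParts n)
oddParts-sorted n = Linked.Linked⇒AllPairs ℕ.≤-trans (Sort.sort-↗ (byEqualPairs n) (concatMap oddPart (comps n)))

oddParts-complete : ∀ {n} (w : Word n) → OddWord w → ∃ λ π → π ∈ oddParts n × SameKer w (partition π)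
oddParts-complete {n} w odd =
  let φ , φ∈ , ker = comps-complete w
      π , π∈ , π≡ = oddPart-complete φ (λ i → trans (cong isOdd (count-cong (allFin n) (λ a → sym (≡ᵇ-≡ ker a i)))) (odd i))
  in π , ∈-resp-↭ (↭-sym (Sort.sort-↭ (byEqualPairs n) (concatMap oddPart (comps n)))) (∈-concatMap⁺ oddPart (lose φ∈ π∈))
     , subst (λ φ → SameKer w (word φ)) (sym π≡) ker

-- If n_ρ does not vanish at `π`, then `π` is constant on the blocks of `ρ`, and a coarser kernel
-- either has strictly more equal pairs or is the same.
nn-triangular : ∀ {n} (π ρ : OddPart n) → nn ρ (partition π) ≡ 0ℚ ⊎ (μ (partition ρ) ℕ.< μ (partition π) ⊎ SameKer (partition ρ) (partition π))
nn-triangular π ρ = map₂ μ-dichotomy (NN.nn-support ρ (partition π))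

-- Linear independence and spanning

∑-isolate : ∀ {A : Set} {R : A → A → Set} {L : List A} {a} (F : A → ℚ) → AllPairs R L → a ∈ L →
  (∀ {b} → b ∈ L → R a b ⊎ R b a → F b ≡ 0ℚ) → ∑ L F ≡ F a
∑-isolate {L = _ ∷ L} {a} F (d ∷ _) (here refl) h = trans (cong (F a +_) (trans (∑-cong-∈ L (λ b∈ → h (there b∈) (inj₁ (All.lookup d b∈)))) (∑-0 L))) (ℚ.+-identityʳ (F a))
∑-isolate {L = b ∷ L} {a} F (d ∷ ds) (there a∈) h = trans (cong₂ _+_ (h (here refl) (inj₂ (All.lookup d a∈))) (∑-isolate F ds a∈ (λ b∈ r → h (there b∈) r))) (ℚ.+-identityˡ (F a))

-- Evaluate at the word of `π`, by induction on `μ`. The terms with smaller `μ` have coefficient 0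
-- by induction, and every other term with different blocks vanishes there, which isolates the
-- coefficient of n_π.
nn-independent : ∀ {n} (L : List (ℚ × OddPart n)) → AllPairs (λ a b → ¬ SameOddPart (proj₂ a) (proj₂ b)) L →
  (∀ w → lincomb nn L w ≡ 0ℚ) → All (λ a → proj₁ a ≡ 0ℚ) L
nn-independent {n} L distinct zero-sum = All.tabulate (λ {a} a∈ → go a a∈ (<-wellFounded (level a)))
  where
  level : ℚ × OddPart n → ℕ
  level a = μ (partition (proj₂ a))
  go : ∀ a → a ∈ L → Acc ℕ._<_ (level a) → proj₁ a ≡ 0ℚ
  go (c , π) a∈ (acc rec) = cancel (NN.nn-nonzero π) (trans (ℚ.*-comm (nn π (partition π)) c) (trans (sym isolated) (zero-sum (partition π))))
    where
    others : ∀ {b} → b ∈ L → ¬ SameOddPart π (proj₂ b) ⊎ ¬ SameOddPart (proj₂ b) π → proj₁ b * nn (proj₂ b) (partition π) ≡ 0ℚ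
    others {b , ρ} b∈ ne = [ (λ z → trans (cong (b *_) z) (ℚ.*-zeroʳ b))
      , [ (λ lt → trans (cong (_* nn ρ (partition π)) (go (b , ρ) b∈ (rec lt))) (ℚ.*-zeroˡ (nn ρ (partition π))))
        , (λ ker → ⊥-elim ([ (λ k → k (sameBlocks-intro {φ = toRaw (OddPart.comp π)} {toRaw (OddPart.comp ρ)} (SameKer-sym ker)))
                           , (λ k → k (sameBlocks-intro {φ = toRaw (OddPart.comp ρ)} {toRaw (OddPart.comp π)} ker)) ]′ ne)) ]′
      ]′ (nn-triangular π ρ)
    isolated : lincomb nn L (partition π) ≡ c * nn π (partition π)
    isolated = ∑-isolate (λ b → proj₁ b * nn (proj₂ b) (partition π)) distinct a∈ others

-- Elimination makes a combination of the n_π agree with `s` at all odd words. The difference is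
-- still symmetric, and still balanced because each n_π lies in `NCΠ n`, so `vanishing` applies to
-- it.
nn-spans : ∀ {n} (s : Series n) → NCSym n s → NCΠ n s → InSpan nn s
nn-spans {n} s sym-s peak-s = L , λ w → x-y≡0⇒x≡y (vanishing {f = g} g-inv g-bal odd-zero w)
  where
  s-inv = KerInv-InSpan m-KerInv sym-s
  triangular : ∀ {π ρ : OddPart n} → μ (partition π) ℕ.≤ μ (partition ρ) → nn ρ (partition π) ≡ 0ℚ ⊎ SameKer (partition π) (partition ρ)
  triangular {π} {ρ} le = map₂ [ (λ lt → ⊥-elim (ℕ.<⇒≱ lt le)) , SameKer-sym ]′ (nn-triangular π ρ)
  elimination = eliminate nn partition NN.nn-symmetric NN.nn-nonzero (oddParts n) (AllPairs.map (λ {π} {ρ} → triangular {π} {ρ}) (oddParts-sorted n)) s s-inv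
  L = proj₁ elimination
  g : Series n
  g w = s w - lincomb nn L w
  g-inv : KerInv g
  g-inv w w′ ker = cong₂ _-_ (s-inv w w′ ker) (KerInv-lincomb NN.nn-symmetric L w w′ ker)
  g-bal : Balanced g
  g-bal = Balanced-minus {f = s} {lincomb nn L} (Balanced-InSpan K-balanced peak-s) (Balanced-lincomb {f = nn} (λ π → Balanced-InSpan K-balanced (nn∈NCΠ π)) L)
  odd-zero : ∀ w → OddWord w → g w ≡ 0ℚ
  odd-zero w odd = let π , π∈ , ker = oddParts-complete w odd in
    trans (g-inv w (partition π) ker) (trans (cong (_- lincomb nn L (partition π)) (All.lookup (proj₂ (proj₂ elimination)) π∈)) (ℚ.+-inverseʳ (lincomb nn L (partition π))))

theorem10p5 : (n : ℕ) →
    ((π : OddPart n) → NCSym n (nn π) × NCΠ n (nn π))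
    × ((L : List (ℚ × OddPart n))
    → AllPairs (λ a b → ¬ SameOddPart (proj₂ a) (proj₂ b)) L
    → (∀ w → lincomb nn L w ≡ 0ℚ)
    → All (λ a → proj₁ a ≡ 0ℚ) L)
    × ((s : Series n) → NCSym n s → NCΠ n s → InSpan nn s)
theorem10p5 n = (λ π → KerInv⇒NCSym (NN.nn-symmetric π) , nn∈NCΠ π) , nn-independent , nn-spans
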